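{- Let $\mathbf d$ be any degree sequence and let $\mathcal H$ be either of the two stub-labeled directed hypergraph spaces $\mathcal H^{\mathrm{stub}}_{s,d,m}(\mathbf d)$ or $\mathcal H^{\mathrm{stub}}_{s,m}(\mathbf d)$. Then for $k\to\infty$ the double hyperarc shuffling method with $k$ steps on $\mathcal H$ samples uniformly from $\mathcal H$; that is, for every initial directed hypergraph $H_0\in\mathcal H$, the outcome $H_k$ of the method converges in distribution, as $k\to\infty$, to the uniform distribution on $\mathcal H$.
   Context: **Directed hypergraphs.** A directed hypergraph $H=(V,A)$ consists of a finite vertex set $V$ and a finite multiset $A=A(H)$ of hyperarcs; a hyperarc is a pair $a=(a^{\mathrm t},a^{\mathrm h})$ of multisets of elements of $V$ (its tail and head). $m_s(v)$ denotes the multiplicity of $v$ in a multiset $s$, and $\uplus$ is multiset union with multiplicities added. A hyperarc $a$ is a self-loop if $a^{\mathrm t}=a^{\mathrm h}$; it is degenerate if some vertex has multiplicity at least $2$ in $a^{\mathrm t}$ or in $a^{\mathrm h}$. Two hyperarcs $a_1,a_2$ of $H$ are multi-hyperarcs if $a_1^{\mathrm t}=a_2^{\mathrm t}$ and $a_1^{\mathrm h}=a_2^{\mathrm h}$. **Degrees.** $d_v^{\mathrm{in}}=\sum_{a\in A}m_{a^{\mathrm h}}(v)$, $d_v^{\mathrm{out}}=\sum_{a\in A}m_{a^{\mathrm t}}(v)$, $\delta_a^{\mathrm t}=|a^{\mathrm t}|$, $\delta_a^{\mathrm h}=|a^{\mathrm h}|$ (cardinalities with multiplicity). The degree sequence is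 $\mathbf d=(\mathbf d_V,\boldsymbol\delta_A)$ with $\mathbf d_V=((d_v^{\mathrm{in}},d_v^{\mathrm{out}}))_{v\in V}$ and $\boldsymbol\delta_A=((\delta_a^{\mathrm t},\delta_a^{\mathrm h}))_{a\in A}$ (the hyperarcs carry no names, so $\boldsymbol\delta_A$ is considered up to reordering). A degree sequence includes the vertex set $V$. **Stub-labeled hypergraphs.** Each vertex $v$ has $d_v^{\mathrm{out}}$ distinct out-stubs and $d_v^{\mathrm{in}}$ distinct in-stubs. In a stub-labeled directed hypergraph the tail (head) of every hyperarc is a set of out-stubs (in-stubs), every out-stub lies in exactly one tail and every in-stub in exactly one head; two stub-labeled directed hypergraphs are the same iff their collections of linked stubs are the same. Self-loops, degenerate hyperarcs and multi-hyperarcs are determined using only the underlying vertices (each stub replaced by its vertex). **Spaces.** For $x\subseteq\{s,d,m\}$, $\mathcal H^{\mathrm{stub}}_x(\mathbf d)$ is the set of all stub-labeled directed hypergraphs with degree sequence $\mathbf d$ that do not contain those of the features $s$ (self-loops), $d$ (degenerate hyperarcs), $m$ (multi-hyperarcs) that are not in $x$. Thus $\mathcal H^{\mathrm{stub}}_{s,d,m}(\mathbf d)$ has no restriction, and $\mathcal H^{\mathrm{stub}}_{s,m}(\mathbf d)$ forbids exactly degenerate hyperarcs. **Double hyperarc shuffle.** For two distinct hyperarcs $a,b$ of $H$ (distinct elements of the multiset $A(H)$), $S(a,b)$ is the set of pairs $(\hat a,\hat b)$ with $a^{\mathrm t}\uplus b^{\mathrm t}=\hat a^{\mathrm t}\uplus\hat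 b^{\mathrm t}$, $a^{\mathrm h}\uplus b^{\mathrm h}=\hat a^{\mathrm h}\uplus\hat b^{\mathrm h}$, $(\delta_a^{\mathrm t},\delta_a^{\mathrm h})=(\delta_{\hat a}^{\mathrm t},\delta_{\hat a}^{\mathrm h})$, $(\delta_b^{\mathrm t},\delta_b^{\mathrm h})=(\delta_{\hat b}^{\mathrm t},\delta_{\hat b}^{\mathrm h})$; for stub-labeled hypergraphs tails and heads here are sets of stubs. The shuffle $s(a,b|H)$ picks $(\hat a,\hat b)\in S(a,b)$ uniformly at random and outputs $H'$ with $A(H')=(A(H)\setminus\{a,b\})\uplus\{\hat a,\hat b\}$. **Double hyperarc shuffling method with $k$ steps** on a space $\mathcal H$, from $H_0\in\mathcal H$: for $i=0,1,\dots,k-1$, pick an unordered pair of distinct hyperarcs $a_i,b_i$ of $H_i$ uniformly at random, perform $s(a_i,b_i|H_i)$ (all choices independent), and let $H_{i+1}$ be the result if it lies in $\mathcal H$, and $H_{i+1}=H_i$ otherwise. The outcome is $H_k$. It is understood that there are at least two hyperarcs. -}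

module Defs where

open import Data.Bool using (if_then_else_)
open import Data.Fin using (Fin; zero; suc)
import Data.Fin.Properties as Fin
open import Data.Fin.Subset using (Subset; inside; outside; _∈_; _∩_; ∣_∣)
  renaming (⊤ to full; ⊥ to empty)
open import Data.Fin.Subset.Properties using (_∈?_)
open import Data.Integer using (+_)
open import Data.List
  using (List; []; _∷_; _++_; map; filter; foldr; concatMap; length; lookup; deduplicate;
         cartesianProduct; cartesianProductWith)
import Data.List.Membership.DecPropositional as DecMembership
open import Data.List.Membership.Propositional using (_∉_) renaming (_∈_ to _∈ˡ_)
open import Data.List.Membership.Propositional.Properties using (∈-∃++)
open import Data.List.Relation.Binary.Permutation.Propositional
  using (_↭_; ↭-refl; ↭-sym; ↭-trans; prep)
open import Data.List.Relation.Binary.Permutation.Propositional.Properties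
  using (↭-empty-inv; ∈-resp-↭; drop-∷; shift)
open import Data.List.Relation.Unary.Any using (Any; any?; here)
open import Data.Nat as ℕ using (ℕ; zero; suc; _≤_; _≤?_)
import Data.Nat.Properties as ℕ
open import Data.Product using (∃-syntax; _×_; _,_; proj₁; proj₂; map₂)
open import Data.Product.Properties using () renaming (≡-dec to ×-≡-dec)
open import Data.Rational as ℚ using (ℚ; 0ℚ; 1ℚ)
open import Data.Sum using (_⊎_)
open import Data.Vec as Vec using (Vec; []; _∷_)
import Data.Bool.Properties as Bool
import Data.Vec.Properties as Vec
open import Function using (_∘_; case_of_)
open import Relation.Binary using (Decidable; DecidableEquality)
open import Relation.Binary.PropositionalEquality using (_≡_; _≢_; refl)
open import Relation.Nullary using (¬_; Dec; yes; no; does; ¬?; _×-dec_; _⊎-dec_; _→-dec_)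
open import Relation.Nullary.Decidable using (map′)
import Relation.Unary as Unary

-- A multiset of elements of Fin n is given by its multiplicities.
Multiset : ℕ → Set
Multiset n = Vec ℕ n

fromSubset : ∀ {n} → Subset n → Multiset n
fromSubset = Vec.map (λ b → if b then 1 else 0)

infixl 6 _⊎ᵐ_

_⊎ᵐ_ : ∀ {n} → Multiset n → Multiset n → Multiset n
_⊎ᵐ_ = Vec.zipWith ℕ._+_

_≟ᵐ_ : ∀ {n} → DecidableEquality (Multiset n)
_≟ᵐ_ = Vec.≡-dec ℕ._≟_

module _ {A : Set} (_≟_ : DecidableEquality A) where

  open DecMembership _≟_ using () renaming (_∈?_ to _∈ˡ?_)

  ↭-dec : Decidable (_↭_ {A = A})
  ↭-dec []       []       = yes ↭-refl
  ↭-dec []       (y ∷ ys) = no λ p → case ↭-empty-inv (↭-sym p) of λ ()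
  ↭-dec (x ∷ xs) ys with x ∈ˡ? ys
  ... | no x∉ys = no λ p → x∉ys (∈-resp-↭ p (here refl))
  ... | yes x∈ys with ∈-∃++ x∈ys
  ...   | as , bs , refl =
    map′ (λ p → ↭-trans (prep x p) (↭-sym (shift x as bs)))
         (λ p → drop-∷ (↭-trans p (shift x as bs)))
         (↭-dec xs (as ++ bs))

-- The probability of an outcome is the sum of the weights of all its
-- occurrences in the list.
Dist : Set → Set
Dist A = List (A × ℚ)

return : ∀ {A} → A → Dist A
return x = (x , 1ℚ) ∷ []

infixl 1 _>>=_

_>>=_ : ∀ {A B} → Dist A → (A → Dist B) → Dist B
μ >>= f = concatMap (λ (x , p) → map (λ (y , q) → y , p ℚ.* q) (f x)) μ

-- Each position of the list is equally likely.
uniform : ∀ {A} → List A → Dist A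
uniform []           = []
uniform xs@(_ ∷ xs′) = map (λ x → x , + 1 ℚ./ suc (length xs′)) xs

Pr : ∀ {A} {P : A → Set} → Unary.Decidable P → Dist A → ℚ
Pr P? μ = foldr ℚ._+_ 0ℚ (map proj₂ (filter (P? ∘ proj₁) μ))

_⟶_ : (ℕ → ℚ) → ℚ → Set
u ⟶ l = ∀ ε → 0ℚ ℚ.< ε → ∃[ K ] (∀ k → K ≤ k → ℚ.∣ u k ℚ.- l ∣ ℚ.< ε)

subsets : ∀ n → List (Subset n)
subsets zero    = [] ∷ []
subsets (suc n) = map (outside ∷_) (subsets n) ++ map (inside ∷_) (subsets n)

tuples : ∀ {A : Set} → ℕ → List A → List (List A)
tuples zero    xs = [] ∷ []
tuples (suc m) xs = cartesianProductWith _∷_ xs (tuples m xs)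

-- All ways to single out one position of a list, with the remaining entries.
picks : ∀ {A : Set} → List A → List (A × List A)
picks []       = []
picks (x ∷ xs) = (x , xs) ∷ map (map₂ (x ∷_)) (picks xs)

-- All ways to single out an unordered pair of distinct positions of a list,
-- with the remaining entries.
pairs : ∀ {A : Set} → List A → List (A × A × List A)
pairs []       = []
pairs (x ∷ xs) = map (x ,_) (picks xs) ++ map (map₂ (map₂ (x ∷_))) (pairs xs)

-- The vertex set is Fin n; δ lists the (tail size, head size) of the
-- hyperarcs, and only matters up to reordering.
record DegreeSequence : Set where
  field
    {n}      : ℕ
    dⁱⁿ dᵒᵘᵗ : Vec ℕ n
    δ        : List (ℕ × ℕ)

-- The stubs of all vertices are numbered consecutively, so that the set of
-- stubs is Fin (Vec.sum d); stubs d v is the set of the stubs of v.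
stubs : ∀ {n} (d : Vec ℕ n) → Fin n → Subset (Vec.sum d)
stubs (k ∷ d) zero    = full {k} Vec.++ empty
stubs (k ∷ d) (suc v) = empty {k} Vec.++ stubs d v

-- The multiset of vertices obtained by replacing each stub by its vertex.
vertices : ∀ {n} (d : Vec ℕ n) → Subset (Vec.sum d) → Multiset n
vertices d s = Vec.tabulate (λ v → ∣ s ∩ stubs d v ∣)

data Feature : Set where
  s d m : Feature

_≟ᶠ_ : DecidableEquality Feature
s ≟ᶠ s = yes refl
s ≟ᶠ d = no λ ()
s ≟ᶠ m = no λ ()
d ≟ᶠ s = no λ ()
d ≟ᶠ d = yes refl
d ≟ᶠ m = no λ ()
m ≟ᶠ s = no λ ()
m ≟ᶠ d = no λ ()
m ≟ᶠ m = yes refl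

∀ᶠ? : ∀ {P : Feature → Set} → Unary.Decidable P → Dec (∀ f → P f)
∀ᶠ? P? = map′ (λ { (p , q , r) → λ { s → p ; d → q ; m → r } })
              (λ p → p s , p d , p m)
              (P? s ×-dec P? d ×-dec P? m)

Arc : ℕ → Set
Arc n = Multiset n × Multiset n

SelfLoop : ∀ {n} → Arc n → Set
SelfLoop (t , h) = t ≡ h

Degenerate : ∀ {n} → Arc n → Set
Degenerate (t , h) = ∃[ v ] (2 ≤ Vec.lookup t v ⊎ 2 ≤ Vec.lookup h v)

HasMultiArcs : ∀ {n} → List (Arc n) → Set
HasMultiArcs A = ∃[ i ] ∃[ j ] (i ≢ j × lookup A i ≡ lookup A j)

Has : ∀ {n} → Feature → List (Arc n) → Set
Has s = Any SelfLoop
Has d = Any Degenerate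
Has m = HasMultiArcs

has? : ∀ {n} f (A : List (Arc n)) → Dec (Has f A)
has? s = any? λ (t , h) → t ≟ᵐ h
has? d = any? λ (t , h) → Fin.any? λ v →
           (2 ≤? Vec.lookup t v) ⊎-dec (2 ≤? Vec.lookup h v)
has? m A = Fin.any? λ i → Fin.any? λ j →
             ¬? (i Fin.≟ j) ×-dec ×-≡-dec _≟ᵐ_ _≟ᵐ_ (lookup A i) (lookup A j)

module Stub (𝐝 : DegreeSequence) where

  open DegreeSequence 𝐝

  OutStubs InStubs : ℕ
  OutStubs = Vec.sum dᵒᵘᵗ
  InStubs  = Vec.sum dⁱⁿ

  Hyperarc : Set
  Hyperarc = Subset OutStubs × Subset InStubs

  tail : Hyperarc → Subset OutStubs
  tail = proj₁

  head : Hyperarc → Subset InStubs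
  head = proj₂

  -- A list represents the multiset of its entries: two hypergraphs H and H′
  -- are the same when H ↭ H′.
  Hypergraph : Set
  Hypergraph = List Hyperarc

  _≟ᵃ_ : DecidableEquality Hyperarc
  _≟ᵃ_ = ×-≡-dec (Vec.≡-dec Bool._≟_) (Vec.≡-dec Bool._≟_)

  _↭?_ : Decidable (_↭_ {A = Hyperarc})
  _↭?_ = ↭-dec _≟ᵃ_

  size : Hyperarc → ℕ × ℕ
  size a = ∣ tail a ∣ , ∣ head a ∣

  underlying : Hyperarc → Arc n
  underlying a = vertices dᵒᵘᵗ (tail a) , vertices dⁱⁿ (head a)

  -- The vertex degrees are those of 𝐝 because every stub is used exactly once.
  record HasDegrees (H : Hypergraph) : Set where
    constructor mkHasDegrees
    field
      tails : ∀ i → length (filter (λ a → i ∈? tail a) H) ≡ 1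
      heads : ∀ i → length (filter (λ a → i ∈? head a) H) ≡ 1
      sizes : map size H ↭ δ

  hasDegrees? : Unary.Decidable HasDegrees
  hasDegrees? H =
    map′ (λ (t , h , p) → mkHasDegrees t h p)
         (λ (mkHasDegrees t h p) → t , h , p)
         (Fin.all? (λ i → length (filter (λ a → i ∈? tail a) H) ℕ.≟ 1)
          ×-dec Fin.all? (λ i → length (filter (λ a → i ∈? head a) H) ℕ.≟ 1)
          ×-dec ↭-dec (×-≡-dec ℕ._≟_ ℕ._≟_) (map size H) δ)

  -- The space of hypergraphs whose features are all among x.
  𝓗 : List Feature → Hypergraph → Set
  𝓗 x H = HasDegrees H × (∀ f → f ∉ x → ¬ Has f (map underlying H))

  𝓗? : ∀ x → Unary.Decidable (𝓗 x)
  𝓗? x H = hasDegrees? H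
    ×-dec ∀ᶠ? (λ f → ¬? (f ∈ˡ? x) →-dec ¬? (has? f (map underlying H)))
    where open DecMembership _≟ᶠ_ using () renaming (_∈?_ to _∈ˡ?_)

  hyperarcs : List Hyperarc
  hyperarcs = cartesianProduct (subsets OutStubs) (subsets InStubs)

  -- Every element of 𝓗 x exactly once up to ↭; a hypergraph in 𝓗 x has length δ hyperarcs.
  elements : List Feature → List Hypergraph
  elements x = deduplicate _↭?_ (filter (𝓗? x) (tuples (length δ) hyperarcs))

  _⇝_ : Hyperarc × Hyperarc → Hyperarc × Hyperarc → Set
  (a , b) ⇝ (â , b̂) =
    fromSubset (tail a) ⊎ᵐ fromSubset (tail b) ≡ fromSubset (tail â) ⊎ᵐ fromSubset (tail b̂) ×
    fromSubset (head a) ⊎ᵐ fromSubset (head b) ≡ fromSubset (head â) ⊎ᵐ fromSubset (head b̂) ×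
    size a ≡ size â ×
    size b ≡ size b̂

  _⇝?_ : Decidable _⇝_
  (a , b) ⇝? (â , b̂) =
    (_ ≟ᵐ _) ×-dec (_ ≟ᵐ _) ×-dec (size a ≟ˢ size â) ×-dec (size b ≟ˢ size b̂)
    where
    _≟ˢ_ : DecidableEquality (ℕ × ℕ)
    _≟ˢ_ = ×-≡-dec ℕ._≟_ ℕ._≟_

  S : Hyperarc → Hyperarc → List (Hyperarc × Hyperarc)
  S a b = filter ((a , b) ⇝?_) (cartesianProduct hyperarcs hyperarcs)

  -- The arguments are the hyperarcs to be shuffled and all other hyperarcs.
  shuffle : Hyperarc × Hyperarc × List Hyperarc → Dist Hypergraph
  shuffle (a , b , rest) = uniform (S a b) >>= λ (â , b̂) → return (â ∷ b̂ ∷ rest)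

  step : List Feature → Hypergraph → Dist Hypergraph
  step x H =
    uniform (pairs H) >>= λ p →
    shuffle p >>= λ H′ →
    return (if does (𝓗? x H′) then H′ else H)

  outcome : List Feature → ℕ → Hypergraph → Dist Hypergraph
  outcome x zero    H₀ = return H₀
  outcome x (suc k) H₀ = outcome x k H₀ >>= step x

  -- The state space is finite and discrete, so convergence in distribution is
  -- convergence of all point probabilities.
  _⟶ᵈ_ : (ℕ → Dist Hypergraph) → Dist Hypergraph → Set
  μ ⟶ᵈ ν = ∀ H → (λ k → Pr (_↭? H) (μ k)) ⟶ Pr (_↭? H) ν

{-# OPTIONS --safe #-}

-- The chain has finitely many states and may stand still, so Doeblin's argument
-- gives convergence to the uniform distribution once the chain is irreducible
-- and the uniform distribution is stationary.
--
-- Stationarity: for hypergraphs H and K that differ, the transition probability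
-- from H to K is a sum over a pair of hyperarcs of H and a pair of hyperarcs of
-- K, in which both pairs have the same union and the remaining hyperarcs agree.
-- This is symmetric, because the only hyperarc that can occur twice is the empty
-- one, and shuffling it changes nothing.
--
-- Irreducibility: regard the tails as a map from out-stubs to hyperarcs, and
-- change it into a target map by exchanging two stubs at a time (then likewise
-- the heads). The stubs are treated in order. If a stub lies in a but belongs in
-- b, then it can be exchanged with a later stub of b without creating two stubs
-- of one vertex in a hyperarc, provided b has at least as many untreated stubs
-- as a. Otherwise the target map can be changed instead, so that the stub
-- belongs in a.

module Submission where

open import Defs
import Algebra.Properties.CommutativeMonoid.Sum as Sum
open import Data.Bool using (true; if_then_else_)
open import Data.Fin as Fin using (Fin; zero; suc; toℕ; fromℕ<; punchIn; punchOut)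
open import Data.Fin.Permutation using (_⟨$⟩ʳ_; transpose)
import Data.Fin.Properties as Fin
open import Data.Fin.Subset using (Subset; inside; outside; _∈_; _∩_; ∣_∣; Nonempty)
  renaming (⊥ to empty)
import Data.Fin.Subset.Properties as Subset
open import Data.Fin.Subset.Properties using (_∈?_)
open import Data.Integer as ℤ using (-[1+_]) renaming (+_ to pos)
import Data.Integer.Properties as ℤ
open import Data.List
  using (List; []; _∷_; _++_; map; length; filter; lookup; tabulate; cartesianProduct; deduplicate)
open import Data.List.Membership.Propositional using (_∉_; find; lose) renaming (_∈_ to _∈ˡ_)
open import Data.List.Membership.Propositional.Properties
  using (∈-map⁺; ∈-map⁻; ∈-++⁻; ∈-++⁺ˡ; ∈-++⁺ʳ; ∈-filter⁺; ∈-filter⁻; ∈-lookup; ∈-∃++;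
         ∈-cartesianProduct⁺; ∈-cartesianProductWith⁺)
open import Data.List.Membership.Propositional.Properties.WithK using (unique∧set⇒bag)
import Data.List.Properties as List
open import Data.List.Relation.Binary.BagAndSetEquality using (∼bag⇒↭)
open import Data.List.Relation.Binary.Permutation.Propositional as ↭
  using (_↭_; ↭-refl; ↭-reflexive; ↭-sym; ↭-trans)
open import Data.List.Relation.Binary.Permutation.Propositional.Properties
  using (↭-length; ↭-map-inv; ∈-resp-↭; Any-resp-↭; filter-↭; map⁺; shift)
open import Data.List.Relation.Unary.All as All using (All)
import Data.List.Relation.Unary.All.Properties as All
open import Data.List.Relation.Unary.AllPairs as AllPairs using (AllPairs; []; _∷_)
import Data.List.Relation.Unary.AllPairs.Properties as AllPairs
open import Data.List.Relation.Unary.Any as Any using (Any; here; there)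
import Data.List.Relation.Unary.Any.Properties as Any
open import Data.List.Relation.Unary.Unique.Propositional using (Unique)
import Data.List.Relation.Unary.Unique.Propositional.Properties as Unique
open import Data.Nat as ℕ using (ℕ; zero; suc)
import Data.Nat.Properties as ℕ
open import Data.Product using (∃-syntax; _×_; _,_; proj₁; proj₂; map₂) renaming (swap to ×-swap)
open import Data.Product.Properties using () renaming (≡-dec to ×-≡-dec)
open import Data.Rational as ℚ using (ℚ; 0ℚ; 1ℚ)
import Data.Rational.Properties as ℚ
open import Data.Rational.Solver using (module +-*-Solver)
open import Data.Rational.Unnormalised as ℚᵘ using (mkℚᵘ; *≡*; *≤*)
import Data.Rational.Unnormalised.Properties as ℚᵘ
open import Data.Sum using (_⊎_; inj₁; inj₂)
open import Data.Vec as Vec using (Vec; []; _∷_)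
import Data.Vec.Properties as Vec
open import Function using (_∘_; case_of_; mk⇔)
open import Relation.Binary using (DecidableEquality)
open import Relation.Binary.PropositionalEquality
  using (_≡_; _≢_; _≗_; refl; sym; trans; cong; cong₂; subst; module ≡-Reasoning)
open import Relation.Nullary using (¬_; Dec; yes; no; does; contradiction; ¬?; _×-dec_)
import Relation.Unary as Unary

open Sum ℕ.+-0-commutativeMonoid using (sum; sum-cong-≗; sum-permute; sum-replicate-zero)
  renaming (∑-distrib-+ to sum-distrib-+; ∑-comm to sum-comm)

-- No quotient by `↭` is formed. The chain is known only through its action on functions, every test
-- function is invariant under `↭`, and `elements x` supplies one representative of each class.
-- Probabilities are rational, so the decay of the powers of `1 - c` is drawn from Bernoulli's
-- inequality and the Archimedean property.
--
-- The obstacle to irreducibility is nondegeneracy: putting a stub in place may force a second stub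
-- of some vertex into the other hyperarc. Changing the target is legitimate because shuffles are
-- reversible, so a path can be extended at either end. Both spaces are handled at once through an
-- owner map on stubs: the vertex where degenerate hyperarcs are forbidden, the stub itself where
-- they are allowed. The stubs of one owner are consecutive, which confines the pigeonhole argument
-- to untreated stubs. Tails and heads can be treated one after the other because neither space has
-- a condition that couples them.

module _ where

  open import Data.Rational using (_/_; _≤_; _<_; _+_; _*_; _-_; -_)
  open +-*-Solver using (solve; _:=_; _:+_; _:*_; :-_; con)

  -- Ordered field facts

  *-monoˡ : ∀ {p q r} → 0ℚ ≤ r → p ≤ q → r * p ≤ r * q
  *-monoˡ {r = r} 0≤r = ℚ.*-monoˡ-≤-nonNeg r {{ℚ.nonNegative 0≤r}}

  *-nonneg : ∀ {p q} → 0ℚ ≤ p → 0ℚ ≤ q → 0ℚ ≤ p * q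
  *-nonneg {p} {q} 0≤p 0≤q = subst (_≤ p * q) (ℚ.*-zeroʳ p) (*-monoˡ 0≤p 0≤q)

  *-pos : ∀ {p q} → 0ℚ < p → 0ℚ < q → 0ℚ < p * q
  *-pos {p} {q} 0<p 0<q = subst (_< p * q) (ℚ.*-zeroʳ p) (ℚ.*-monoʳ-<-pos p {{ℚ.positive 0<p}} 0<q)

  +-nonneg : ∀ {p q} → 0ℚ ≤ p → 0ℚ ≤ q → 0ℚ ≤ p + q
  +-nonneg = ℚ.+-mono-≤

  0≤1 : 0ℚ ≤ 1ℚ
  0≤1 = ℚ.nonNegative⁻¹ 1ℚ

  0<1 : 0ℚ < 1ℚ
  0<1 = ℚ.positive⁻¹ 1ℚ

  ≤⇒0≤- : ∀ {p q} → p ≤ q → 0ℚ ≤ q - p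
  ≤⇒0≤- {p} {q} p≤q = subst (_≤ q - p) (ℚ.+-inverseʳ p) (ℚ.+-monoˡ-≤ (- p) p≤q)

  0≤-⇒≤ : ∀ {p q} → 0ℚ ≤ q - p → p ≤ q
  0≤-⇒≤ {p} {q} 0≤ = ℚ.≤-trans (ℚ.≤-reflexive (sym (ℚ.+-identityˡ p)))
    (ℚ.≤-trans (ℚ.+-monoˡ-≤ p 0≤)
      (ℚ.≤-reflexive (solve 2 (λ p q → (q :+ :- p) :+ p := q) refl p q)))

  ≤-by-difference : ∀ {p q r} → q - p ≡ r → 0ℚ ≤ r → p ≤ q
  ≤-by-difference eq 0≤r = 0≤-⇒≤ (subst (0ℚ ≤_) (sym eq) 0≤r)

  ∣∣≤ : ∀ {p b} → - b ≤ p → p ≤ b → ℚ.∣ p ∣ ≤ b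
  ∣∣≤ {p} {b} -b≤p p≤b with ℚ.∣p∣≡p∨∣p∣≡-p p
  ... | inj₁ eq = subst (_≤ b) (sym eq) p≤b
  ... | inj₂ eq = subst (_≤ b) (sym eq)
    (subst (- p ≤_) (solve 1 (λ b → :- (:- b) := b) refl b) (ℚ.neg-antimono-≤ -b≤p))

  p≤∣p∣ : ∀ p → p ≤ ℚ.∣ p ∣
  p≤∣p∣ p with ℚ.≤-total 0ℚ p
  ... | inj₁ 0≤p = ℚ.≤-reflexive (sym (ℚ.0≤p⇒∣p∣≡p 0≤p))
  ... | inj₂ p≤0 = ℚ.≤-trans p≤0 (ℚ.0≤∣p∣ p)

  -∣p∣≤p : ∀ p → - ℚ.∣ p ∣ ≤ p
  -∣p∣≤p p = subst (- ℚ.∣ p ∣ ≤_) (solve 1 (λ b → :- (:- b) := b) refl p)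
    (ℚ.neg-antimono-≤ (subst (- p ≤_) (ℚ.∣-p∣≡∣p∣ p) (p≤∣p∣ (- p))))

  fromℕ : ℕ → ℚ
  fromℕ zero    = 0ℚ
  fromℕ (suc n) = 1ℚ + fromℕ n

  fromℕ-nonneg : ∀ n → 0ℚ ≤ fromℕ n
  fromℕ-nonneg zero    = ℚ.≤-refl
  fromℕ-nonneg (suc n) = +-nonneg 0≤1 (fromℕ-nonneg n)

  toℚᵘ-fromℕ : ∀ n → ℚ.toℚᵘ (fromℕ n) ℚᵘ.≃ mkℚᵘ (pos n) 0
  toℚᵘ-fromℕ zero    = ℚᵘ.≃-refl
  toℚᵘ-fromℕ (suc n) = ℚᵘ.≃-trans (ℚ.toℚᵘ-homo-+ 1ℚ (fromℕ n))
    (ℚᵘ.≃-trans (ℚᵘ.+-congʳ (ℚ.toℚᵘ 1ℚ) (toℚᵘ-fromℕ n)) (*≡* eq))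
    where
    eq : (pos 1 ℤ.* pos 1 ℤ.+ pos n ℤ.* pos 1) ℤ.* pos 1 ≡ pos (suc n) ℤ.* pos 1
    eq = cong (ℤ._* pos 1) (cong₂ ℤ._+_ {x = pos 1} refl (ℤ.*-identityʳ (pos n)))

  fromℕ-*-1/ : ∀ n → fromℕ (suc n) * (pos 1 / suc n) ≡ 1ℚ
  fromℕ-*-1/ n = ℚ.toℚᵘ-injective
    (ℚᵘ.≃-trans (ℚ.toℚᵘ-homo-* (fromℕ (suc n)) (pos 1 / suc n))
    (ℚᵘ.≃-trans (ℚᵘ.*-cong (toℚᵘ-fromℕ (suc n)) (ℚ.toℚᵘ-fromℚᵘ (mkℚᵘ (pos 1) n))) (*≡* eq)))
    where
    open ≡-Reasoning
    eq : (pos (suc n) ℤ.* pos 1) ℤ.* pos 1 ≡ pos 1 ℤ.* pos (suc n ℕ.+ 0)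
    eq = begin
      (pos (suc n) ℤ.* pos 1) ℤ.* pos 1   ≡⟨ ℤ.*-identityʳ _ ⟩
      pos (suc n) ℤ.* pos 1             ≡⟨ ℤ.*-identityʳ _ ⟩
      pos (suc n)                     ≡⟨ cong (λ n → pos n) (sym (ℕ.+-identityʳ _)) ⟩
      pos (suc n ℕ.+ 0)             ≡⟨ sym (ℤ.*-identityˡ _) ⟩
      pos 1 ℤ.* pos (suc n ℕ.+ 0)     ∎

  1/-pos : ∀ n → 0ℚ < pos 1 / suc n
  1/-pos n = ℚ.positive⁻¹ (pos 1 / suc n) {{ℚ.normalize-pos 1 (suc n)}}

  -- The denominator is at least one, so a nonnegative numerator is itself a bound.
  ≤fromℕ : ∀ q → ∃[ n ] q ≤ fromℕ n
  ≤fromℕ q@(ℚ.mkℚ (pos n) e _) = n , ℚ.toℚᵘ-cancel-≤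
    (ℚᵘ.≤-respʳ-≃ (ℚᵘ.≃-sym (toℚᵘ-fromℕ n)) (*≤* (ℤ.*-monoˡ-≤-nonNeg (pos n) (ℤ.+≤+ (ℕ.s≤s ℕ.z≤n)))))
  ≤fromℕ q@(ℚ.mkℚ -[1+ n ] e _) = 0 , ℚ.nonPositive⁻¹ q

  archimedean : ∀ q {r} → 0ℚ < r → ∃[ n ] q < fromℕ n * r
  archimedean q {r} 0<r = suc n , ℚ.≤-<-trans q≤ (ℚ.≤-<-trans (ℚ.≤-reflexive (sym (ℚ.+-identityˡ _)))
    (subst (0ℚ + fromℕ n * r <_) (solve 2 (λ r n → r :+ n :* r := (con 1ℚ :+ n) :* r) refl r (fromℕ n))
      (ℚ.+-monoˡ-< (fromℕ n * r) 0<r)))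
    where
    instance
      r≢0 = ℚ.pos⇒nonZero r {{ℚ.positive 0<r}}
    n = proj₁ (≤fromℕ (q * ℚ.1/ r))
    q≤ : q ≤ fromℕ n * r
    q≤ = subst (_≤ fromℕ n * r)
      (trans (ℚ.*-assoc q _ r) (trans (cong (q *_) (ℚ.*-inverseˡ r)) (ℚ.*-identityʳ q)))
      (ℚ.*-monoʳ-≤-nonNeg r {{ℚ.pos⇒nonNeg r {{ℚ.positive 0<r}}}} (proj₂ (≤fromℕ (q * ℚ.1/ r))))

  -- Sums over lists

  ∑ : ∀ {A : Set} → List A → (A → ℚ) → ℚ
  ∑ []       f = 0ℚ
  ∑ (x ∷ xs) f = f x + ∑ xs f

  module _ {A : Set} where

    ∑-cong : ∀ xs {f g : A → ℚ} → (∀ {x} → x ∈ˡ xs → f x ≡ g x) → ∑ xs f ≡ ∑ xs g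
    ∑-cong []       eq = refl
    ∑-cong (x ∷ xs) eq = cong₂ _+_ (eq (here refl)) (∑-cong xs (eq ∘ there))

    ∑-cong′ : ∀ xs {f g : A → ℚ} → (∀ x → f x ≡ g x) → ∑ xs f ≡ ∑ xs g
    ∑-cong′ xs eq = ∑-cong xs λ {x} _ → eq x

    ∑-mono : ∀ xs {f g : A → ℚ} → (∀ {x} → x ∈ˡ xs → f x ≤ g x) → ∑ xs f ≤ ∑ xs g
    ∑-mono []       le = ℚ.≤-refl
    ∑-mono (x ∷ xs) le = ℚ.+-mono-≤ (le (here refl)) (∑-mono xs (le ∘ there))

    ∑-0 : ∀ (xs : List A) → ∑ xs (λ _ → 0ℚ) ≡ 0ℚ
    ∑-0 []       = refl
    ∑-0 (x ∷ xs) = trans (ℚ.+-identityˡ _) (∑-0 xs)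

    ∑-zero : ∀ xs {f : A → ℚ} → (∀ {x} → x ∈ˡ xs → f x ≡ 0ℚ) → ∑ xs f ≡ 0ℚ
    ∑-zero xs eq = trans (∑-cong xs eq) (∑-0 xs)

    ∑-nonneg : ∀ xs {f : A → ℚ} → (∀ {x} → x ∈ˡ xs → 0ℚ ≤ f x) → 0ℚ ≤ ∑ xs f
    ∑-nonneg xs {f} le = subst (_≤ ∑ xs f) (∑-0 xs) (∑-mono xs le)

    ∑-const : ∀ (xs : List A) c → ∑ xs (λ _ → c) ≡ fromℕ (length xs) * c
    ∑-const []       c = sym (ℚ.*-zeroˡ c)
    ∑-const (x ∷ xs) c = trans (cong (c +_) (∑-const xs c))
      (solve 2 (λ c n → c :+ n :* c := (con 1ℚ :+ n) :* c) refl c (fromℕ (length xs)))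

    ∑-+ : ∀ xs (f g : A → ℚ) → ∑ xs (λ x → f x + g x) ≡ ∑ xs f + ∑ xs g
    ∑-+ []       f g = refl
    ∑-+ (x ∷ xs) f g = trans (cong (f x + g x +_) (∑-+ xs f g))
      (solve 4 (λ a b c e → (a :+ b) :+ (c :+ e) := (a :+ c) :+ (b :+ e)) refl
        (f x) (g x) (∑ xs f) (∑ xs g))

    ∑-*ˡ : ∀ xs c (f : A → ℚ) → ∑ xs (λ x → c * f x) ≡ c * ∑ xs f
    ∑-*ˡ []       c f = sym (ℚ.*-zeroʳ c)
    ∑-*ˡ (x ∷ xs) c f = trans (cong (c * f x +_) (∑-*ˡ xs c f)) (sym (ℚ.*-distribˡ-+ c (f x) (∑ xs f)))

    ∑-*ʳ : ∀ xs c (f : A → ℚ) → ∑ xs (λ x → f x * c) ≡ ∑ xs f * c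
    ∑-*ʳ xs c f = trans (∑-cong′ xs λ x → ℚ.*-comm (f x) c) (trans (∑-*ˡ xs c f) (ℚ.*-comm c _))

    ∑-++ : ∀ xs ys (f : A → ℚ) → ∑ (xs ++ ys) f ≡ ∑ xs f + ∑ ys f
    ∑-++ []       ys f = sym (ℚ.+-identityˡ _)
    ∑-++ (x ∷ xs) ys f = trans (cong (f x +_) (∑-++ xs ys f)) (sym (ℚ.+-assoc (f x) _ _))

    ∑-map : ∀ {B : Set} (h : B → A) xs (f : A → ℚ) → ∑ (map h xs) f ≡ ∑ xs (f ∘ h)
    ∑-map h []       f = refl
    ∑-map h (x ∷ xs) f = cong (f (h x) +_) (∑-map h xs f)

    ∑-↭ : ∀ {xs ys} (f : A → ℚ) → xs ↭ ys → ∑ xs f ≡ ∑ ys f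
    ∑-↭ f ↭.refl         = refl
    ∑-↭ f (↭.prep x p)   = cong (f x +_) (∑-↭ f p)
    ∑-↭ f (↭.swap x y p) = trans (cong (λ z → f x + (f y + z)) (∑-↭ f p))
      (solve 3 (λ a b c → a :+ (b :+ c) := b :+ (a :+ c)) refl (f x) (f y) _)
    ∑-↭ f (↭.trans p q)  = trans (∑-↭ f p) (∑-↭ f q)

    ∑-≥ : ∀ {x xs} {f : A → ℚ} → (∀ {y} → y ∈ˡ xs → 0ℚ ≤ f y) → x ∈ˡ xs → f x ≤ ∑ xs f
    ∑-≥ {xs = y ∷ xs} {f} le (here refl) = subst (_≤ f y + ∑ xs f) (ℚ.+-identityʳ (f y))
      (ℚ.+-monoʳ-≤ (f y) (∑-nonneg xs (le ∘ there)))
    ∑-≥ {xs = y ∷ xs} {f} le (there x∈) = ℚ.≤-trans (∑-≥ (le ∘ there) x∈)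
      (subst (_≤ f y + ∑ xs f) (ℚ.+-identityˡ (∑ xs f)) (ℚ.+-monoˡ-≤ (∑ xs f) (le (here refl))))

  ∑-comm : ∀ {A B : Set} xs ys (f : A → B → ℚ) →
           ∑ xs (λ x → ∑ ys (f x)) ≡ ∑ ys (λ y → ∑ xs (λ x → f x y))
  ∑-comm []       ys f = sym (∑-0 ys)
  ∑-comm (x ∷ xs) ys f = trans (cong (∑ ys (f x) +_) (∑-comm xs ys f))
    (sym (∑-+ ys (f x) (λ y → ∑ xs (λ x → f x y))))

  -- Convergence of finite Markov chains

  iterate : ∀ {F : Set} → (F → F) → ℕ → F → F
  iterate P zero    f = f
  iterate P (suc k) f = P (iterate P k f)

  iterate-+ : ∀ {F : Set} (P : F → F) j k f → iterate P (j ℕ.+ k) f ≡ iterate P j (iterate P k f)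
  iterate-+ P zero    k f = refl
  iterate-+ P (suc j) k f = cong P (iterate-+ P j k f)

  ⊓-pos : ∀ {p q} → 0ℚ < p → 0ℚ < q → 0ℚ < p ℚ.⊓ q
  ⊓-pos {p} {q} 0<p 0<q with ℚ.≤-total p q
  ... | inj₁ p≤q = subst (0ℚ <_) (sym (ℚ.p≤q⇒p⊓q≡p p≤q)) 0<p
  ... | inj₂ q≤p = subst (0ℚ <_) (sym (ℚ.p≥q⇒p⊓q≡q q≤p)) 0<q

  1≤length : ∀ {A : Set} {x : A} {xs} → x ∈ˡ xs → 1ℚ ≤ fromℕ (length xs)
  1≤length {xs = _ ∷ ys} _ = ℚ.≤-trans (ℚ.≤-reflexive (sym (ℚ.+-identityʳ 1ℚ)))
    (ℚ.+-monoʳ-≤ 1ℚ (fromℕ-nonneg (length ys)))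

  module _ {c : ℚ} (B : ℕ → ℚ) (B-suc : ∀ j → B (suc j) ≡ (1ℚ - c) * B j) (0≤B : ∀ j → 0ℚ ≤ B j)
           (0<c : 0ℚ < c) where

    -- (1 - c) (1 + (j + 1) c) ≤ 1 + j c
    bernoulli-decay : ∀ j → (1ℚ + fromℕ j * c) * B j ≤ B 0
    bernoulli-decay zero    = ℚ.≤-reflexive (solve 2 (λ c b → (con 1ℚ :+ con 0ℚ :* c) :* b := b) refl c (B 0))
    bernoulli-decay (suc j) = ℚ.≤-trans (≤-by-difference
      (trans (cong (λ b → (1ℚ + fromℕ j * c) * B j - (1ℚ + fromℕ (suc j) * c) * b) (B-suc j))
        (solve 3 (λ n c b →
            (con 1ℚ :+ n :* c) :* b :+ :- ((con 1ℚ :+ (con 1ℚ :+ n) :* c) :* ((con 1ℚ :+ :- c) :* b))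
            := (con 1ℚ :+ n) :* ((c :* c) :* b)) refl (fromℕ j) c (B j)))
      (*-nonneg (fromℕ-nonneg (suc j)) (*-nonneg (*-nonneg (ℚ.<⇒≤ 0<c) (ℚ.<⇒≤ 0<c)) (0≤B j))))
      (bernoulli-decay j)

    -- Bernoulli yields only a rate of order 1/j, which is enough: `j` is chosen with `B 0` below
    -- `j c ε`.
    geometric-decay : ∀ {ε} → 0ℚ < ε → ∃[ j ] B j < ε
    geometric-decay {ε} 0<ε = j , ℚ.≰⇒> λ ε≤B → ℚ.<-irrefl refl (begin-strict
      B 0                          <⟨ proj₂ large ⟩
      fromℕ j * (c * ε)            ≡⟨ ℚ.+-identityˡ _ ⟨
      0ℚ + fromℕ j * (c * ε)       ≤⟨ ℚ.+-monoˡ-≤ _ (ℚ.<⇒≤ 0<ε) ⟩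
      ε + fromℕ j * (c * ε)        ≡⟨ solve 3 (λ n c e → e :+ n :* (c :* e) := (con 1ℚ :+ n :* c) :* e)
                                        refl (fromℕ j) c ε ⟩
      (1ℚ + fromℕ j * c) * ε       ≤⟨ *-monoˡ (+-nonneg 0≤1 (*-nonneg (fromℕ-nonneg j) (ℚ.<⇒≤ 0<c))) ε≤B ⟩
      (1ℚ + fromℕ j * c) * B j     ≤⟨ bernoulli-decay j ⟩
      B 0                          ∎)
      where
      open ℚ.≤-Reasoning
      large = archimedean (B 0) (*-pos 0<c 0<ε)
      j = proj₁ large

  -- A chain is given by the action P of its transition kernel on functions:
  -- P f x is the expectation of f after one step from x. The states are the
  -- elements of 𝓢 up to _~_.
  module Kernel {X : Set} (_~_ : X → X → Set) (𝓢 : X → Set) (P : (X → ℚ) → X → ℚ) where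

    Invariant : (X → ℚ) → Set
    Invariant f = ∀ {x y} → x ~ y → f x ≡ f y

    Nonneg : (X → ℚ) → Set
    Nonneg f = ∀ {x} → 𝓢 x → 0ℚ ≤ f x

    -- Equivalently, the `k`-step transition probability from `x` to the class of `y` is positive.
    -- Phrased with test functions, such bounds compose without transition matrices.
    Minorises : ℕ → X → X → Set
    Minorises k x y = ∃[ c ] 0ℚ < c × (∀ {f} → Invariant f → Nonneg f → c * f y ≤ iterate P k f x)

  record UniformChain {X : Set} (_~_ : X → X → Set) (𝓢 : X → Set) (els : List X) : Set₁ where

    field
      P : (X → ℚ) → X → ℚ

    open Kernel _~_ 𝓢 P public

    field
      els⊆𝓢      : ∀ {x} → x ∈ˡ els → 𝓢 x
      𝓢⊆els      : ∀ {x} → 𝓢 x → ∃[ y ] y ∈ˡ els × x ~ y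
      P-inv      : ∀ {f} → Invariant f → Invariant (P f)
      P-mono     : ∀ {f g} → (∀ {x} → 𝓢 x → f x ≤ g x) → ∀ {x} → 𝓢 x → P f x ≤ P g x
      -- Combines homogeneity with total probability one, the case `c = 0`.
      P-affine   : ∀ b c f {x} → 𝓢 x → P (λ y → b + c * f y) x ≡ b + c * P f x
      stationary : ∀ {f} → Invariant f → ∑ els (P f) ≡ ∑ els f
      lazy       : ∀ {x} → 𝓢 x → Minorises 1 x x

    P-cong : ∀ {f g} → (∀ {x} → 𝓢 x → f x ≡ g x) → ∀ {x} → 𝓢 x → P f x ≡ P g x
    P-cong eq 𝓢x = ℚ.≤-antisym (P-mono (ℚ.≤-reflexive ∘ eq) 𝓢x)
                               (P-mono (λ 𝓢y → ℚ.≤-reflexive (sym (eq 𝓢y))) 𝓢x)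

    P-const : ∀ b {x} → 𝓢 x → P (λ _ → b) x ≡ b
    P-const b {x} 𝓢x = begin
      P (λ _ → b) x                ≡⟨ P-cong (λ _ → sym (b+0*1≡b)) 𝓢x ⟩
      P (λ _ → b + 0ℚ * 1ℚ) x      ≡⟨ P-affine b 0ℚ (λ _ → 1ℚ) 𝓢x ⟩
      b + 0ℚ * P (λ _ → 1ℚ) x      ≡⟨ cong (b +_) (ℚ.*-zeroˡ (P (λ _ → 1ℚ) x)) ⟩
      b + 0ℚ                       ≡⟨ ℚ.+-identityʳ b ⟩
      b                            ∎
      where
      open ≡-Reasoning
      b+0*1≡b : b + 0ℚ * 1ℚ ≡ b
      b+0*1≡b = trans (cong (b +_) (ℚ.*-zeroˡ 1ℚ)) (ℚ.+-identityʳ b)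

    P^ : ℕ → (X → ℚ) → X → ℚ
    P^ = iterate P

    P^-inv : ∀ k {f} → Invariant f → Invariant (P^ k f)
    P^-inv zero    inv = inv
    P^-inv (suc k) inv = P-inv (P^-inv k inv)

    P^-mono : ∀ k {f g} → (∀ {x} → 𝓢 x → f x ≤ g x) → ∀ {x} → 𝓢 x → P^ k f x ≤ P^ k g x
    P^-mono zero    le = le
    P^-mono (suc k) le = P-mono (P^-mono k le)

    P^-affine : ∀ k b c f {x} → 𝓢 x → P^ k (λ y → b + c * f y) x ≡ b + c * P^ k f x
    P^-affine zero    b c f 𝓢x = refl
    P^-affine (suc k) b c f 𝓢x = trans (P-cong (P^-affine k b c f) 𝓢x) (P-affine b c (P^ k f) 𝓢x)

    P^-const : ∀ k b {x} → 𝓢 x → P^ k (λ _ → b) x ≡ b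
    P^-const zero    b 𝓢x = refl
    P^-const (suc k) b 𝓢x = trans (P-cong (P^-const k b) 𝓢x) (P-const b 𝓢x)

    P^-nonneg : ∀ k {f} → Nonneg f → Nonneg (P^ k f)
    P^-nonneg k {f} 0≤f {x} 𝓢x = subst (_≤ P^ k f x) (P^-const k 0ℚ 𝓢x) (P^-mono k 0≤f 𝓢x)

    P^-stationary : ∀ k {f} → Invariant f → ∑ els (P^ k f) ≡ ∑ els f
    P^-stationary zero    inv = refl
    P^-stationary (suc k) inv = trans (stationary (P^-inv k inv)) (P^-stationary k inv)

    -- The Chapman-Kolmogorov inequality: the first bound is applied to `P^ k f`, which is again
    -- invariant and nonnegative.
    minorises-trans : ∀ {j k x y z} → Minorises j x y → Minorises k y z → Minorises (j ℕ.+ k) x z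
    minorises-trans {j} {k} {x} {y} {z} (b , 0<b , x≥y) (c , 0<c , y≥z) =
      b * c , *-pos 0<b 0<c , λ {f} inv 0≤f → begin
        b * c * f z          ≡⟨ ℚ.*-assoc b c (f z) ⟩
        b * (c * f z)        ≤⟨ *-monoˡ (ℚ.<⇒≤ 0<b) (y≥z inv 0≤f) ⟩
        b * P^ k f y         ≤⟨ x≥y (P^-inv k inv) (P^-nonneg k 0≤f) ⟩
        P^ j (P^ k f) x      ≡⟨ cong (λ g → g x) (iterate-+ P j k f) ⟨
        P^ (j ℕ.+ k) f x     ∎
      where open ℚ.≤-Reasoning

    -- A lower bound after k steps survives any further number of steps, because
    -- the chain may stand still.
    minorises-later : ∀ j {k x} → 𝓢 x → (F : (X → ℚ) → ℚ) →
      ∃[ c ] 0ℚ < c × (∀ {f} → Invariant f → Nonneg f → c * F f ≤ P^ k f x) →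
      ∃[ c ] 0ℚ < c × (∀ {f} → Invariant f → Nonneg f → c * F f ≤ P^ (j ℕ.+ k) f x)
    minorises-later zero    𝓢x F bound = bound
    minorises-later (suc j) {k} {x} 𝓢x F bound with minorises-later j 𝓢x F bound | lazy 𝓢x
    ... | c , 0<c , x≥F | b , 0<b , x≥x =
      b * c , *-pos 0<b 0<c , λ {f} inv 0≤f → begin
        b * c * F f               ≡⟨ ℚ.*-assoc b c (F f) ⟩
        b * (c * F f)             ≤⟨ *-monoˡ (ℚ.<⇒≤ 0<b) (x≥F inv 0≤f) ⟩
        b * P^ (j ℕ.+ k) f x      ≤⟨ x≥x (P^-inv (j ℕ.+ k) inv) (P^-nonneg (j ℕ.+ k) 0≤f) ⟩
        P^ (suc j ℕ.+ k) f x      ∎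
      where open ℚ.≤-Reasoning

    module _ (irreducible : ∀ {x y} → 𝓢 x → 𝓢 y → ∃[ k ] Minorises k x y) where

      -- Different targets are reached after different numbers of steps. Standing still postpones
      -- the two bounds to the common time `j + k`, where they can be averaged.
      minorises-∑ : ∀ {x} → 𝓢 x → ∀ ys → (∀ {y} → y ∈ˡ ys → 𝓢 y) →
        ∃[ k ] ∃[ c ] 0ℚ < c × (∀ {f} → Invariant f → Nonneg f → c * ∑ ys f ≤ P^ k f x)
      minorises-∑ {x} 𝓢x [] _ = 0 , 1ℚ , 0<1 , λ {f} inv 0≤f → subst (_≤ f x) (sym (ℚ.*-zeroʳ 1ℚ)) (0≤f 𝓢x)
      minorises-∑ {x} 𝓢x (y ∷ ys) 𝓢ys
        with irreducible 𝓢x (𝓢ys (here refl)) | minorises-∑ 𝓢x ys (𝓢ys ∘ there)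
      ... | j , x≥y | k , x≥ys
        with minorises-later k {j} 𝓢x (λ f → f y) x≥y | minorises-later j {k} 𝓢x (λ f → ∑ ys f) x≥ys
      ... | b , 0<b , x≥y′ | c , 0<c , x≥ys′ =
        -- Both bounds have the same right side `F`, so adding them gives `F + F`; the factor one
        -- half compensates.
        j ℕ.+ k , ℚ.½ * (b ℚ.⊓ c) , *-pos (ℚ.positive⁻¹ ℚ.½) (⊓-pos 0<b 0<c) , λ {f} inv 0≤f →
          let open ℚ.≤-Reasoning
              F = P^ (j ℕ.+ k) f x
          in begin
          ℚ.½ * (b ℚ.⊓ c) * (f y + ∑ ys f)
            ≡⟨ solve 4 (λ h m u v → h :* m :* (u :+ v) := h :* (u :* m :+ v :* m))
                 refl ℚ.½ (b ℚ.⊓ c) (f y) (∑ ys f) ⟩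
          ℚ.½ * (f y * (b ℚ.⊓ c) + ∑ ys f * (b ℚ.⊓ c))
            ≤⟨ *-monoˡ (ℚ.nonNegative⁻¹ ℚ.½) (ℚ.+-mono-≤
                 (*-monoˡ (0≤f (𝓢ys (here refl))) (ℚ.p⊓q≤p b c))
                 (*-monoˡ (∑-nonneg ys (0≤f ∘ 𝓢ys ∘ there)) (ℚ.p⊓q≤q b c))) ⟩
          ℚ.½ * (f y * b + ∑ ys f * c)
            ≡⟨ cong₂ (λ u v → ℚ.½ * (u + v)) (ℚ.*-comm (f y) b) (ℚ.*-comm (∑ ys f) c) ⟩
          ℚ.½ * (b * f y + c * ∑ ys f)
            ≤⟨ *-monoˡ (ℚ.nonNegative⁻¹ ℚ.½) (ℚ.+-mono-≤
                 (subst (λ l → b * f y ≤ P^ l f x) (ℕ.+-comm k j) (x≥y′ inv 0≤f))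
                 (x≥ys′ inv 0≤f)) ⟩
          ℚ.½ * (F + F)
            ≡⟨ solve 1 (λ u → con ℚ.½ :* (u :+ u) := u) refl F ⟩
          F ∎

      *-weaken : ∀ {a b r v} → a ≤ b → 0ℚ ≤ r → b * r ≤ v → a * r ≤ v
      *-weaken {a} {b} {r} a≤b 0≤r = ℚ.≤-trans (ℚ.*-monoʳ-≤-nonNeg r {{ℚ.nonNegative 0≤r}} a≤b)

      ∑els-nonneg : ∀ {f} → Nonneg f → 0ℚ ≤ ∑ els f
      ∑els-nonneg 0≤f = ∑-nonneg els (0≤f ∘ els⊆𝓢)

      -- The contraction below uses one fixed number of steps, so all starting states need a common
      -- time and a common constant.
      minorises-uniformly : ∀ ys → (∀ {y} → y ∈ˡ ys → 𝓢 y) →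
        ∃[ k ] ∃[ c ] 0ℚ < c × (∀ {y} → y ∈ˡ ys → ∀ {f} → Invariant f → Nonneg f → c * ∑ els f ≤ P^ k f y)
      minorises-uniformly [] _ = 0 , 1ℚ , 0<1 , λ ()
      minorises-uniformly (y ∷ ys) 𝓢ys
        with minorises-∑ (𝓢ys (here refl)) els els⊆𝓢 | minorises-uniformly ys (𝓢ys ∘ there)
      ... | j , y≥ | k , c₀ , 0<c₀ , ys≥ = go (minorises-later k {j} (𝓢ys (here refl)) (∑ els) y≥)
        where
        -- Postponing costs each state its own factor, so the minimum over the states already
        -- treated has to be taken afresh.
        laterAll : ∀ zs → (∀ {z} → z ∈ˡ zs → z ∈ˡ ys) →
          ∃[ c ] 0ℚ < c × (∀ {z} → z ∈ˡ zs → ∀ {f} → Invariant f → Nonneg f → c * ∑ els f ≤ P^ (j ℕ.+ k) f z)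
        laterAll [] _ = 1ℚ , 0<1 , λ ()
        laterAll (z ∷ zs) zs⊆ys
          with minorises-later j {k} (𝓢ys (there (zs⊆ys (here refl)))) (∑ els)
                 (c₀ , 0<c₀ , ys≥ (zs⊆ys (here refl)))
             | laterAll zs (zs⊆ys ∘ there)
        ... | b , 0<b , z≥ | c , 0<c , zs≥ = b ℚ.⊓ c , ⊓-pos 0<b 0<c , λ where
          (here refl) inv 0≤f → *-weaken (ℚ.p⊓q≤p b c) (∑els-nonneg 0≤f) (z≥ inv 0≤f)
          (there z∈)  inv 0≤f → *-weaken (ℚ.p⊓q≤q b c) (∑els-nonneg 0≤f) (zs≥ z∈ inv 0≤f)
        go : ∃[ c ] 0ℚ < c × (∀ {f} → Invariant f → Nonneg f → c * ∑ els f ≤ P^ (k ℕ.+ j) f y) →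
          ∃[ k ] ∃[ c ] 0ℚ < c ×
            (∀ {z} → z ∈ˡ y ∷ ys → ∀ {f} → Invariant f → Nonneg f → c * ∑ els f ≤ P^ k f z)
        go (b , 0<b , y≥′) with laterAll ys (λ z∈ → z∈)
        ... | c , 0<c , ys≥′ = j ℕ.+ k , b ℚ.⊓ c , ⊓-pos 0<b 0<c , λ where
          (here refl) {f} inv 0≤f → *-weaken (ℚ.p⊓q≤p b c) (∑els-nonneg 0≤f)
            (subst (λ l → b * ∑ els f ≤ P^ l f y) (ℕ.+-comm k j) (y≥′ inv 0≤f))
          (there z∈)  inv 0≤f → *-weaken (ℚ.p⊓q≤q b c) (∑els-nonneg 0≤f) (ys≥′ z∈ inv 0≤f)

      doeblin : ∃[ k ] ∃[ c ] 0ℚ < c ×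
        (∀ {x f} → 𝓢 x → Invariant f → Nonneg f → c * ∑ els f ≤ P^ k f x)
      doeblin with minorises-uniformly els els⊆𝓢
      ... | k , c , 0<c , bound = k , c , 0<c , λ {x} {f} 𝓢x inv 0≤f →
        let (y , y∈ , x~y) = 𝓢⊆els 𝓢x
        in subst (c * ∑ els f ≤_) (sym (P^-inv k inv x~y)) (bound y∈ inv 0≤f)

      Bounded : ℚ → (X → ℚ) → Set
      Bounded b f = ∀ {x} → 𝓢 x → - b ≤ f x × f x ≤ b

      P^-bounded : ∀ k {b f} → Bounded b f → Bounded b (P^ k f)
      P^-bounded k {b} {f} bnd {x} 𝓢x =
        subst (_≤ P^ k f x) (P^-const k (- b) 𝓢x) (P^-mono k (λ 𝓢y → proj₁ (bnd 𝓢y)) 𝓢x) ,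
        subst (P^ k f x ≤_) (P^-const k b 𝓢x) (P^-mono k (λ 𝓢y → proj₂ (bnd 𝓢y)) 𝓢x)

      N : ℚ
      N = fromℕ (length els)

      1≤N : ∀ {x} → 𝓢 x → 1ℚ ≤ N
      1≤N 𝓢x = 1≤length (proj₁ (proj₂ (𝓢⊆els 𝓢x)))

      -- The minorisation is applied to b + e f, which is nonnegative and has sum b N.
      contracts-below : ∀ e {k c} → 0ℚ < c →
        (∀ {x f} → 𝓢 x → Invariant f → Nonneg f → c * ∑ els f ≤ P^ k f x) →
        ∀ {b f} → Invariant f → ∑ els f ≡ 0ℚ → (∀ {x} → 𝓢 x → 0ℚ ≤ b + e * f x) → 0ℚ ≤ b →
        ∀ {x} → 𝓢 x → - ((1ℚ - c) * b) ≤ e * P^ k f x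
      contracts-below e {k} {c} 0<c minor {b} {f} inv ∑f≡0 0≤ 0≤b {x} 𝓢x = ≤-by-difference eq
        (+-nonneg (≤⇒0≤- (minor {x} {λ y → b + e * f y} 𝓢x (λ x~y → cong (λ v → b + e * v) (inv x~y)) 0≤))
                  (*-nonneg (ℚ.<⇒≤ 0<c) (*-nonneg 0≤b (≤⇒0≤- (1≤N 𝓢x)))))
        where
        open ≡-Reasoning
        ∑≡ : ∑ els (λ y → b + e * f y) ≡ N * b
        ∑≡ = begin
          ∑ els (λ y → b + e * f y)               ≡⟨ ∑-+ els (λ _ → b) (λ y → e * f y) ⟩
          ∑ els (λ _ → b) + ∑ els (λ y → e * f y) ≡⟨ cong₂ _+_ (∑-const els b) (∑-*ˡ els e f) ⟩
          N * b + e * ∑ els f                     ≡⟨ cong (λ v → N * b + e * v) ∑f≡0 ⟩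
          N * b + e * 0ℚ                          ≡⟨ cong (N * b +_) (ℚ.*-zeroʳ e) ⟩
          N * b + 0ℚ                              ≡⟨ ℚ.+-identityʳ _ ⟩
          N * b                                   ∎
        -- The minorisation would give the factor `1 - c N`; the surplus `c b (N - 1)` is discarded,
        -- as `N` is at least one.
        eq : e * P^ k f x - - ((1ℚ - c) * b) ≡
             (P^ k (λ y → b + e * f y) x - c * ∑ els (λ y → b + e * f y)) + c * (b * (N - 1ℚ))
        eq = begin
          e * P^ k f x - - ((1ℚ - c) * b)
            ≡⟨ solve 4 (λ v c b n → v :+ :- (:- ((con 1ℚ :+ :- c) :* b)) :=
                 ((b :+ v) :+ :- (c :* (n :* b))) :+ c :* (b :* (n :+ :- con 1ℚ)))
                 refl (e * P^ k f x) c b N ⟩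
          ((b + e * P^ k f x) - c * (N * b)) + c * (b * (N - 1ℚ))
            ≡⟨ cong₂ (λ u v → (u - c * v) + c * (b * (N - 1ℚ))) (P^-affine k b e f 𝓢x) ∑≡ ⟨
          (P^ k (λ y → b + e * f y) x - c * ∑ els (λ y → b + e * f y)) + c * (b * (N - 1ℚ)) ∎

      -- `contracts-below` with sign `e = 1` bounds from below, and with `e = - 1` from above.
      contracts : ∀ {k c} → 0ℚ < c →
        (∀ {x f} → 𝓢 x → Invariant f → Nonneg f → c * ∑ els f ≤ P^ k f x) →
        ∀ {b f} → Invariant f → ∑ els f ≡ 0ℚ → Bounded b f → 0ℚ ≤ b → Bounded ((1ℚ - c) * b) (P^ k f)
      contracts {k} {c} 0<c minor {b} {f} inv ∑f≡0 bnd 0≤b {x} 𝓢x =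
        subst (- B ≤_) (ℚ.*-identityˡ (P^ k f x))
          (contracts-below 1ℚ {k} 0<c minor inv ∑f≡0
            (λ {y} 𝓢y → subst (0ℚ ≤_) (solve 2 (λ b v → v :+ :- (:- b) := b :+ con 1ℚ :* v) refl b (f y))
              (≤⇒0≤- (proj₁ (bnd 𝓢y)))) 0≤b 𝓢x) ,
        ≤-by-difference (solve 2 (λ b v → b :+ :- v := con (- 1ℚ) :* v :+ :- (:- b)) refl B (P^ k f x))
          (≤⇒0≤- (contracts-below (- 1ℚ) {k} 0<c minor inv ∑f≡0
            (λ {y} 𝓢y → subst (0ℚ ≤_) (solve 2 (λ b v → b :+ :- v := b :+ con (- 1ℚ) :* v) refl b (f y))
              (≤⇒0≤- (proj₂ (bnd 𝓢y)))) 0≤b 𝓢x))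
        where
        B = (1ℚ - c) * b

      -- Comparing `- b` with `b` through the value at one state suffices. This keeps the shrinking
      -- bounds nonnegative without a separate estimate of `c`.
      bounded-nonneg : ∀ {b f x} → 𝓢 x → Bounded b f → 0ℚ ≤ b
      bounded-nonneg {b} 𝓢x bnd with ℚ.≤-total 0ℚ b
      ... | inj₁ 0≤b = 0≤b
      ... | inj₂ b≤0 = ℚ.≤-trans (subst (0ℚ ≤_) refl (ℚ.neg-antimono-≤ b≤0))
                         (ℚ.≤-trans (proj₁ (bnd 𝓢x)) (proj₂ (bnd 𝓢x)))

      mean-zero-decays : ∀ {f} → Invariant f → ∑ els f ≡ 0ℚ → ∀ {x} → 𝓢 x → (λ k → P^ k f x) ⟶ 0ℚ
      mean-zero-decays {f} inv ∑f≡0 {x} 𝓢x ε 0<ε with doeblin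
      ... | K , c , 0<c , minor = proj₁ small ℕ.* K , λ k JK≤k → small-at k JK≤k
        where
        -- The sum stands in for a maximum; it bounds `f` on all of `𝓢` because every state has a
        -- representative in `els`.
        B₀ : ℚ
        B₀ = ∑ els (λ y → ℚ.∣ f y ∣)

        bounded₀ : Bounded B₀ f
        bounded₀ {y} 𝓢y with 𝓢⊆els 𝓢y
        ... | z , z∈ , y~z =
          ℚ.≤-trans (ℚ.neg-antimono-≤ ∣fy∣≤) (-∣p∣≤p (f y)) , ℚ.≤-trans (p≤∣p∣ (f y)) ∣fy∣≤
          where
          ∣fy∣≤ : ℚ.∣ f y ∣ ≤ B₀
          ∣fy∣≤ = subst (λ v → ℚ.∣ v ∣ ≤ B₀) (sym (inv y~z)) (∑-≥ (λ _ → ℚ.0≤∣p∣ _) z∈)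

        B : ℕ → ℚ
        B zero    = B₀
        B (suc j) = (1ℚ - c) * B j

        bounded : ∀ j → Bounded (B j) (P^ (j ℕ.* K) f)
        bounded zero    = bounded₀
        bounded (suc j) = subst (Bounded (B (suc j))) (sym (iterate-+ P K (j ℕ.* K) f))
          (contracts {K} 0<c minor (P^-inv (j ℕ.* K) inv) (trans (P^-stationary (j ℕ.* K) inv) ∑f≡0)
            (bounded j) (bounded-nonneg 𝓢x (bounded j)))

        small : ∃[ J ] B J < ε
        small = geometric-decay B (λ _ → refl) (λ j → bounded-nonneg 𝓢x (bounded j)) 0<c 0<ε

        small-at : ∀ k → proj₁ small ℕ.* K ℕ.≤ k → ℚ.∣ P^ k f x - 0ℚ ∣ < ε
        small-at k JK≤k = ℚ.≤-<-trans
          (∣∣≤ (subst (- B J ≤_) (sym eq) (proj₁ bnd)) (subst (_≤ B J) (sym eq) (proj₂ bnd)))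
          (proj₂ small)
          where
          J = proj₁ small
          -- Contraction is known only at multiples of `K`; the remaining `r` steps do not enlarge
          -- the bound.
          r = k ℕ.∸ J ℕ.* K
          bnd = P^-bounded r (bounded J) 𝓢x
          eq : P^ k f x - 0ℚ ≡ P^ r (P^ (J ℕ.* K) f) x
          eq = trans (ℚ.+-identityʳ _) (trans (cong (λ l → P^ l f x) (sym (ℕ.m∸n+n≡m JK≤k)))
                 (cong (λ g → g x) (iterate-+ P r (J ℕ.* K) f)))

      -- Subtracting the mean `π` reduces to `mean-zero-decays`; `g` is written with the factor `1ℚ`
      -- to fit `P^-affine`.
      converges : ∀ {f w} → Invariant f → N * w ≡ 1ℚ → ∀ {x} → 𝓢 x → (λ k → P^ k f x) ⟶ (w * ∑ els f)
      converges {f} {w} inv Nw≡1 {x} 𝓢x ε 0<ε =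
        proj₁ decays , λ k K≤k → subst (λ v → ℚ.∣ v ∣ < ε) (eq k) (proj₂ decays k K≤k)
        where
        open ≡-Reasoning
        π = w * ∑ els f
        g = λ y → - π + 1ℚ * f y
        g-inv : Invariant g
        g-inv x~y = cong (λ v → - π + 1ℚ * v) (inv x~y)
        ∑g≡0 : ∑ els g ≡ 0ℚ
        ∑g≡0 = begin
          ∑ els g                                    ≡⟨ ∑-+ els (λ _ → - π) (λ y → 1ℚ * f y) ⟩
          ∑ els (λ _ → - π) + ∑ els (λ y → 1ℚ * f y) ≡⟨ cong₂ _+_ (∑-const els (- π)) (∑-*ˡ els 1ℚ f) ⟩
          N * - π + 1ℚ * ∑ els f
            ≡⟨ solve 3 (λ n w s → n :* :- (w :* s) :+ con 1ℚ :* s := (con 1ℚ :+ :- (n :* w)) :* s)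
                 refl N w (∑ els f) ⟩
          (1ℚ - N * w) * ∑ els f                     ≡⟨ cong (λ v → (1ℚ - v) * ∑ els f) Nw≡1 ⟩
          0ℚ * ∑ els f                               ≡⟨ ℚ.*-zeroˡ (∑ els f) ⟩
          0ℚ                                         ∎
        decays = mean-zero-decays {g} g-inv ∑g≡0 𝓢x ε 0<ε
        eq : ∀ k → P^ k g x - 0ℚ ≡ P^ k f x - π
        eq k = trans (cong (_- 0ℚ) (P^-affine k (- π) 1ℚ f 𝓢x))
          (solve 2 (λ p v → (:- p :+ con 1ℚ :* v) :+ :- con 0ℚ := v :+ :- p) refl π (P^ k f x))

  -- Indicators and expectations

  ⟦_⟧ : ∀ {P : Set} → Dec P → ℚ
  ⟦ P? ⟧ = if does P? then 1ℚ else 0ℚ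

  ⟦⟧-yes : ∀ {P : Set} (P? : Dec P) → P → ⟦ P? ⟧ ≡ 1ℚ
  ⟦⟧-yes (yes _) p = refl
  ⟦⟧-yes (no ¬p) p = contradiction p ¬p

  ⟦⟧-no : ∀ {P : Set} (P? : Dec P) → ¬ P → ⟦ P? ⟧ ≡ 0ℚ
  ⟦⟧-no (yes p) ¬p = contradiction p ¬p
  ⟦⟧-no (no _)  ¬p = refl

  ⟦⟧-cong : ∀ {P Q : Set} (P? : Dec P) (Q? : Dec Q) → (P → Q) → (Q → P) → ⟦ P? ⟧ ≡ ⟦ Q? ⟧
  ⟦⟧-cong (yes p) Q? f g = sym (⟦⟧-yes Q? (f p))
  ⟦⟧-cong (no ¬p) Q? f g = sym (⟦⟧-no Q? (¬p ∘ g))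

  ∑-single : ∀ {A : Set} {xs : List A} {c} {f : A → ℚ} → Unique xs → c ∈ˡ xs →
             (∀ {x} → x ∈ˡ xs → x ≢ c → f x ≡ 0ℚ) → ∑ xs f ≡ f c
  ∑-single {xs = x ∷ xs} {f = f} (x∉ ∷ _) (here refl) zero-off =
    trans (cong (f x +_) (∑-zero xs λ y∈ → zero-off (there y∈) (All.lookup x∉ y∈ ∘ sym))) (ℚ.+-identityʳ (f x))
  ∑-single {xs = x ∷ xs} {c} {f} (x∉ ∷ uniq) (there c∈) zero-off =
    trans (cong₂ _+_ (zero-off (here refl) (All.lookup x∉ c∈)) (∑-single uniq c∈ (zero-off ∘ there)))
      (ℚ.+-identityˡ (f c))

  -- The value for the empty list matches `uniform [] = []`, so that `𝔼-uniform` holds for every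
  -- list.
  weight : ∀ {A : Set} → List A → ℚ
  weight []       = 0ℚ
  weight (_ ∷ xs) = pos 1 / suc (length xs)

  weight-cong : ∀ {A B : Set} (xs : List A) (ys : List B) → length xs ≡ length ys → weight xs ≡ weight ys
  weight-cong []       []       _  = refl
  weight-cong (x ∷ xs) (y ∷ ys) eq = cong (λ n → pos 1 / suc n) (ℕ.suc-injective eq)

  weight-nonneg : ∀ {A : Set} (xs : List A) → 0ℚ ≤ weight xs
  weight-nonneg []       = ℚ.≤-refl
  weight-nonneg (_ ∷ xs) = ℚ.<⇒≤ (1/-pos (length xs))

  weight-pos : ∀ {A : Set} {x : A} {xs} → x ∈ˡ xs → 0ℚ < weight xs
  weight-pos {xs = _ ∷ xs} _ = 1/-pos (length xs)

  length-*-weight : ∀ {A : Set} {x : A} {xs} → x ∈ˡ xs → fromℕ (length xs) * weight xs ≡ 1ℚ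
  length-*-weight {xs = _ ∷ xs} _ = fromℕ-*-1/ (length xs)

  weight-*-∑-const : ∀ {A : Set} {x : A} {xs} → x ∈ˡ xs → ∀ c → weight xs * ∑ xs (λ _ → c) ≡ c
  weight-*-∑-const {xs = xs} x∈ c = begin
    weight xs * ∑ xs (λ _ → c)          ≡⟨ cong (weight xs *_) (∑-const xs c) ⟩
    weight xs * (fromℕ (length xs) * c) ≡⟨ solve 3 (λ w n c → w :* (n :* c) := (n :* w) :* c)
                                               refl (weight xs) (fromℕ (length xs)) c ⟩
    fromℕ (length xs) * weight xs * c   ≡⟨ cong (_* c) (length-*-weight x∈) ⟩
    1ℚ * c                              ≡⟨ ℚ.*-identityˡ c ⟩
    c                                   ∎
    where open ≡-Reasoning

  𝔼 : ∀ {A : Set} → Dist A → (A → ℚ) → ℚ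
  𝔼 μ f = ∑ μ (λ (x , p) → p * f x)

  module _ {A : Set} where

    𝔼-return : ∀ (x : A) f → 𝔼 (return x) f ≡ f x
    𝔼-return x f = trans (ℚ.+-identityʳ _) (ℚ.*-identityˡ (f x))

    𝔼->>= : ∀ {B : Set} (μ : Dist A) (g : A → Dist B) f → 𝔼 (μ >>= g) f ≡ 𝔼 μ (λ x → 𝔼 (g x) f)
    𝔼->>= []            g f = refl
    𝔼->>= ((x , p) ∷ μ) g f = trans
      (∑-++ (map (λ (y , q) → y , p * q) (g x)) (μ >>= g) _)
      (cong₂ _+_
        (trans (∑-map _ (g x) _)
          (trans (∑-cong′ (g x) λ (y , q) → ℚ.*-assoc p q (f y)) (∑-*ˡ (g x) p _)))
        (𝔼->>= μ g f))

    𝔼-uniform : ∀ (xs : List A) f → 𝔼 (uniform xs) f ≡ weight xs * ∑ xs f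
    𝔼-uniform []            f = refl
    𝔼-uniform xs@(_ ∷ xs′)  f = trans (∑-map (λ x → x , weight xs) xs (λ (x , p) → p * f x)) (∑-*ˡ xs (weight xs) f)

    Pr≡𝔼 : ∀ {P : A → Set} (P? : Unary.Decidable P) μ → Pr P? μ ≡ 𝔼 μ (λ x → ⟦ P? x ⟧)
    Pr≡𝔼 P? [] = refl
    Pr≡𝔼 P? ((x , p) ∷ μ) with P? x
    ... | yes _ = cong₂ _+_ (sym (ℚ.*-identityʳ p)) (Pr≡𝔼 P? μ)
    ... | no  _ = trans (Pr≡𝔼 P? μ) (trans (sym (ℚ.+-identityˡ _)) (cong (_+ 𝔼 μ _) (sym (ℚ.*-zeroʳ p))))

  -- Sums over pairs of positions

  module _ {A : Set} where

    picks-∈ : ∀ {x} {r xs : List A} → (x , r) ∈ˡ picks xs → x ∈ˡ xs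
    picks-∈ {xs = y ∷ xs} (here refl) = here refl
    picks-∈ {xs = y ∷ xs} (there p) with ∈-map⁻ (map₂ (y ∷_)) p
    ... | _ , p′ , refl = there (picks-∈ p′)

    picks-↭ : ∀ {x} {r xs : List A} → (x , r) ∈ˡ picks xs → x ∷ r ↭ xs
    picks-↭ {xs = y ∷ xs} (here refl) = ↭-refl
    picks-↭ {x} {xs = y ∷ xs} (there p) with ∈-map⁻ (map₂ (y ∷_)) p
    ... | (_ , r) , p′ , refl = ↭-trans (↭.swap x y ↭-refl) (↭.prep y (picks-↭ p′))

    pairs-↭ : ∀ {a b} {r xs : List A} → (a , b , r) ∈ˡ pairs xs → a ∷ b ∷ r ↭ xs
    pairs-↭ {a} {b} {r} {x ∷ xs} p with ∈-++⁻ (map (x ,_) (picks xs)) p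
    ... | inj₁ q with ∈-map⁻ (x ,_) q
    ...   | _ , q′ , refl = ↭.prep x (picks-↭ q′)
    pairs-↭ {a} {b} {r} {x ∷ xs} p | inj₂ q with ∈-map⁻ (map₂ (map₂ (x ∷_))) q
    ...   | (_ , _ , r′) , q′ , refl =
      ↭-trans (↭.prep a (↭.swap b x ↭-refl)) (↭-trans (↭.swap a x ↭-refl) (↭.prep x (pairs-↭ q′)))

    length-picks : ∀ (xs : List A) → length (picks xs) ≡ length xs
    length-picks []       = refl
    length-picks (x ∷ xs) = cong suc (trans (List.length-map _ (picks xs)) (length-picks xs))

  length-pairs : ∀ {A B : Set} (xs : List A) (ys : List B) →
                 length xs ≡ length ys → length (pairs xs) ≡ length (pairs ys)
  length-pairs []       []       _  = refl
  length-pairs (x ∷ xs) (y ∷ ys) eq = trans (expand x xs) (trans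
    (cong₂ ℕ._+_ (ℕ.suc-injective eq) (length-pairs xs ys (ℕ.suc-injective eq))) (sym (expand y ys)))
    where
    expand : ∀ {C : Set} x (xs : List C) → length (pairs (x ∷ xs)) ≡ length xs ℕ.+ length (pairs xs)
    expand x xs = trans (List.length-++ (map (x ,_) (picks xs))) (cong₂ ℕ._+_
      (trans (List.length-map _ (picks xs)) (length-picks xs)) (List.length-map _ (pairs xs)))

  module _ {A : Set} where

    ∑-picks-∷ : ∀ x (xs : List A) ψ →
      ∑ (picks (x ∷ xs)) ψ ≡ ψ (x , xs) + ∑ (picks xs) (λ (y , r) → ψ (y , x ∷ r))
    ∑-picks-∷ x xs ψ = cong (ψ (x , xs) +_) (∑-map _ (picks xs) ψ)

    ∑-pairs-∷ : ∀ x (xs : List A) φ →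
      ∑ (pairs (x ∷ xs)) φ ≡
        ∑ (picks xs) (λ (y , r) → φ (x , y , r)) + ∑ (pairs xs) (λ (y , z , r) → φ (y , z , x ∷ r))
    ∑-pairs-∷ x xs φ = trans (∑-++ (map (x ,_) (picks xs)) _ φ)
      (cong₂ _+_ (∑-map _ (picks xs) φ) (∑-map _ (pairs xs) φ))

    -- The four groups are the pairs containing both `x` and `y`, only `x`, only `y`, or neither;
    -- swapping `x` and `y` interchanges the two middle groups.
    ∑-pairs-∷∷ : ∀ x y (xs : List A) φ →
      ∑ (pairs (x ∷ y ∷ xs)) φ ≡
        (φ (x , y , xs) + ∑ (picks xs) (λ (z , r) → φ (x , z , y ∷ r))) +
        (∑ (picks xs) (λ (z , r) → φ (y , z , x ∷ r)) + ∑ (pairs xs) (λ (u , v , r) → φ (u , v , x ∷ y ∷ r)))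
    ∑-pairs-∷∷ x y xs φ = trans (∑-pairs-∷ x (y ∷ xs) φ) (cong₂ _+_
      (∑-picks-∷ y xs (λ (z , r) → φ (x , z , r))) (∑-pairs-∷ y xs (λ (u , v , r) → φ (u , v , x ∷ r))))

    ∑-picks-↭ : ∀ {xs ys : List A} ψ → (∀ {x r r′} → r ↭ r′ → ψ (x , r) ≡ ψ (x , r′)) →
                xs ↭ ys → ∑ (picks xs) ψ ≡ ∑ (picks ys) ψ
    ∑-picks-↭ ψ resp ↭.refl = refl
    ∑-picks-↭ ψ resp (↭.prep {xs} {ys} x p) = trans (∑-picks-∷ x xs ψ) (trans
      (cong₂ _+_ (resp p) (∑-picks-↭ (λ (y , r) → ψ (y , x ∷ r)) (resp ∘ ↭.prep x) p))
      (sym (∑-picks-∷ x ys ψ)))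
    ∑-picks-↭ ψ resp (↭.swap {xs} {ys} x y p) = begin
      ∑ (picks (x ∷ y ∷ xs)) ψ
        ≡⟨ trans (∑-picks-∷ x (y ∷ xs) ψ)
             (cong (ψ (x , y ∷ xs) +_) (∑-picks-∷ y xs (λ (z , r) → ψ (z , x ∷ r)))) ⟩
      ψ (x , y ∷ xs) + (ψ (y , x ∷ xs) + ∑ (picks xs) (λ (z , r) → ψ (z , x ∷ y ∷ r)))
        ≡⟨ solve 3 (λ a b c → a :+ (b :+ c) := b :+ (a :+ c)) refl (ψ (x , y ∷ xs)) (ψ (y , x ∷ xs)) _ ⟩
      ψ (y , x ∷ xs) + (ψ (x , y ∷ xs) + ∑ (picks xs) (λ (z , r) → ψ (z , x ∷ y ∷ r)))
        ≡⟨ cong₂ _+_ (resp (↭.prep x p)) (cong₂ _+_ (resp (↭.prep y p))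
             (trans (∑-cong′ (picks xs) λ _ → resp (↭.swap x y ↭-refl))
               (∑-picks-↭ (λ (z , r) → ψ (z , y ∷ x ∷ r)) (λ q → resp (↭.prep y (↭.prep x q))) p))) ⟩
      ψ (y , x ∷ ys) + (ψ (x , y ∷ ys) + ∑ (picks ys) (λ (z , r) → ψ (z , y ∷ x ∷ r)))
        ≡⟨ trans (∑-picks-∷ y (x ∷ ys) ψ)
             (cong (ψ (y , x ∷ ys) +_) (∑-picks-∷ x ys (λ (z , r) → ψ (z , y ∷ r)))) ⟨
      ∑ (picks (y ∷ x ∷ ys)) ψ ∎
      where open ≡-Reasoning
    ∑-picks-↭ ψ resp (↭.trans p q) = trans (∑-picks-↭ ψ resp p) (∑-picks-↭ ψ resp q)

    -- `pairs` lists an unordered pair in the order of its positions. A permutation may reverse that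
    -- order, hence the symmetry required of `φ`.
    ∑-pairs-↭ : ∀ {xs ys : List A} φ → (∀ {a b r} → φ (a , b , r) ≡ φ (b , a , r)) →
                (∀ {a b r r′} → r ↭ r′ → φ (a , b , r) ≡ φ (a , b , r′)) →
                xs ↭ ys → ∑ (pairs xs) φ ≡ ∑ (pairs ys) φ
    ∑-pairs-↭ φ comm resp ↭.refl = refl
    ∑-pairs-↭ φ comm resp (↭.prep {xs} {ys} x p) = trans (∑-pairs-∷ x xs φ) (trans
      (cong₂ _+_ (∑-picks-↭ (λ (y , r) → φ (x , y , r)) resp p)
                 (∑-pairs-↭ (λ (y , z , r) → φ (y , z , x ∷ r)) comm (resp ∘ ↭.prep x) p))
      (sym (∑-pairs-∷ x ys φ)))
    ∑-pairs-↭ φ comm resp (↭.swap {xs} {ys} x y p) = begin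
      ∑ (pairs (x ∷ y ∷ xs)) φ
        ≡⟨ ∑-pairs-∷∷ x y xs φ ⟩
      (φ (x , y , xs) + ∑ (picks xs) (λ (z , r) → φ (x , z , y ∷ r))) +
      (∑ (picks xs) (λ (z , r) → φ (y , z , x ∷ r)) + ∑ (pairs xs) (λ (u , v , r) → φ (u , v , x ∷ y ∷ r)))
        ≡⟨ cong₂ _+_
             (cong₂ _+_ (trans comm (resp p)) (∑-picks-↭ (λ (z , r) → φ (x , z , y ∷ r)) (resp ∘ ↭.prep y) p))
             (cong₂ _+_ (∑-picks-↭ (λ (z , r) → φ (y , z , x ∷ r)) (resp ∘ ↭.prep x) p)
               (trans (∑-cong′ (pairs xs) λ _ → resp (↭.swap x y ↭-refl))
                 (∑-pairs-↭ (λ (u , v , r) → φ (u , v , y ∷ x ∷ r)) comm (λ q → resp (↭.prep y (↭.prep x q))) p))) ⟩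
      (φ (y , x , ys) + ∑ (picks ys) (λ (z , r) → φ (x , z , y ∷ r))) +
      (∑ (picks ys) (λ (z , r) → φ (y , z , x ∷ r)) + ∑ (pairs ys) (λ (u , v , r) → φ (u , v , y ∷ x ∷ r)))
        ≡⟨ solve 4 (λ a b c e → (a :+ b) :+ (c :+ e) := (a :+ c) :+ (b :+ e)) refl (φ (y , x , ys)) _ _ _ ⟩
      (φ (y , x , ys) + ∑ (picks ys) (λ (z , r) → φ (y , z , x ∷ r))) +
      (∑ (picks ys) (λ (z , r) → φ (x , z , y ∷ r)) + ∑ (pairs ys) (λ (u , v , r) → φ (u , v , y ∷ x ∷ r)))
        ≡⟨ ∑-pairs-∷∷ y x ys φ ⟨
      ∑ (pairs (y ∷ x ∷ ys)) φ ∎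
      where open ≡-Reasoning
    ∑-pairs-↭ φ comm resp (↭.trans p q) = trans (∑-pairs-↭ φ comm resp p) (∑-pairs-↭ φ comm resp q)

  -- Subsets as multisets

  subsets-complete : ∀ {n} (p : Subset n) → p ∈ˡ subsets n
  subsets-complete []                    = here refl
  subsets-complete (outside ∷ p)         = ∈-++⁺ˡ (∈-map⁺ (outside ∷_) (subsets-complete p))
  subsets-complete {suc n} (inside ∷ p)  =
    ∈-++⁺ʳ (map (outside ∷_) (subsets n)) (∈-map⁺ (inside ∷_) (subsets-complete p))

  subsets-unique : ∀ n → Unique (subsets n)
  subsets-unique zero    = All.[] ∷ []
  subsets-unique (suc n) = Unique.++⁺ (Unique.map⁺ Vec.∷-injectiveʳ (subsets-unique n))
    (Unique.map⁺ Vec.∷-injectiveʳ (subsets-unique n)) disjoint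
    where
    disjoint : ∀ {v} → ¬ (v ∈ˡ map (outside ∷_) (subsets n) × v ∈ˡ map (inside ∷_) (subsets n))
    disjoint (v∈ , v∈′) with ∈-map⁻ (outside ∷_) v∈ | ∈-map⁻ (inside ∷_) v∈′
    ... | _ , _ , refl | _ , _ , ()

  ⊎ᵐ-comm : ∀ {n} (t u : Multiset n) → t ⊎ᵐ u ≡ u ⊎ᵐ t
  ⊎ᵐ-comm = Vec.zipWith-comm ℕ.+-comm

  ⊎ᵐ-cancelˡ : ∀ {n} (t u v : Multiset n) → t ⊎ᵐ u ≡ t ⊎ᵐ v → u ≡ v
  ⊎ᵐ-cancelˡ []      []      []      _  = refl
  ⊎ᵐ-cancelˡ (k ∷ t) (i ∷ u) (j ∷ v) eq =
    cong₂ _∷_ (ℕ.+-cancelˡ-≡ k i j (Vec.∷-injectiveˡ eq)) (⊎ᵐ-cancelˡ t u v (Vec.∷-injectiveʳ eq))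

  fromSubset-injective : ∀ {n} (p q : Subset n) → fromSubset p ≡ fromSubset q → p ≡ q
  fromSubset-injective []            []            _  = refl
  fromSubset-injective (outside ∷ p) (outside ∷ q) eq =
    cong (outside ∷_) (fromSubset-injective p q (Vec.∷-injectiveʳ eq))
  fromSubset-injective (inside  ∷ p) (inside  ∷ q) eq =
    cong (inside ∷_) (fromSubset-injective p q (Vec.∷-injectiveʳ eq))
  fromSubset-injective (outside ∷ p) (inside  ∷ q) eq = contradiction (Vec.∷-injectiveˡ eq) λ ()
  fromSubset-injective (inside  ∷ p) (outside ∷ q) eq = contradiction (Vec.∷-injectiveˡ eq) λ ()

  ∣p∣≡0⇒p≡⊥ : ∀ {n} (p : Subset n) → ∣ p ∣ ≡ 0 → p ≡ empty
  ∣p∣≡0⇒p≡⊥ []            _  = refl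
  ∣p∣≡0⇒p≡⊥ (outside ∷ p) eq = cong (outside ∷_) (∣p∣≡0⇒p≡⊥ p eq)
  ∣p∣≡0⇒p≡⊥ (inside ∷ p)  ()

  -- The shuffle relation and the symmetry of transition probabilities

  module Shuffling (𝐝 : DegreeSequence) where

    open DegreeSequence 𝐝
    open Stub 𝐝

    hyperarcs-complete : ∀ a → a ∈ˡ hyperarcs
    hyperarcs-complete (t , h) = ∈-cartesianProduct⁺ (subsets-complete t) (subsets-complete h)

    hyperarcs-unique : Unique hyperarcs
    hyperarcs-unique = Unique.cartesianProduct⁺ (subsets-unique OutStubs) (subsets-unique InStubs)

    ⇝-refl : ∀ {p} → p ⇝ p
    ⇝-refl = refl , refl , refl , refl

    ⇝-sym : ∀ {p q} → p ⇝ q → q ⇝ p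
    ⇝-sym (t , h , i , j) = sym t , sym h , sym i , sym j

    ⇝-trans : ∀ {p q r} → p ⇝ q → q ⇝ r → p ⇝ r
    ⇝-trans (t , h , i , j) (t′ , h′ , i′ , j′) = trans t t′ , trans h h′ , trans i i′ , trans j j′

    ⇝-swap : ∀ {a b c e} → (a , b) ⇝ (c , e) → (b , a) ⇝ (e , c)
    ⇝-swap (t , h , i , j) =
      trans (⊎ᵐ-comm _ _) (trans t (⊎ᵐ-comm _ _)) , trans (⊎ᵐ-comm _ _) (trans h (⊎ᵐ-comm _ _)) , j , i

    ∅ : Hyperarc
    ∅ = empty , empty

    -- Sizes are preserved position by position, so `a` is empty as well, and cancelling it from the
    -- unions leaves `b` equal to `e`.
    ⇝-∅ : ∀ {a b c e} → (a , b) ⇝ (c , e) → c ≡ ∅ → (a , b) ≡ (c , e)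
    ⇝-∅ {a} {b} {c} {e} (t , h , i , _) refl = cong₂ _,_ a≡∅ b≡e
      where
      a≡∅ : a ≡ ∅
      a≡∅ = cong₂ _,_
        (∣p∣≡0⇒p≡⊥ (tail a) (trans (cong proj₁ i) (Subset.∣⊥∣≡0 OutStubs)))
        (∣p∣≡0⇒p≡⊥ (head a) (trans (cong proj₂ i) (Subset.∣⊥∣≡0 InStubs)))
      b≡e : b ≡ e
      b≡e = cong₂ _,_
        (fromSubset-injective _ _ (⊎ᵐ-cancelˡ (fromSubset empty) _ _
          (trans (cong (λ c → fromSubset (tail c) ⊎ᵐ fromSubset (tail b)) (sym a≡∅)) t)))
        (fromSubset-injective _ _ (⊎ᵐ-cancelˡ (fromSubset empty) _ _
          (trans (cong (λ c → fromSubset (head c) ⊎ᵐ fromSubset (head b)) (sym a≡∅)) h)))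

    S-sound : ∀ {a b ŝ} → ŝ ∈ˡ S a b → (a , b) ⇝ ŝ
    S-sound {a} {b} ŝ∈ = proj₂ (∈-filter⁻ ((a , b) ⇝?_) {xs = cartesianProduct hyperarcs hyperarcs} ŝ∈)

    S-complete : ∀ {a b ŝ} → (a , b) ⇝ ŝ → ŝ ∈ˡ S a b
    S-complete {a} {b} ⇝ŝ = ∈-filter⁺ ((a , b) ⇝?_)
      (∈-cartesianProduct⁺ (hyperarcs-complete _) (hyperarcs-complete _)) ⇝ŝ

    S-unique : ∀ a b → Unique (S a b)
    S-unique a b = Unique.filter⁺ ((a , b) ⇝?_) (Unique.cartesianProduct⁺ hyperarcs-unique hyperarcs-unique)

    S-self : ∀ {a b} → (a , b) ∈ˡ S a b
    S-self = S-complete ⇝-refl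

    -- `⇝` is an equivalence relation, so related pairs have the same class of shuffles. Hence a
    -- move and its reverse carry the same weight.
    S-cong : ∀ {a b c e} → (a , b) ⇝ (c , e) → S a b ≡ S c e
    S-cong {a} {b} {c} {e} p⇝q = List.filter-≐ ((a , b) ⇝?_) ((c , e) ⇝?_)
      ( (λ {r} → ⇝-trans {c , e} {a , b} {r} (⇝-sym {a , b} {c , e} p⇝q))
      , (λ {r} → ⇝-trans {a , b} {c , e} {r} p⇝q))
      (cartesianProduct hyperarcs hyperarcs)

    -- Both lists are free of duplicates and have the same elements.
    S-swap : ∀ a b → map ×-swap (S a b) ↭ S b a
    S-swap a b = ∼bag⇒↭ (unique∧set⇒bag
      (Unique.map⁺ (λ { refl → refl }) (S-unique a b)) (S-unique b a) (mk⇔ to from))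
      where
      to : ∀ {ŝ} → ŝ ∈ˡ map ×-swap (S a b) → ŝ ∈ˡ S b a
      to ŝ∈ with ∈-map⁻ ×-swap ŝ∈
      ... | _ , p∈ , refl = S-complete (⇝-swap (S-sound p∈))
      from : ∀ {ŝ} → ŝ ∈ˡ S b a → ŝ ∈ˡ map ×-swap (S a b)
      from ŝ∈ = ∈-map⁺ ×-swap (S-complete (⇝-swap (S-sound ŝ∈)))

    weight-S-swap : ∀ a b → weight (S a b) ≡ weight (S b a)
    weight-S-swap a b = weight-cong (S a b) (S b a)
      (trans (sym (List.length-map ×-swap (S a b))) (↭-length (S-swap a b)))

    ∑-S-swap : ∀ a b (g : Hyperarc × Hyperarc → ℚ) → ∑ (S b a) g ≡ ∑ (S a b) (g ∘ ×-swap)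
    ∑-S-swap a b g = trans (sym (∑-↭ g (S-swap a b))) (∑-map ×-swap (S a b) g)

    HasDegrees-↭ : ∀ {H H′} → H ↭ H′ → HasDegrees H → HasDegrees H′
    HasDegrees-↭ p (mkHasDegrees tails heads sizes) = mkHasDegrees
      (λ i → trans (sym (↭-length (filter-↭ (λ a → i ∈? tail a) p))) (tails i))
      (λ i → trans (sym (↭-length (filter-↭ (λ a → i ∈? head a) p))) (heads i))
      (↭-trans (↭-sym (map⁺ size p)) sizes)

    HasDegrees-length : ∀ {H} → HasDegrees H → length H ≡ length δ
    HasDegrees-length {H} deg = trans (sym (List.length-map size H)) (↭-length (HasDegrees.sizes deg))

    filter-twice : ∀ {P : Hyperarc → Set} (P? : Unary.Decidable P) a r →
                   length (filter P? (a ∷ a ∷ r)) ≡ 1 → ¬ P a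
    filter-twice P? a r eq pa with trans (sym (cong length
      (trans (List.filter-accept P? {x = a} {xs = a ∷ r} pa)
        (cong (a ∷_) (List.filter-accept P? {x = a} {xs = r} pa))))) eq
    ... | ()

    -- A stub of a repeated hyperarc would be used twice.
    twice⇒∅ : ∀ {a r H} → a ∷ a ∷ r ↭ H → HasDegrees H → a ≡ ∅
    twice⇒∅ {a} {r} p deg = cong₂ _,_
      (Subset.Empty-unique λ (i , i∈) → filter-twice (λ a → i ∈? tail a) a r (HasDegrees.tails deg′ i) i∈)
      (Subset.Empty-unique λ (i , i∈) → filter-twice (λ a → i ∈? head a) a r (HasDegrees.heads deg′ i) i∈)
      where deg′ = HasDegrees-↭ (↭-sym p) deg

    -- The expectation of `ψ` at the proposed hypergraph, multiplied by the number of pairs and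
    -- taken before acceptance.
    𝕊 : Hypergraph → (Hypergraph → ℚ) → ℚ
    𝕊 H ψ = ∑ (pairs H) λ (a , b , r) → weight (S a b) * ∑ (S a b) λ (â , b̂) → ψ (â ∷ b̂ ∷ r)

    𝕊-cong : ∀ H {φ ψ} → (∀ K → φ K ≡ ψ K) → 𝕊 H φ ≡ 𝕊 H ψ
    𝕊-cong H eq = ∑-cong′ (pairs H) λ (a , b , r) → cong (weight (S a b) *_) (∑-cong′ (S a b) λ _ → eq _)

    𝕊-mono : ∀ H {φ ψ} → (∀ K → φ K ≤ ψ K) → 𝕊 H φ ≤ 𝕊 H ψ
    𝕊-mono H le = ∑-mono (pairs H) λ {(a , b , r)} _ → *-monoˡ (weight-nonneg (S a b)) (∑-mono (S a b) λ _ → le _)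

    𝕊-+ : ∀ H φ ψ → 𝕊 H (λ K → φ K + ψ K) ≡ 𝕊 H φ + 𝕊 H ψ
    𝕊-+ H φ ψ = trans
      (∑-cong′ (pairs H) λ (a , b , r) → trans
        (cong (weight (S a b) *_) (∑-+ (S a b) _ _)) (ℚ.*-distribˡ-+ (weight (S a b)) _ _))
      (∑-+ (pairs H) _ _)

    𝕊-*ʳ : ∀ H ψ c → 𝕊 H (λ K → ψ K * c) ≡ 𝕊 H ψ * c
    𝕊-*ʳ H ψ c = trans
      (∑-cong′ (pairs H) λ (a , b , r) → trans
        (cong (weight (S a b) *_) (∑-*ʳ (S a b) c _)) (sym (ℚ.*-assoc (weight (S a b)) _ c)))
      (∑-*ʳ (pairs H) c _)

    𝕊-const : ∀ H c → 𝕊 H (λ _ → c) ≡ ∑ (pairs H) (λ _ → c)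
    𝕊-const H c = ∑-cong′ (pairs H) λ (a , b , r) → weight-*-∑-const {xs = S a b} S-self c

    𝕊-∑ : ∀ H {B : Set} (ys : List B) (ψ : B → Hypergraph → ℚ) →
          𝕊 H (λ K → ∑ ys (λ y → ψ y K)) ≡ ∑ ys (λ y → 𝕊 H (ψ y))
    𝕊-∑ H []       ψ = trans (𝕊-const H 0ℚ) (∑-0 (pairs H))
    𝕊-∑ H (y ∷ ys) ψ = trans (𝕊-+ H (ψ y) (λ K → ∑ ys (λ y → ψ y K))) (cong (𝕊 H (ψ y) +_) (𝕊-∑ H ys ψ))

    𝕊-↭ : ∀ {H H′ ψ} → (∀ {K K′} → K ↭ K′ → ψ K ≡ ψ K′) → H ↭ H′ → 𝕊 H ψ ≡ 𝕊 H′ ψ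
    𝕊-↭ {ψ = ψ} inv = ∑-pairs-↭ _
      (λ {a} {b} {r} → cong₂ _*_ (weight-S-swap a b)
        (trans (∑-S-swap b a λ (â , b̂) → ψ (â ∷ b̂ ∷ r)) (∑-cong′ (S b a) λ _ → inv (↭.swap _ _ ↭-refl))))
      (λ {a} {b} p → cong (weight (S a b) *_) (∑-cong′ (S a b) λ _ → inv (↭.prep _ (↭.prep _ p))))

    _≟ᵖ_ : DecidableEquality (Hyperarc × Hyperarc)
    _≟ᵖ_ = ×-≡-dec _≟ᵃ_ _≟ᵃ_

    Split : Set
    Split = Hyperarc × Hyperarc × List Hyperarc

    -- Tests whether a pair of positions holds exactly `ŝ` and leaves `r`. Both orders are tested
    -- because `ŝ` is ordered while the pair of positions is not.
    singled-out : Hyperarc × Hyperarc → List Hyperarc → Split → ℚ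
    singled-out ŝ r (c , e , r′) = ⟦ ((c , e) ≟ᵖ ŝ) ×-dec (r′ ↭? r) ⟧ + ⟦ ((e , c) ≟ᵖ ŝ) ×-dec (r′ ↭? r) ⟧

    singled-out-comm : ∀ ŝ r c e r′ → singled-out ŝ r (c , e , r′) ≡ singled-out ŝ r (e , c , r′)
    singled-out-comm ŝ r c e r′ = ℚ.+-comm ⟦ ((c , e) ≟ᵖ ŝ) ×-dec (r′ ↭? r) ⟧ _

    singled-out-resp : ∀ ŝ r c e {r′ r″} → r′ ↭ r″ →
                       singled-out ŝ r (c , e , r′) ≡ singled-out ŝ r (c , e , r″)
    singled-out-resp ŝ r c e {r′} {r″} p = cong₂ _+_ (resp ((c , e) ≟ᵖ ŝ)) (resp ((e , c) ≟ᵖ ŝ))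
      where
      resp : ∀ {P : Set} (P? : Dec P) → ⟦ P? ×-dec (r′ ↭? r) ⟧ ≡ ⟦ P? ×-dec (r″ ↭? r) ⟧
      resp P? = ⟦⟧-cong (P? ×-dec (r′ ↭? r)) (P? ×-dec (r″ ↭? r))
        (λ (pf , q) → pf , ↭-trans (↭-sym p) q) (λ (pf , q) → pf , ↭-trans p q)

    singled-out-zero : ∀ ŝ r c e r′ → (c , e) ≢ ŝ → (e , c) ≢ ŝ → singled-out ŝ r (c , e , r′) ≡ 0ℚ
    singled-out-zero ŝ r c e r′ ≢₁ ≢₂ = cong₂ _+_
      (⟦⟧-no (((c , e) ≟ᵖ ŝ) ×-dec (r′ ↭? r)) (≢₁ ∘ proj₁))
      (⟦⟧-no (((e , c) ≟ᵖ ŝ) ×-dec (r′ ↭? r)) (≢₂ ∘ proj₁))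

    ∑-singled-out : ∀ {a b r} → a ≢ b → a ∉ r → b ∉ r → ∑ (pairs (a ∷ b ∷ r)) (singled-out (a , b) r) ≡ 1ℚ
    ∑-singled-out {a} {b} {r} a≢b a∉r b∉r = trans (∑-pairs-∷∷ a b r φ) (cong₂ _+_
        (cong₂ _+_ first (∑-zero (picks r) λ {(z , r′)} z∈ → singled-out-zero (a , b) r a z (b ∷ r′)
          (λ { refl → b∉r (picks-∈ z∈) }) (λ { refl → a∉r (picks-∈ z∈) })))
        (cong₂ _+_
          (∑-zero (picks r) λ {(z , r′)} z∈ → singled-out-zero (a , b) r b z (a ∷ r′)
            (λ { refl → a≢b refl }) (λ { refl → a∉r (picks-∈ z∈) }))
          (∑-zero (pairs r) λ {(y , z , r′)} p∈ → singled-out-zero (a , b) r y z (a ∷ b ∷ r′)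
            (λ { refl → a∉r (first∈ p∈) }) (λ { refl → b∉r (first∈ p∈) }))))
      where
      φ = singled-out (a , b) r
      first : φ (a , b , r) ≡ 1ℚ
      first = cong₂ _+_
        (⟦⟧-yes (((a , b) ≟ᵖ (a , b)) ×-dec (r ↭? r)) (refl , ↭-refl))
        (⟦⟧-no (((b , a) ≟ᵖ (a , b)) ×-dec (r ↭? r)) (λ { (refl , _) → a≢b refl }))
      first∈ : ∀ {y z r′} → (y , z , r′) ∈ˡ pairs r → y ∈ˡ r
      first∈ p∈ = ∈-resp-↭ (pairs-↭ p∈) (here refl)

    -- In a hypergraph the only repeated hyperarc is ∅, and no shuffle of ∅ leads
    -- to a different hypergraph. So the two new hyperarcs occur just once in K.
    ↭-singled-out : ∀ {H K a b r â b̂} → HasDegrees K → ¬ (H ↭ K) →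
                    (a , b , r) ∈ˡ pairs H → (â , b̂) ∈ˡ S a b →
                    ⟦ (â ∷ b̂ ∷ r) ↭? K ⟧ ≡ ∑ (pairs K) (singled-out (â , b̂) r)
    ↭-singled-out {H} {K} {a} {b} {r} {â} {b̂} deg H≁K p∈ ŝ∈ = by-cases ((â ∷ b̂ ∷ r) ↭? K)
      where
      ŝ = (â , b̂)
      moved : â ∷ b̂ ∷ r ↭ K → (a , b) ≢ (â , b̂)
      moved q refl = H≁K (↭-trans (↭-sym (pairs-↭ p∈)) q)
      â≢∅ : â ∷ b̂ ∷ r ↭ K → â ≢ ∅
      â≢∅ q â≡∅ = moved q (⇝-∅ (S-sound ŝ∈) â≡∅)
      b̂≢∅ : â ∷ b̂ ∷ r ↭ K → b̂ ≢ ∅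
      b̂≢∅ q b̂≡∅ with ⇝-∅ (⇝-swap {a} {b} {â} {b̂} (S-sound ŝ∈)) b̂≡∅
      ... | refl = moved q refl
      by-cases : (d? : Dec (â ∷ b̂ ∷ r ↭ K)) → ⟦ d? ⟧ ≡ ∑ (pairs K) (singled-out ŝ r)
      -- Along `q` the sum moves to the list `â ∷ b̂ ∷ r`, where only the first pair of positions
      -- contributes.
      by-cases (yes q) = sym (trans
        (∑-pairs-↭ (singled-out ŝ r) (λ {c} {e} {r′} → singled-out-comm ŝ r c e r′)
          (λ {c} {e} → singled-out-resp ŝ r c e) (↭-sym q))
        (∑-singled-out â≢b̂ â∉r b̂∉r))
        where
        â≢b̂ : â ≢ b̂
        â≢b̂ refl = â≢∅ q (twice⇒∅ q deg)
        â∉r : â ∉ r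
        â∉r â∈ with ∈-∃++ â∈
        ... | xs , ys , refl = â≢∅ q (twice⇒∅
          (↭-trans (↭.prep â (↭-sym (shift â (b̂ ∷ xs) ys))) q) deg)
        b̂∉r : b̂ ∉ r
        b̂∉r b̂∈ with ∈-∃++ b̂∈
        ... | xs , ys , refl = b̂≢∅ q (twice⇒∅
          (↭-trans (↭.prep b̂ (↭-sym (shift b̂ (â ∷ xs) ys))) (↭-trans (↭.swap b̂ â ↭-refl) q)) deg)
      by-cases (no ¬q) = sym (∑-zero (pairs K) λ {(c , e , r′)} q∈ → cong₂ _+_
        (⟦⟧-no (((c , e) ≟ᵖ ŝ) ×-dec (r′ ↭? r)) λ { (refl , r′↭r) →
          ¬q (↭-trans (↭.prep _ (↭.prep _ (↭-sym r′↭r))) (pairs-↭ q∈)) })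
        (⟦⟧-no (((e , c) ≟ᵖ ŝ) ×-dec (r′ ↭? r)) λ { (refl , r′↭r) →
          ¬q (↭-trans (↭.prep _ (↭.prep _ (↭-sym r′↭r))) (↭-trans (↭.swap _ _ ↭-refl) (pairs-↭ q∈))) }))

    ∑-S-single : ∀ a b q {Q : Set} (Q? : Dec Q) →
      ∑ (S a b) (λ ŝ → ⟦ (q ≟ᵖ ŝ) ×-dec Q? ⟧) ≡ ⟦ ((a , b) ⇝? q) ×-dec Q? ⟧
    ∑-S-single a b q Q? = by-cases ((a , b) ⇝? q)
      where
      by-cases : (d? : Dec ((a , b) ⇝ q)) → ∑ (S a b) (λ ŝ → ⟦ (q ≟ᵖ ŝ) ×-dec Q? ⟧) ≡ ⟦ d? ×-dec Q? ⟧
      by-cases (yes ⇝q) = trans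
        (∑-single (S-unique a b) (S-complete ⇝q) λ {ŝ} _ ŝ≢q →
          ⟦⟧-no ((q ≟ᵖ ŝ) ×-dec Q?) (λ (eq , _) → ŝ≢q (sym eq)))
        (⟦⟧-cong ((q ≟ᵖ q) ×-dec Q?) (yes ⇝q ×-dec Q?) (λ (_ , qf) → ⇝q , qf) (λ (_ , qf) → refl , qf))
      by-cases (no ¬⇝q) = ∑-zero (S a b) λ {ŝ} ŝ∈ →
        ⟦⟧-no ((q ≟ᵖ ŝ) ×-dec Q?) (λ { (refl , _) → ¬⇝q (S-sound ŝ∈) })

    flow : Hypergraph → Hypergraph → ℚ
    flow H K = 𝕊 H (λ H′ → ⟦ H′ ↭? K ⟧)

    -- The contribution to the flow of one pair of positions in the source and one in the target,
    -- with the new hyperarcs matched in either order.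
    link : Split → Split → ℚ
    link (a , b , r) (c , e , r′) =
      weight (S a b) * (⟦ ((a , b) ⇝? (c , e)) ×-dec (r′ ↭? r) ⟧ + ⟦ ((a , b) ⇝? (e , c)) ×-dec (r′ ↭? r) ⟧)

    -- Replacing the test for `K` by a sum over its pairs makes source and target enter alike, so
    -- that symmetry can be checked term by term.
    flow-link : ∀ {H K} → HasDegrees K → ¬ (H ↭ K) →
                flow H K ≡ ∑ (pairs H) (λ p → ∑ (pairs K) (link p))
    flow-link {H} {K} deg H≁K = ∑-cong (pairs H) λ {(a , b , r)} p∈ → begin
      weight (S a b) * ∑ (S a b) (λ (â , b̂) → ⟦ (â ∷ b̂ ∷ r) ↭? K ⟧)
        ≡⟨ cong (weight (S a b) *_) (begin
          ∑ (S a b) (λ (â , b̂) → ⟦ (â ∷ b̂ ∷ r) ↭? K ⟧)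
            ≡⟨ ∑-cong (S a b) (λ {(â , b̂)} ŝ∈ → ↭-singled-out deg H≁K p∈ ŝ∈) ⟩
          ∑ (S a b) (λ ŝ → ∑ (pairs K) (singled-out ŝ r))
            ≡⟨ ∑-comm (S a b) (pairs K) (λ ŝ → singled-out ŝ r) ⟩
          ∑ (pairs K) (λ q → ∑ (S a b) (λ ŝ → singled-out ŝ r q))
            ≡⟨ ∑-cong′ (pairs K) (λ (c , e , r′) → trans
                 (∑-+ (S a b) (λ ŝ → ⟦ ((c , e) ≟ᵖ ŝ) ×-dec (r′ ↭? r) ⟧)
                              (λ ŝ → ⟦ ((e , c) ≟ᵖ ŝ) ×-dec (r′ ↭? r) ⟧))
                 (cong₂ _+_ (∑-S-single a b (c , e) (r′ ↭? r)) (∑-S-single a b (e , c) (r′ ↭? r)))) ⟩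
          ∑ (pairs K) (unweighted (a , b , r)) ∎) ⟩
      weight (S a b) * ∑ (pairs K) (unweighted (a , b , r))
        ≡⟨ ∑-*ˡ (pairs K) (weight (S a b)) (unweighted (a , b , r)) ⟨
      ∑ (pairs K) (link (a , b , r)) ∎
      where
      open ≡-Reasoning
      unweighted : Split → Split → ℚ
      unweighted (a , b , r) (c , e , r′) =
        ⟦ ((a , b) ⇝? (c , e)) ×-dec (r′ ↭? r) ⟧ + ⟦ ((a , b) ⇝? (e , c)) ×-dec (r′ ↭? r) ⟧

    -- Reversing `⇝` preserves the weight by `S-cong`. In the crossed summand both pairs must also
    -- be turned around, whence `⇝-swap`.
    link-sym : ∀ p q → link p q ≡ link q p
    link-sym (a , b , r) (c , e , r′) = begin
      link (a , b , r) (c , e , r′)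
        ≡⟨ ℚ.*-distribˡ-+ (weight (S a b)) _ _ ⟩
      weight (S a b) * ⟦ ((a , b) ⇝? (c , e)) ×-dec (r′ ↭? r) ⟧ +
      weight (S a b) * ⟦ ((a , b) ⇝? (e , c)) ×-dec (r′ ↭? r) ⟧
        ≡⟨ cong₂ _+_
             (swap-sides ((a , b) ⇝? (c , e)) ((c , e) ⇝? (a , b)) (⇝-sym {a , b} {c , e}) (⇝-sym {c , e} {a , b})
               (λ ⇝q → cong weight (S-cong ⇝q)))
             (swap-sides ((a , b) ⇝? (e , c)) ((c , e) ⇝? (b , a))
               (λ ⇝q → ⇝-swap {e} {c} {a} {b} (⇝-sym {a , b} {e , c} ⇝q))
               (λ ⇝q → ⇝-swap {b} {a} {c} {e} (⇝-sym {c , e} {b , a} ⇝q))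
               (λ ⇝q → trans (cong weight (S-cong ⇝q)) (weight-S-swap e c))) ⟩
      weight (S c e) * ⟦ ((c , e) ⇝? (a , b)) ×-dec (r ↭? r′) ⟧ +
      weight (S c e) * ⟦ ((c , e) ⇝? (b , a)) ×-dec (r ↭? r′) ⟧
        ≡⟨ ℚ.*-distribˡ-+ (weight (S c e)) _ _ ⟨
      link (c , e , r′) (a , b , r) ∎
      where
      open ≡-Reasoning
      swap-sides : ∀ {P Q : Set} (P? : Dec P) (Q? : Dec Q) → (P → Q) → (Q → P) →
        (P → weight (S a b) ≡ weight (S c e)) →
        weight (S a b) * ⟦ P? ×-dec (r′ ↭? r) ⟧ ≡ weight (S c e) * ⟦ Q? ×-dec (r ↭? r′) ⟧
      swap-sides (yes p) Q? f g eq = cong₂ _*_ (eq p) (⟦⟧-cong (yes p ×-dec (r′ ↭? r)) (Q? ×-dec (r ↭? r′))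
        (λ (_ , q) → f p , ↭-sym q) (λ (_ , q) → p , ↭-sym q))
      swap-sides (no ¬p) Q? f g eq = trans (ℚ.*-zeroʳ (weight (S a b))) (sym (trans
        (cong (weight (S c e) *_) (⟦⟧-no (Q? ×-dec (r ↭? r′)) (¬p ∘ g ∘ proj₁))) (ℚ.*-zeroʳ (weight (S c e)))))

    flow-sym : ∀ {H K} → HasDegrees H → HasDegrees K → ¬ (H ↭ K) → flow H K ≡ flow K H
    flow-sym {H} {K} degH degK H≁K = begin
      flow H K                                      ≡⟨ flow-link degK H≁K ⟩
      ∑ (pairs H) (λ p → ∑ (pairs K) (link p))      ≡⟨ ∑-comm (pairs H) (pairs K) link ⟩
      ∑ (pairs K) (λ q → ∑ (pairs H) (λ p → link p q))
        ≡⟨ ∑-cong′ (pairs K) (λ q → ∑-cong′ (pairs H) λ p → link-sym p q) ⟩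
      ∑ (pairs K) (λ q → ∑ (pairs H) (link q))      ≡⟨ flow-link degH (H≁K ∘ ↭-sym) ⟨
      flow K H                                      ∎
      where open ≡-Reasoning

  -- The shuffling method as a Markov chain on the space

  tuples-complete : ∀ {A : Set} {xs : List A} → (∀ x → x ∈ˡ xs) → ∀ ys → ys ∈ˡ tuples (length ys) xs
  tuples-complete all∈ []       = here refl
  tuples-complete all∈ (y ∷ ys) = ∈-cartesianProductWith⁺ _∷_ (all∈ y) (tuples-complete all∈ ys)

  distinct-unique : ∀ {A : Set} {_~_ : A → A → Set} {xs x y} → (∀ {x y} → x ~ y → y ~ x) →
                    AllPairs (λ x y → ¬ (x ~ y)) xs → x ∈ˡ xs → y ∈ˡ xs → x ~ y → x ≡ y
  distinct-unique ~sym (≁ ∷ _)  (here refl) (here refl) x~y = refl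
  distinct-unique ~sym (≁ ∷ _)  (here refl) (there y∈)  x~y = contradiction x~y (All.lookup ≁ y∈)
  distinct-unique ~sym (≁ ∷ _)  (there x∈)  (here refl) x~y = contradiction (~sym x~y) (All.lookup ≁ x∈)
  distinct-unique ~sym (_ ∷ ≁s) (there x∈)  (there y∈)  x~y = distinct-unique ~sym ≁s x∈ y∈ x~y

  if-elim : ∀ {A P : Set} {u v : A} (C : A → Set) (P? : Dec P) → (P → C u) → (¬ P → C v) →
            C (if does P? then u else v)
  if-elim C (yes p) f g = f p
  if-elim C (no ¬p) f g = g ¬p

  module ShuffleChain (𝐝 : DegreeSequence) (2≤ : 2 ℕ.≤ length (DegreeSequence.δ 𝐝)) (x : List Feature)
    (𝓗-↭ : ∀ {H K} → H ↭ K → Stub.𝓗 𝐝 x H → Stub.𝓗 𝐝 x K) where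

    open DegreeSequence 𝐝
    open Stub 𝐝
    open Shuffling 𝐝

    els : List Hypergraph
    els = elements x

    els-distinct : AllPairs (λ H K → ¬ (H ↭ K)) els
    els-distinct = go (filter (𝓗? x) (tuples (length δ) hyperarcs))
      where
      go : ∀ Hs → AllPairs (λ H K → ¬ (H ↭ K)) (deduplicate _↭?_ Hs)
      go []       = []
      go (H ∷ Hs) = All.all-filter (¬? ∘ (H ↭?_)) (deduplicate _↭?_ Hs) ∷
                    AllPairs.filter⁺ (¬? ∘ (H ↭?_)) (go Hs)

    els⊆𝓗 : ∀ {H} → H ∈ˡ els → 𝓗 x H
    els⊆𝓗 H∈ = proj₂ (∈-filter⁻ (𝓗? x) {xs = tuples (length δ) hyperarcs} (Any.deduplicate⁻ _↭?_ H∈))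

    𝓗-length : ∀ {H} → 𝓗 x H → length H ≡ length δ
    𝓗-length (deg , _) = HasDegrees-length deg

    𝓗⊆els : ∀ {H} → 𝓗 x H → ∃[ K ] K ∈ˡ els × H ↭ K
    𝓗⊆els {H} 𝓗H = find found
      where
      H∈ : H ∈ˡ filter (𝓗? x) (tuples (length δ) hyperarcs)
      H∈ = ∈-filter⁺ (𝓗? x)
        (subst (λ l → H ∈ˡ tuples l hyperarcs) (𝓗-length 𝓗H) (tuples-complete hyperarcs-complete H)) 𝓗H
      found = Any.deduplicate⁺ _↭?_ (λ p q → ↭-trans q (↭-sym p)) (Any.map (λ { refl → ↭-refl {x = H} }) H∈)

    Inv : (Hypergraph → ℚ) → Set
    Inv f = ∀ {H K} → H ↭ K → f H ≡ f K

    -- Exactly one element of `els` is a rearrangement of `K`, so the sum is the expansion of `D K`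
    -- over representatives.
    ∑-els-yes : ∀ {D} → Inv D → ∀ {K} → 𝓗 x K → ∑ els (λ E → ⟦ K ↭? E ⟧ * D E) ≡ D K
    ∑-els-yes {D} inv {K} 𝓗K with 𝓗⊆els 𝓗K
    ... | E , E∈ , K↭E = begin
      ∑ els (λ E → ⟦ K ↭? E ⟧ * D E)  ≡⟨ ∑-single els-unique E∈ off ⟩
      ⟦ K ↭? E ⟧ * D E                ≡⟨ cong₂ _*_ (⟦⟧-yes (K ↭? E) K↭E) (inv (↭-sym K↭E)) ⟩
      1ℚ * D K                        ≡⟨ ℚ.*-identityˡ (D K) ⟩
      D K                             ∎
      where
      open ≡-Reasoning
      els-unique : Unique els
      els-unique = AllPairs.map (λ { ≁ refl → ≁ ↭-refl }) els-distinct
      off : ∀ {F} → F ∈ˡ els → F ≢ E → ⟦ K ↭? F ⟧ * D F ≡ 0ℚ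
      off {F} F∈ F≢E = trans (cong (_* D F) (⟦⟧-no (K ↭? F) λ K↭F →
        F≢E (distinct-unique ↭-sym els-distinct F∈ E∈ (↭-trans (↭-sym K↭F) K↭E)))) (ℚ.*-zeroˡ (D F))

    ∑-els-no : ∀ (D : Hypergraph → ℚ) {K} → ¬ 𝓗 x K → ∑ els (λ E → ⟦ K ↭? E ⟧ * D E) ≡ 0ℚ
    ∑-els-no D {K} ¬𝓗K = ∑-zero els λ {E} E∈ → trans
      (cong (_* D E) (⟦⟧-no (K ↭? E) λ K↭E → ¬𝓗K (𝓗-↭ (↭-sym K↭E) (els⊆𝓗 E∈)))) (ℚ.*-zeroˡ (D E))

    abstract
      -- Abstract, so that the decision `𝓗?` stays folded; `accept-elim` says all that is used about
      -- it.
      accept : Hypergraph → Hypergraph → Hypergraph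
      accept H K = if does (𝓗? x K) then K else H

      accept-def : ∀ H K → (if does (𝓗? x K) then K else H) ≡ accept H K
      accept-def H K = refl

      accept-elim : ∀ {H K} (C : Hypergraph → Set) → (𝓗 x K → C K) → (¬ 𝓗 x K → C H) → C (accept H K)
      accept-elim {H} {K} C = if-elim C (𝓗? x K)

    accept-𝓗 : ∀ {H} K → 𝓗 x H → 𝓗 x (accept H K)
    accept-𝓗 K 𝓗H = accept-elim (𝓗 x) (λ 𝓗K → 𝓗K) (λ _ → 𝓗H)

    accept-yes : ∀ H {K} → 𝓗 x K → accept H K ≡ K
    accept-yes H {K} 𝓗K = accept-elim {H} {K} (_≡ K) (λ _ → refl) (contradiction 𝓗K)

    accept-no : ∀ H {K} → ¬ 𝓗 x K → accept H K ≡ H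
    accept-no H {K} ¬𝓗K = accept-elim {H} {K} (_≡ H) (λ 𝓗K → contradiction 𝓗K ¬𝓗K) (λ _ → refl)

    accept-inv : ∀ {f} → Inv f → ∀ {H H′ K K′} → H ↭ H′ → K ↭ K′ → f (accept H K) ≡ f (accept H′ K′)
    accept-inv {f} inv {H} {H′} {K} {K′} p q = accept-elim (λ L → f L ≡ f (accept H′ K′))
      (λ 𝓗K → trans (inv q) (cong f (sym (accept-yes H′ (𝓗-↭ q 𝓗K)))))
      (λ ¬𝓗K → trans (inv p) (cong f (sym (accept-no H′ (¬𝓗K ∘ 𝓗-↭ (↭-sym q))))))

    P : (Hypergraph → ℚ) → Hypergraph → ℚ
    P f H = 𝔼 (step x H) f

    P≡ : ∀ f H → P f H ≡ weight (pairs H) * 𝕊 H (f ∘ accept H)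
    P≡ f H = begin
      𝔼 (uniform (pairs H) >>= λ p → shuffle p >>= respond) f
        ≡⟨ trans (𝔼->>= (uniform (pairs H)) (λ p → shuffle p >>= respond) f)
             (𝔼-uniform (pairs H) (λ p → 𝔼 (shuffle p >>= respond) f)) ⟩
      weight (pairs H) * ∑ (pairs H) (λ p → 𝔼 (shuffle p >>= respond) f)
        ≡⟨ cong (weight (pairs H) *_) (∑-cong′ (pairs H) λ (a , b , r) → 𝔼-shuffle a b r) ⟩
      weight (pairs H) * 𝕊 H (f ∘ accept H) ∎
      where
      open ≡-Reasoning
      respond : Hypergraph → Dist Hypergraph
      respond K = return (if does (𝓗? x K) then K else H)
      𝔼-respond : ∀ K → 𝔼 (respond K) f ≡ f (accept H K)
      𝔼-respond K = trans (𝔼-return _ f) (cong f (accept-def H K))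
      𝔼-shuffle : ∀ a b r → 𝔼 (shuffle (a , b , r) >>= respond) f ≡
        weight (S a b) * ∑ (S a b) (λ (â , b̂) → f (accept H (â ∷ b̂ ∷ r)))
      𝔼-shuffle a b r = begin
        𝔼 (shuffle (a , b , r) >>= respond) f
          ≡⟨ 𝔼->>= (shuffle (a , b , r)) respond f ⟩
        𝔼 (uniform (S a b) >>= λ (â , b̂) → return (â ∷ b̂ ∷ r)) (λ K → 𝔼 (respond K) f)
          ≡⟨ trans (𝔼->>= (uniform (S a b)) (λ (â , b̂) → return (â ∷ b̂ ∷ r)) (λ K → 𝔼 (respond K) f))
               (𝔼-uniform (S a b) (λ (â , b̂) → 𝔼 (return (â ∷ b̂ ∷ r)) (λ K → 𝔼 (respond K) f))) ⟩
        weight (S a b) * ∑ (S a b) (λ (â , b̂) → 𝔼 (return (â ∷ b̂ ∷ r)) (λ K → 𝔼 (respond K) f))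
          ≡⟨ cong (weight (S a b) *_) (∑-cong′ (S a b) λ (â , b̂) →
               trans (𝔼-return (â ∷ b̂ ∷ r) (λ K → 𝔼 (respond K) f)) (𝔼-respond (â ∷ b̂ ∷ r))) ⟩
        weight (S a b) * ∑ (S a b) (λ (â , b̂) → f (accept H (â ∷ b̂ ∷ r))) ∎

    -- The method appends its last step at the end, so this step acts on `f` first; `iterate-+`
    -- moves that innermost `P` to the outside.
    outcome-𝔼 : ∀ k H f → 𝔼 (outcome x k H) f ≡ iterate P k f H
    outcome-𝔼 zero    H f = 𝔼-return H f
    outcome-𝔼 (suc k) H f = trans (𝔼->>= (outcome x k H) (step x) f) (trans (outcome-𝔼 k H (P f))
      (cong (λ g → g H) (trans (sym (iterate-+ P k 1 f)) (cong (λ l → iterate P l f) (ℕ.+-comm k 1)))))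

    weight-pairs : ∀ (H K : Hypergraph) → length H ≡ length K → weight (pairs H) ≡ weight (pairs K)
    weight-pairs H K eq = weight-cong (pairs H) (pairs K) (length-pairs H K eq)

    -- With two hyperarcs there is a pair to pick, so the weights of the pairs add up to one.
    pair∈ : ∀ {H} → 𝓗 x H → ∃[ p ] p ∈ˡ pairs H
    pair∈ {H} 𝓗H with H | subst (2 ℕ.≤_) (sym (𝓗-length 𝓗H)) 2≤
    ... | a ∷ b ∷ r | _ = (a , b , r) , here refl
    ... | _ ∷ []    | ℕ.s≤s ()

    weight-*-𝕊-const : ∀ {H} → 𝓗 x H → ∀ c → weight (pairs H) * 𝕊 H (λ _ → c) ≡ c
    weight-*-𝕊-const {H} 𝓗H c = trans (cong (weight (pairs H) *_) (𝕊-const H c))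
      (weight-*-∑-const (proj₂ (pair∈ 𝓗H)) c)

    P-inv : ∀ {f} → Inv f → Inv (P f)
    P-inv {f} inv {H} {K} H↭K = begin
      P f H                                    ≡⟨ P≡ f H ⟩
      weight (pairs H) * 𝕊 H (f ∘ accept H)
        ≡⟨ cong₂ _*_ (weight-pairs H K (↭-length H↭K))
             (trans (𝕊-cong H λ L → accept-inv {f} inv {H} {K} {L} {L} H↭K ↭-refl)
               (𝕊-↭ {H} {K} (λ {L} {L′} → accept-inv {f} inv {K} {K} {L} {L′} ↭-refl) H↭K)) ⟩
      weight (pairs K) * 𝕊 K (f ∘ accept K)    ≡⟨ P≡ f K ⟨
      P f K                                    ∎
      where open ≡-Reasoning

    P-mono : ∀ {f g} → (∀ {H} → 𝓗 x H → f H ≤ g H) → ∀ {H} → 𝓗 x H → P f H ≤ P g H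
    P-mono {f} {g} le {H} 𝓗H = begin
      P f H                                    ≡⟨ P≡ f H ⟩
      weight (pairs H) * 𝕊 H (f ∘ accept H)
        ≤⟨ *-monoˡ (weight-nonneg (pairs H)) (𝕊-mono H λ K → le (accept-𝓗 K 𝓗H)) ⟩
      weight (pairs H) * 𝕊 H (g ∘ accept H)    ≡⟨ P≡ g H ⟨
      P g H                                    ∎
      where open ℚ.≤-Reasoning

    P-affine : ∀ b c f {H} → 𝓗 x H → P (λ K → b + c * f K) H ≡ b + c * P f H
    P-affine b c f {H} 𝓗H = begin
      P (λ K → b + c * f K) H                            ≡⟨ P≡ (λ K → b + c * f K) H ⟩
      w * 𝕊 H (λ K → b + c * f (accept H K))
        ≡⟨ cong (w *_) (𝕊-cong H λ K → cong (b +_) (ℚ.*-comm c (f (accept H K)))) ⟩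
      w * 𝕊 H (λ K → b + f (accept H K) * c)
        ≡⟨ cong (w *_) (trans (𝕊-+ H (λ _ → b) (λ K → f (accept H K) * c))
             (cong (𝕊 H (λ _ → b) +_) (𝕊-*ʳ H (f ∘ accept H) c))) ⟩
      w * (𝕊 H (λ _ → b) + 𝕊 H (f ∘ accept H) * c)
        ≡⟨ solve 4 (λ w u v c → w :* (u :+ v :* c) := w :* u :+ c :* (w :* v))
             refl w (𝕊 H (λ _ → b)) (𝕊 H (f ∘ accept H)) c ⟩
      w * 𝕊 H (λ _ → b) + c * (w * 𝕊 H (f ∘ accept H))
        ≡⟨ cong₂ (λ u v → u + c * v) (weight-*-𝕊-const 𝓗H b) (sym (P≡ f H)) ⟩
      b + c * P f H                                      ∎
      where
      open ≡-Reasoning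
      w = weight (pairs H)

    -- A rejected proposal leaves `f` unchanged and matches no element of `els`. So the acceptance
    -- rule disappears and only flows within the space remain.
    drift : ∀ {f} → Inv f → ∀ {H} → 𝓗 x H →
            P f H ≡ f H + weight (pairs H) * ∑ els (λ E → flow H E * (f E - f H))
    drift {f} inv {H} 𝓗H = begin
      P f H                                              ≡⟨ P≡ f H ⟩
      w * 𝕊 H (f ∘ accept H)                             ≡⟨ cong (w *_) (𝕊-cong H expand) ⟩
      w * 𝕊 H (λ K → f H + ∑ els (λ E → ⟦ K ↭? E ⟧ * (f E - f H)))
        ≡⟨ cong (w *_) (trans (𝕊-+ H (λ _ → f H) (λ K → ∑ els (λ E → ⟦ K ↭? E ⟧ * (f E - f H))))
             (cong (𝕊 H (λ _ → f H) +_) (trans (𝕊-∑ H els (λ E K → ⟦ K ↭? E ⟧ * (f E - f H)))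
               (∑-cong′ els λ E → 𝕊-*ʳ H (λ K → ⟦ K ↭? E ⟧) (f E - f H))))) ⟩
      w * (𝕊 H (λ _ → f H) + ∑ els (λ E → flow H E * (f E - f H)))
        ≡⟨ ℚ.*-distribˡ-+ w (𝕊 H (λ _ → f H)) _ ⟩
      w * 𝕊 H (λ _ → f H) + w * ∑ els (λ E → flow H E * (f E - f H))
        ≡⟨ cong (_+ w * ∑ els (λ E → flow H E * (f E - f H))) (weight-*-𝕊-const 𝓗H (f H)) ⟩
      f H + w * ∑ els (λ E → flow H E * (f E - f H))     ∎
      where
      open ≡-Reasoning
      w = weight (pairs H)
      expand : ∀ K → f (accept H K) ≡ f H + ∑ els (λ E → ⟦ K ↭? E ⟧ * (f E - f H))
      expand K = accept-elim (λ L → f L ≡ f H + ∑ els (λ E → ⟦ K ↭? E ⟧ * (f E - f H)))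
        (λ 𝓗K → trans (solve 2 (λ u v → u := v :+ (u :+ :- v)) refl (f K) (f H))
          (cong (f H +_) (sym (∑-els-yes {λ E → f E - f H} (λ p → cong (_- f H) (inv p)) 𝓗K))))
        (λ ¬𝓗K → trans (sym (ℚ.+-identityʳ (f H))) (cong (f H +_) (sym (∑-els-no (λ E → f E - f H) ¬𝓗K))))

    -- Interchanging `H` and `K` changes the sign of every term: by `flow-sym` if they differ, and
    -- because `f K - f H` vanishes if they are the same hypergraph. So the sum is its own negative.
    net-flow≡0 : ∀ {f} → Inv f → ∑ els (λ H → ∑ els (λ K → flow H K * (f K - f H))) ≡ 0ℚ
    net-flow≡0 {f} inv = begin
      Z                     ≡⟨ solve 1 (λ z → z := con ℚ.½ :* (z :+ z)) refl Z ⟩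
      ℚ.½ * (Z + Z)         ≡⟨ cong (λ z → ℚ.½ * (Z + z)) Z≡-Z ⟩
      ℚ.½ * (Z + - 1ℚ * Z)  ≡⟨ solve 1 (λ z → con ℚ.½ :* (z :+ con (- 1ℚ) :* z) := con 0ℚ) refl Z ⟩
      0ℚ                    ∎
      where
      open ≡-Reasoning
      Z = ∑ els (λ H → ∑ els (λ K → flow H K * (f K - f H)))
      antisymmetric : ∀ {H K} → H ∈ˡ els → K ∈ˡ els → flow H K * (f K - f H) ≡ - 1ℚ * (flow K H * (f H - f K))
      antisymmetric {H} {K} H∈ K∈ = by-cases (H ↭? K)
        where
        by-cases : Dec (H ↭ K) → flow H K * (f K - f H) ≡ - 1ℚ * (flow K H * (f H - f K))
        by-cases (yes H↭K) = trans (cong (λ v → flow H K * (f K - v)) (inv H↭K))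
          (trans (solve 3 (λ a b u → a :* (u :+ :- u) := con (- 1ℚ) :* (b :* (u :+ :- u)))
            refl (flow H K) (flow K H) (f K))
            (cong (λ v → - 1ℚ * (flow K H * (v - f K))) (sym (inv H↭K))))
        by-cases (no H≁K) = trans (cong (_* (f K - f H)) (flow-sym (proj₁ (els⊆𝓗 H∈)) (proj₁ (els⊆𝓗 K∈)) H≁K))
          (solve 3 (λ a u v → a :* (v :+ :- u) := con (- 1ℚ) :* (a :* (u :+ :- v)))
            refl (flow K H) (f H) (f K))
      Z≡-Z : Z ≡ - 1ℚ * Z
      Z≡-Z = begin
        Z
          ≡⟨ ∑-cong els (λ {H} H∈ → trans (∑-cong els λ {K} K∈ → antisymmetric H∈ K∈)
               (∑-*ˡ els (- 1ℚ) (λ K → flow K H * (f H - f K)))) ⟩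
        ∑ els (λ H → - 1ℚ * ∑ els (λ K → flow K H * (f H - f K)))
          ≡⟨ ∑-*ˡ els (- 1ℚ) (λ H → ∑ els (λ K → flow K H * (f H - f K))) ⟩
        - 1ℚ * ∑ els (λ H → ∑ els (λ K → flow K H * (f H - f K)))
          ≡⟨ cong (- 1ℚ *_) (∑-comm els els (λ H K → flow K H * (f H - f K))) ⟩
        - 1ℚ * Z ∎

    stationary : ∀ {f} → Inv f → ∑ els (P f) ≡ ∑ els f
    stationary {f} inv = begin
      ∑ els (P f)
        ≡⟨ ∑-cong els (λ {H} H∈ → trans (drift inv (els⊆𝓗 H∈))
             (cong (λ v → f H + v * net H) (same-weight H∈))) ⟩
      ∑ els (λ H → f H + w * net H)     ≡⟨ ∑-+ els f (λ H → w * net H) ⟩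
      ∑ els f + ∑ els (λ H → w * net H) ≡⟨ cong (∑ els f +_) (∑-*ˡ els w net) ⟩
      ∑ els f + w * ∑ els net           ≡⟨ cong (λ z → ∑ els f + w * z) (net-flow≡0 inv) ⟩
      ∑ els f + w * 0ℚ                  ≡⟨ cong (∑ els f +_) (ℚ.*-zeroʳ w) ⟩
      ∑ els f + 0ℚ                      ≡⟨ ℚ.+-identityʳ (∑ els f) ⟩
      ∑ els f                           ∎
      where
      open ≡-Reasoning
      net = λ H → ∑ els (λ K → flow H K * (f K - f H))
      -- Every state has as many hyperarcs as `δ` has entries, so `δ` itself serves to name the
      -- common number of pairs.
      w = weight (pairs δ)
      same-weight : ∀ {H} → H ∈ˡ els → weight (pairs H) ≡ w
      same-weight {H} H∈ = weight-cong (pairs H) (pairs δ) (length-pairs H δ (𝓗-length (els⊆𝓗 H∈)))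

    open Kernel _↭_ (𝓗 x) P using (Minorises)

    -- Of the sums that make up `P` only one term is kept: the front pair of `a ∷ b ∷ r` and its one
    -- shuffle.
    shuffle-minorises : ∀ {H a b r â b̂} → H ↭ a ∷ b ∷ r → (a , b) ⇝ (â , b̂) → 𝓗 x H →
                        𝓗 x (â ∷ b̂ ∷ r) → Minorises 1 H (â ∷ b̂ ∷ r)
    shuffle-minorises {H} {a} {b} {r} {â} {b̂} H↭ ⇝ŝ 𝓗H 𝓗K =
      w * v , *-pos (weight-pos {xs = pairs L} (here refl)) (weight-pos (S-complete ⇝ŝ)) , λ {f} inv 0≤f →
        let ψ = λ (p : Split) → weight (S (proj₁ p) (proj₁ (proj₂ p))) *
                  ∑ (S (proj₁ p) (proj₁ (proj₂ p))) (λ ŝ → f (accept L (proj₁ ŝ ∷ proj₂ ŝ ∷ proj₂ (proj₂ p))))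
            0≤fa : ∀ K → 0ℚ ≤ f (accept L K)
            0≤fa K = 0≤f (accept-𝓗 K (𝓗-↭ H↭ 𝓗H))
        in begin
        w * v * f (â ∷ b̂ ∷ r)                     ≡⟨ ℚ.*-assoc w v _ ⟩
        w * (v * f (â ∷ b̂ ∷ r))                   ≡⟨ cong (λ K → w * (v * f K)) (accept-yes L 𝓗K) ⟨
        w * (v * f (accept L (â ∷ b̂ ∷ r)))
          ≤⟨ *-monoˡ (weight-nonneg (pairs L)) (*-monoˡ (weight-nonneg (S a b))
               (∑-≥ (λ _ → 0≤fa _) (S-complete ⇝ŝ))) ⟩
        w * ψ (a , b , r)
          ≤⟨ *-monoˡ (weight-nonneg (pairs L)) (∑-≥ {xs = pairs L} {f = ψ} (λ {p} _ →
               *-nonneg (weight-nonneg (S (proj₁ p) (proj₁ (proj₂ p)))) (∑-nonneg (S (proj₁ p) (proj₁ (proj₂ p)))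
                 λ {ŝ} _ → 0≤fa (proj₁ ŝ ∷ proj₂ ŝ ∷ proj₂ (proj₂ p)))) (here refl)) ⟩
        w * 𝕊 L (f ∘ accept L)                    ≡⟨ P≡ f L ⟨
        P f L                                     ≡⟨ P-inv inv H↭ ⟨
        P f H                                     ∎
      where
      open ℚ.≤-Reasoning
      L = a ∷ b ∷ r
      w = weight (pairs L)
      v = weight (S a b)

    -- The pair `(a , b)` is one of its own shuffles.
    lazy : ∀ {H} → 𝓗 x H → Minorises 1 H H
    lazy {H} 𝓗H = stay (pairs-↭ (proj₂ (pair∈ 𝓗H)))
      where
      stay : ∀ {a b r} → a ∷ b ∷ r ↭ H → Minorises 1 H H
      stay {a} {b} {r} p = proj₁ minor , proj₁ (proj₂ minor) , λ {f} inv 0≤f →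
        subst (λ v → proj₁ minor * v ≤ P f H) (inv p) (proj₂ (proj₂ minor) inv 0≤f)
        where
        minor = shuffle-minorises {H} {a} {b} {r} {a} {b} (↭-sym p) (⇝-refl {a , b}) 𝓗H (𝓗-↭ (↭-sym p) 𝓗H)

    chain : UniformChain _↭_ (𝓗 x) els
    chain = record
      { P = P ; els⊆𝓢 = els⊆𝓗 ; 𝓢⊆els = 𝓗⊆els ; P-inv = P-inv ; P-mono = P-mono ; P-affine = P-affine
      ; stationary = stationary ; lazy = lazy }

-- Counting in Fin n

𝟙 : ∀ {P : Set} → Dec P → ℕ
𝟙 P? = if does P? then 1 else 0

𝟙-yes : ∀ {P : Set} (P? : Dec P) → P → 𝟙 P? ≡ 1
𝟙-yes (yes _) p = refl
𝟙-yes (no ¬p) p = contradiction p ¬p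

𝟙-no : ∀ {P : Set} (P? : Dec P) → ¬ P → 𝟙 P? ≡ 0
𝟙-no (yes p) ¬p = contradiction p ¬p
𝟙-no (no _)  ¬p = refl

𝟙-mono : ∀ {P Q : Set} (P? : Dec P) (Q? : Dec Q) → (P → Q) → 𝟙 P? ℕ.≤ 𝟙 Q?
𝟙-mono (yes p) Q? f = ℕ.≤-reflexive (sym (𝟙-yes Q? (f p)))
𝟙-mono (no _)  Q? f = ℕ.z≤n

𝟙-cong : ∀ {P Q : Set} (P? : Dec P) (Q? : Dec Q) → (P → Q) → (Q → P) → 𝟙 P? ≡ 𝟙 Q?
𝟙-cong P? Q? f g = ℕ.≤-antisym (𝟙-mono P? Q? f) (𝟙-mono Q? P? g)

sum-mono : ∀ {n} {f g : Fin n → ℕ} → (∀ i → f i ℕ.≤ g i) → sum f ℕ.≤ sum g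
sum-mono {zero}  le = ℕ.z≤n
sum-mono {suc n} le = ℕ.+-mono-≤ (le zero) (sum-mono (le ∘ suc))

sum-mono-< : ∀ {n} {f g : Fin n → ℕ} → (∀ i → f i ℕ.≤ g i) → ∀ i → f i ℕ.< g i → sum f ℕ.< sum g
sum-mono-< {suc n} le zero    lt = ℕ.+-mono-<-≤ lt (sum-mono (le ∘ suc))
sum-mono-< {suc n} le (suc i) lt = ℕ.+-mono-≤-< (le zero) (sum-mono-< (le ∘ suc) i lt)

≤-sum : ∀ {n} (f : Fin n → ℕ) i → f i ℕ.≤ sum f
≤-sum {suc n} f zero    = ℕ.m≤m+n (f zero) _
≤-sum {suc n} f (suc i) = ℕ.≤-trans (≤-sum (f ∘ suc) i) (ℕ.m≤n+m _ (f zero))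

sum-zero : ∀ {n} {f : Fin n → ℕ} → (∀ i → f i ≡ 0) → sum f ≡ 0
sum-zero {n} eq = trans (sum-cong-≗ eq) (sum-replicate-zero n)

sum-𝟙≤1 : ∀ {n} {P : Fin n → Set} (P? : Unary.Decidable P) → (∀ {i j} → P i → P j → i ≡ j) → sum (𝟙 ∘ P?) ℕ.≤ 1
sum-𝟙≤1 {zero}  P? uniq = ℕ.z≤n
sum-𝟙≤1 {suc n} P? uniq with P? zero
... | yes p = ℕ.≤-reflexive (cong suc (sum-zero λ i → 𝟙-no (P? (suc i)) λ q → contradiction (uniq p q) λ ()))
... | no  _ = sum-𝟙≤1 (P? ∘ suc) λ p q → Fin.suc-injective (uniq p q)

-- Double counting of the matched pairs: each `i` in `P` has at least one partner, and each `j` in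
-- `Q` is the partner of at most one.
sum-𝟙-matching : ∀ {k n} {P : Fin k → Set} {Q : Fin n → Set} {T : Fin k → Fin n → Set}
  (P? : Unary.Decidable P) (Q? : Unary.Decidable Q) (T? : ∀ i j → Dec (T i j)) →
  (∀ {i} → P i → ∃[ j ] Q j × T i j) → (∀ {i i′ j} → P i → P i′ → T i j → T i′ j → i ≡ i′) →
  sum (𝟙 ∘ P?) ℕ.≤ sum (𝟙 ∘ Q?)
sum-𝟙-matching {k} {n} {P} {Q} {T} P? Q? T? total injective = begin
  sum (𝟙 ∘ P?)                             ≤⟨ sum-mono row ⟩
  sum (λ i → sum (λ j → 𝟙 (matched? i j))) ≡⟨ sum-comm (λ i j → 𝟙 (matched? i j)) ⟩
  sum (λ j → sum (λ i → 𝟙 (matched? i j))) ≤⟨ sum-mono column ⟩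
  sum (𝟙 ∘ Q?)                             ∎
  where
  open ℕ.≤-Reasoning
  matched? = λ i j → P? i ×-dec Q? j ×-dec T? i j
  row : ∀ i → 𝟙 (P? i) ℕ.≤ sum (λ j → 𝟙 (matched? i j))
  row i with P? i in eq
  ... | no _  = ℕ.z≤n
  ... | yes p with total p
  ...   | j , q , t = ℕ.≤-trans (ℕ.≤-reflexive (sym (𝟙-yes (yes p ×-dec Q? j ×-dec T? i j) (p , q , t))))
                        (≤-sum (λ j → 𝟙 (yes p ×-dec Q? j ×-dec T? i j)) j)
  column : ∀ j → sum (λ i → 𝟙 (matched? i j)) ℕ.≤ 𝟙 (Q? j)
  column j = by-cases (Q? j)
    where
    by-cases : (q? : Dec (Q j)) → sum (λ i → 𝟙 (P? i ×-dec q? ×-dec T? i j)) ℕ.≤ 𝟙 q?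
    by-cases (yes q) = sum-𝟙≤1 (λ i → P? i ×-dec yes q ×-dec T? i j)
      λ (p , _ , t) (p′ , _ , t′) → injective p p′ t t′
    by-cases (no ¬q) = ℕ.≤-reflexive (sum-zero λ i → 𝟙-no (P? i ×-dec no ¬q ×-dec T? i j) (¬q ∘ proj₁ ∘ proj₂))

-- Assignments of stubs to hyperarcs

module _ {N k : ℕ} where

  exchange : Fin N → Fin N → (Fin N → Fin k) → Fin N → Fin k
  exchange i j f = f ∘ (transpose i j ⟨$⟩ʳ_)

  exchange-first : ∀ i j f → exchange i j f i ≡ f j
  exchange-first i j f with i Fin.≟ i
  ... | yes _  = refl
  ... | no i≢i = contradiction refl i≢i

  exchange-second : ∀ i j f → exchange i j f j ≡ f i
  exchange-second i j f with j Fin.≟ i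
  ... | yes refl = refl
  ... | no _ with j Fin.≟ j
  ...   | yes _  = refl
  ...   | no j≢j = contradiction refl j≢j

  exchange-other : ∀ {i j} f {l} → l ≢ i → l ≢ j → exchange i j f l ≡ f l
  exchange-other {i} {j} f {l} l≢i l≢j with l Fin.≟ i
  ... | yes l≡i = contradiction l≡i l≢i
  ... | no _ with l Fin.≟ j
  ...   | yes l≡j = contradiction l≡j l≢j
  ...   | no _ = refl

  load : (Fin N → Fin k) → Fin k → ℕ
  load f a = sum (λ l → 𝟙 (f l Fin.≟ a))

  load-exchange : ∀ i j f a → load (exchange i j f) a ≡ load f a
  load-exchange i j f a = sym (sum-permute (λ l → 𝟙 (f l Fin.≟ a)) (transpose i j))

-- No hyperarc contains two stubs of the same owner.
Simple : ∀ {N n k} → (Fin N → Fin n) → (Fin N → Fin k) → Set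
Simple owner f = ∀ {i j} → f i ≡ f j → owner i ≡ owner j → i ≡ j

module Assignments {N n : ℕ} (owner : Fin N → Fin n)
  (owner-mono : ∀ {i j} → i Fin.≤ j → owner i Fin.≤ owner j) (k : ℕ) where

  Assignment : Set
  Assignment = Fin N → Fin k

  -- Only `i` and `j` get a new hyperarc. The first guard protects the hyperarc of `i` against the
  -- arriving `j`, excepting `i` itself because it leaves; the second does the same for the hyperarc
  -- of `j`.
  exchange-simple : ∀ (f : Assignment) i j → Simple owner f → f i ≢ f j →
    (∀ l → f l ≡ f i → owner l ≡ owner j → l ≡ i) → (∀ l → f l ≡ f j → owner l ≡ owner i → l ≡ j) →
    Simple owner (exchange i j f)
  exchange-simple f i j simple fi≢fj leave enter {x} {y} =
    by-cases (x Fin.≟ i) (x Fin.≟ j) (y Fin.≟ i) (y Fin.≟ j)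
    where
    f′ = exchange i j f
    by-cases : Dec (x ≡ i) → Dec (x ≡ j) → Dec (y ≡ i) → Dec (y ≡ j) → f′ x ≡ f′ y → owner x ≡ owner y → x ≡ y
    by-cases (yes refl) _ (yes refl) _ _ _ = refl
    by-cases (yes refl) _ (no _) (yes refl) eq _ =
      contradiction (trans (sym (exchange-second i j f)) (trans (sym eq) (exchange-first i j f))) fi≢fj
    by-cases (yes refl) _ (no y≢i) (no y≢j) eq ow = contradiction
      (enter y (trans (sym (exchange-other f y≢i y≢j)) (trans (sym eq) (exchange-first i j f))) (sym ow)) y≢j
    by-cases (no _) (yes refl) (yes refl) _ eq _ =
      contradiction (trans (sym (exchange-second i j f)) (trans eq (exchange-first i j f))) fi≢fj
    by-cases (no _) (yes refl) (no _) (yes refl) _ _ = refl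
    by-cases (no _) (yes refl) (no y≢i) (no y≢j) eq ow = contradiction
      (leave y (trans (sym (exchange-other f y≢i y≢j)) (trans (sym eq) (exchange-second i j f))) (sym ow)) y≢i
    by-cases (no x≢i) (no x≢j) (yes refl) _ eq ow = contradiction
      (enter x (trans (sym (exchange-other f x≢i x≢j)) (trans eq (exchange-first i j f))) ow) x≢j
    by-cases (no x≢i) (no x≢j) (no _) (yes refl) eq ow = contradiction
      (leave x (trans (sym (exchange-other f x≢i x≢j)) (trans eq (exchange-second i j f))) ow) x≢i
    by-cases (no x≢i) (no x≢j) (no y≢i) (no y≢j) eq ow = simple
      (trans (sym (exchange-other f x≢i x≢j)) (trans eq (exchange-other f y≢i y≢j))) ow

  free : Fin N → Assignment → Fin k → ℕ
  free i f a = sum (λ l → 𝟙 ((i Fin.≤? l) ×-dec (f l Fin.≟ a)))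

  Agree : ℕ → Assignment → Assignment → Set
  Agree t f g = ∀ l → toℕ l ℕ.< t → f l ≡ g l

  -- Total loads agree and so do the treated stubs. Thus a comparison of free stubs made in `f` is
  -- also valid in `g`.
  free-agree : ∀ {i f g} a → Agree (toℕ i) f g → load f a ≡ load g a → free i f a ≡ free i g a
  free-agree {i} {f} {g} a agree eq = ℕ.+-cancelˡ-≡ (fixed f) _ _ (begin
    fixed f ℕ.+ free i f a ≡⟨ split f ⟨
    load f a               ≡⟨ eq ⟩
    load g a               ≡⟨ split g ⟩
    fixed g ℕ.+ free i g a ≡⟨ cong (ℕ._+ free i g a) (sum-cong-≗ same) ⟨
    fixed f ℕ.+ free i g a ∎)
    where
    open ≡-Reasoning
    fixed : Assignment → ℕ
    fixed f = sum (λ l → 𝟙 (¬? (i Fin.≤? l) ×-dec (f l Fin.≟ a)))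
    split : ∀ f → load f a ≡ fixed f ℕ.+ free i f a
    split f = trans (sum-cong-≗ λ l → pointwise (i Fin.≤? l) (f l Fin.≟ a)) (sum-distrib-+
      (λ l → 𝟙 (¬? (i Fin.≤? l) ×-dec (f l Fin.≟ a))) (λ l → 𝟙 ((i Fin.≤? l) ×-dec (f l Fin.≟ a))))
      where
      pointwise : ∀ {P Q : Set} (P? : Dec P) (Q? : Dec Q) → 𝟙 Q? ≡ 𝟙 (¬? P? ×-dec Q?) ℕ.+ 𝟙 (P? ×-dec Q?)
      pointwise (yes _) Q? = refl
      pointwise (no _)  Q? = sym (ℕ.+-identityʳ _)
    same : ∀ l → 𝟙 (¬? (i Fin.≤? l) ×-dec (f l Fin.≟ a)) ≡ 𝟙 (¬? (i Fin.≤? l) ×-dec (g l Fin.≟ a))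
    same l = 𝟙-cong (¬? (i Fin.≤? l) ×-dec (f l Fin.≟ a)) (¬? (i Fin.≤? l) ×-dec (g l Fin.≟ a))
      (λ (l<i , fl≡a) → l<i , trans (sym (agree l (ℕ.≰⇒> l<i))) fl≡a)
      (λ (l<i , gl≡a) → l<i , trans (agree l (ℕ.≰⇒> l<i)) gl≡a)

  -- By pigeonhole: otherwise every free stub of b shares its owner with a free
  -- stub of f i other than i.
  exchangeable : ∀ (f : Assignment) {i b} → Simple owner f → f i ≢ b →
    (∀ l → l Fin.< i → owner l ≡ owner i → f l ≢ b) →
    free i f (f i) ℕ.≤ free i f b → ∃[ j ] i Fin.≤ j × f j ≡ b × Simple owner (exchange i j f)
  exchangeable f {i} {b} simple fi≢b earlier a≤b =
    by-cases (Fin.any? λ j → (f j Fin.≟ b) ×-dec (owner j Fin.≟ owner i))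
             (Fin.any? λ j → (i Fin.≤? j) ×-dec (f j Fin.≟ b) ×-dec ¬? (clash? j))
    where
    a = f i
    clash? : ∀ j → Dec (∃[ l ] f l ≡ a × owner l ≡ owner j)
    clash? j = Fin.any? λ l → (f l Fin.≟ a) ×-dec (owner l Fin.≟ owner j)
    by-cases : Dec (∃[ j ] f j ≡ b × owner j ≡ owner i) →
      Dec (∃[ j ] i Fin.≤ j × f j ≡ b × ¬ (∃[ l ] f l ≡ a × owner l ≡ owner j)) →
      ∃[ j ] i Fin.≤ j × f j ≡ b × Simple owner (exchange i j f)
    -- Two stubs of the same owner can always be exchanged; `earlier` makes `j` untreated.
    by-cases (yes (j , refl , ow)) _ =
      j , ℕ.≮⇒≥ (λ j<i → earlier j j<i ow refl) , refl , exchange-simple f i j simple fi≢b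
        (λ l fl≡a ow′ → simple fl≡a (trans ow′ ow))
        (λ l fl≡b ow′ → simple fl≡b (trans ow′ (sym ow)))
    by-cases (no none) (yes (j , i≤j , refl , noclash)) =
      j , i≤j , refl , exchange-simple f i j simple fi≢b
        (λ l fl≡a ow → contradiction (l , fl≡a , ow) noclash)
        (λ l fl≡b ow → contradiction (l , fl≡b , ow) none)
    by-cases (no none) (no stuck) = contradiction (ℕ.≤-<-trans b≤ <a) (ℕ.≤⇒≯ a≤b)
      where
      free? = λ l → (i Fin.≤? l) ×-dec (f l Fin.≟ a)
      others? = λ l → ((i Fin.≤? l) ×-dec (f l Fin.≟ a)) ×-dec ¬? (l Fin.≟ i)
      <a : sum (𝟙 ∘ others?) ℕ.< free i f a
      <a = sum-mono-< (λ l → 𝟙-mono (others? l) (free? l) proj₁) i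
        (ℕ.≤-reflexive (trans (cong suc (𝟙-no (others? i) (λ (_ , i≢i) → i≢i refl)))
          (sym (𝟙-yes (free? i) (ℕ.≤-refl , refl)))))
      partner : ∀ {j} → i Fin.≤ j × f j ≡ b → ∃[ l ] ((i Fin.≤ l × f l ≡ a) × l ≢ i) × owner j ≡ owner l
      partner {j} (i≤j , fj≡b) with clash? j
      ... | no ¬clash = contradiction (j , i≤j , fj≡b , ¬clash) stuck
      ... | yes (l , fl≡a , ow) = l , ((ℕ.≮⇒≥ l≮i , fl≡a) , λ { refl → none (j , fj≡b , sym ow) }) , sym ow
        where
        -- By monotonicity an earlier `l` would squeeze the owner of `i` between the equal owners of
        -- `l` and `j`, giving `b` a stub with the owner of `i`.
        l≮i : ¬ (l Fin.< i)
        l≮i l<i = none (j , fj≡b , Fin.≤-antisym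
          (ℕ.≤-trans (ℕ.≤-reflexive (cong toℕ (sym ow))) (owner-mono (ℕ.<⇒≤ l<i))) (owner-mono i≤j))
      b≤ : free i f b ℕ.≤ sum (𝟙 ∘ others?)
      b≤ = sum-𝟙-matching (λ j → (i Fin.≤? j) ×-dec (f j Fin.≟ b)) others? (λ j l → owner j Fin.≟ owner l)
        partner (λ (_ , fj≡b) (_ , fj′≡b) ow ow′ → simple (trans fj≡b (sym fj′≡b)) (trans ow (sym ow′)))

  -- A path built from both ends. The inequalities ensure that each exchange concerns two distinct
  -- hyperarcs, hence is a shuffle.
  data _↭ᵃ_ : Assignment → Assignment → Set where
    done  : ∀ {f g} → f ≗ g → f ↭ᵃ g
    left  : ∀ {f g i j} → f i ≢ f j → Simple owner (exchange i j f) → exchange i j f ↭ᵃ g → f ↭ᵃ g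
    right : ∀ {f g i j} → g i ≢ g j → Simple owner (exchange i j g) → f ↭ᵃ exchange i j g → f ↭ᵃ g

  agree-suc : ∀ {f g} i → Agree (toℕ i) f g → f i ≡ g i → Agree (suc (toℕ i)) f g
  agree-suc i agree eq l l≤i with ℕ.m≤n⇒m<n∨m≡n (ℕ.s≤s⁻¹ l≤i)
  ... | inj₁ l<i = agree l l<i
  ... | inj₂ l≡i with Fin.toℕ-injective l≡i
  ...   | refl = eq

  exchange-before : ∀ {i j} (f : Assignment) l → i Fin.≤ j → l Fin.< i → exchange i j f l ≡ f l
  exchange-before f l i≤j l<i = exchange-other f
    (λ { refl → ℕ.<-irrefl refl l<i }) (λ { refl → ℕ.<-irrefl refl (ℕ.<-≤-trans l<i i≤j) })

  -- Induction on the number `u` of untreated stubs; the first `t` stubs already agree and are never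
  -- moved again.
  connect : ∀ u t → t ℕ.+ u ≡ N → ∀ {f g} → Simple owner f → Simple owner g →
            (∀ a → load f a ≡ load g a) → Agree t f g → f ↭ᵃ g

  connect-at : ∀ u i → toℕ i ℕ.+ suc u ≡ N → ∀ {f g} → Simple owner f → Simple owner g →
               (∀ a → load f a ≡ load g a) → Agree (toℕ i) f g → f ↭ᵃ g

  connect zero    t t≡N simple-f simple-g loads agree =
    done λ l → agree l (subst (toℕ l ℕ.<_) (trans (sym t≡N) (ℕ.+-identityʳ t)) (Fin.toℕ<n l))
  connect (suc u) t t+u≡N {f} {g} simple-f simple-g loads agree =
    connect-at u (fromℕ< t<N) (subst (λ v → v ℕ.+ suc u ≡ N) t≡ t+u≡N) simple-f simple-g loads
      (subst (λ v → Agree v f g) t≡ agree)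
    where
    t<N : t ℕ.< N
    t<N = subst (suc t ℕ.≤_) (trans (sym (ℕ.+-suc t u)) t+u≡N) (ℕ.m≤m+n (suc t) u)
    t≡ : t ≡ toℕ (fromℕ< t<N)
    t≡ = sym (Fin.toℕ-fromℕ< t<N)

  connect-at u i i+u≡N {f} {g} simple-f simple-g loads agree = by-cases (f i Fin.≟ g i)
    where
    next : suc (toℕ i) ℕ.+ u ≡ N
    next = trans (sym (ℕ.+-suc (toℕ i) u)) i+u≡N
    by-cases : Dec (f i ≡ g i) → f ↭ᵃ g
    by-cases (yes eq) = connect u _ next {f} {g} simple-f simple-g loads (agree-suc {f} {g} i agree eq)
    by-cases (no fi≢gi) with ℕ.≤-total (free i f (f i)) (free i f (g i))
    -- The treated stubs lie as in `g`, and `g` puts no second stub of this owner into `g i`; so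
    -- none of them blocks the exchange.
    ... | inj₁ a≤b =
      let (j , i≤j , fj≡gi , simple) = exchangeable f simple-f fi≢gi
            (λ l l<i ow fl≡gi → contradiction
              (cong toℕ (simple-g (trans (sym (agree l l<i)) fl≡gi) ow)) (ℕ.<⇒≢ l<i))
            a≤b
      in left {f} {g} {i} {j} (fi≢gi ∘ (λ eq → trans eq fj≡gi)) simple
           (connect u _ next {exchange i j f} {g} simple simple-g
           (λ a → trans (load-exchange i j f a) (loads a))
           (agree-suc {exchange i j f} {g} i (λ l l<i → trans (exchange-before f l i≤j l<i) (agree l l<i))
             (trans (exchange-first i j f) fj≡gi)))
    -- The roles of `f` and `g` are interchanged: now `f i` has at least as many untreated stubs, so
    -- `g` can be altered to put stub `i` there.
    ... | inj₂ b≤a =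
      let (j , i≤j , gj≡fi , simple) = exchangeable g simple-g (fi≢gi ∘ sym)
            (λ l l<i ow gl≡fi → contradiction
              (cong toℕ (simple-f (trans (agree l l<i) gl≡fi) ow)) (ℕ.<⇒≢ l<i))
            (subst (λ v → v ℕ.≤ free i g (f i)) (free-agree (g i) agree (loads (g i)))
              (subst (free i f (g i) ℕ.≤_) (free-agree (f i) agree (loads (f i))) b≤a))
      in right {f} {g} {i} {j} (fi≢gi ∘ sym ∘ (λ eq → trans eq gj≡fi)) simple
           (connect u _ next {f} {exchange i j g} simple-f simple
           (λ a → trans (loads a) (sym (load-exchange i j g a)))
           (agree-suc {f} {exchange i j g} i (λ l l<i → trans (agree l l<i) (sym (exchange-before g l i≤j l<i)))
             (sym (trans (exchange-first i j g) gj≡fi))))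

  connected : ∀ {f g} → Simple owner f → Simple owner g → (∀ a → load f a ≡ load g a) → f ↭ᵃ g
  connected simple-f simple-g loads = connect N 0 refl simple-f simple-g loads λ l ()

-- Stubs and their vertices

owner : ∀ {n} (deg : Vec ℕ n) → Fin (Vec.sum deg) → Fin n
owner (zero  ∷ deg) i       = suc (owner deg i)
owner (suc k ∷ deg) zero    = zero
owner (suc k ∷ deg) (suc i) = owner (k ∷ deg) i

owner-mono : ∀ {n} (deg : Vec ℕ n) {i j} → i Fin.≤ j → owner deg i Fin.≤ owner deg j
owner-mono (zero  ∷ deg)                 i≤j         = ℕ.s≤s (owner-mono deg i≤j)
owner-mono (suc k ∷ deg) {zero}          _           = ℕ.z≤n
owner-mono (suc k ∷ deg) {suc i} {suc j} (ℕ.s≤s i≤j) = owner-mono (k ∷ deg) i≤j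

∈-stubs-owner : ∀ {n} (deg : Vec ℕ n) i → i ∈ stubs deg (owner deg i)
∈-stubs-owner (zero  ∷ deg) i    = ∈-stubs-owner deg i
∈-stubs-owner (suc k ∷ deg) zero = Vec.here
∈-stubs-owner (suc k ∷ deg) (suc i) with owner (k ∷ deg) i | ∈-stubs-owner (k ∷ deg) i
... | zero  | i∈ = Vec.there i∈
... | suc v | i∈ = Vec.there i∈

∈-stubs⇒owner : ∀ {n} (deg : Vec ℕ n) {i v} → i ∈ stubs deg v → owner deg i ≡ v
∈-stubs⇒owner (zero  ∷ deg) {i}     {zero}  i∈ = contradiction i∈ Subset.∉⊥
∈-stubs⇒owner (zero  ∷ deg) {i}     {suc v} i∈ = cong suc (∈-stubs⇒owner deg i∈)
∈-stubs⇒owner (suc k ∷ deg) {zero}  {zero}  _  = refl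
∈-stubs⇒owner (suc k ∷ deg) {suc i} {zero}  (Vec.there i∈) = ∈-stubs⇒owner (k ∷ deg) {i} {zero} i∈
∈-stubs⇒owner (suc k ∷ deg) {suc i} {suc v} (Vec.there i∈) = ∈-stubs⇒owner (k ∷ deg) {i} {suc v} i∈

0<∣p∣⇒nonempty : ∀ {n} (p : Subset n) → 0 ℕ.< ∣ p ∣ → Nonempty p
0<∣p∣⇒nonempty {n} p 0<∣p∣ with Subset.nonempty? p
... | yes ne = ne
... | no  ¬ne = contradiction (trans (cong ∣_∣ (Subset.Empty-unique ¬ne)) (Subset.∣⊥∣≡0 n)) (ℕ.>⇒≢ 0<∣p∣)

1<∣p∣⇒two : ∀ {n} (p : Subset n) → 1 ℕ.< ∣ p ∣ → ∃[ i ] ∃[ j ] i ≢ j × i ∈ p × j ∈ p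
1<∣p∣⇒two (outside ∷ p) lt with 1<∣p∣⇒two p lt
... | i , j , i≢j , i∈ , j∈ = suc i , suc j , i≢j ∘ Fin.suc-injective , Vec.there i∈ , Vec.there j∈
1<∣p∣⇒two (inside ∷ p) (ℕ.s≤s lt) with 0<∣p∣⇒nonempty p lt
... | j , j∈ = zero , suc j , (λ ()) , Vec.here , Vec.there j∈

two⇒1<∣p∣ : ∀ {n} {p : Subset n} {i j} → i ≢ j → i ∈ p → j ∈ p → 1 ℕ.< ∣ p ∣
two⇒1<∣p∣ {p = p} {i} i≢j i∈ j∈ = ℕ.≤-<-trans
  (ℕ.≤-<-trans ℕ.z≤n (Subset.x∈p⇒∣p-x∣<∣p∣ (Subset.x∈p∧x≢y⇒x∈p-y j∈ (i≢j ∘ sym))))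
  (Subset.x∈p⇒∣p-x∣<∣p∣ {x = i} {p = p} i∈)

-- Fibres of assignments as sets of stubs

module _ {N k : ℕ} where

  fibre : (Fin N → Fin k) → Fin k → Subset N
  fibre f a = Vec.tabulate λ i → does (f i Fin.≟ a)

  ∈-fibre : ∀ f {i a} → f i ≡ a → i ∈ fibre f a
  ∈-fibre f {i} {a} eq = Vec.lookup⇒[]= i (fibre f a)
    (trans (Vec.lookup∘tabulate (λ i → does (f i Fin.≟ a)) i) (does-true (f i Fin.≟ a) eq))
    where
    does-true : ∀ {P : Set} (P? : Dec P) → P → does P? ≡ true
    does-true (yes _) _ = refl
    does-true (no ¬p) p = contradiction p ¬p

  fibre-∈ : ∀ f {i a} → i ∈ fibre f a → f i ≡ a
  fibre-∈ f {i} {a} i∈ = true-does (f i Fin.≟ a)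
    (trans (sym (Vec.lookup∘tabulate (λ i → does (f i Fin.≟ a)) i)) (Vec.[]=⇒lookup i∈))
    where
    true-does : ∀ {P : Set} (P? : Dec P) → does P? ≡ true → P
    true-does (yes p) _ = p
    true-does (no _)  ()

  fibre-cong : ∀ {f g a} → (∀ i → f i ≡ a → g i ≡ a) → (∀ i → g i ≡ a → f i ≡ a) → fibre f a ≡ fibre g a
  fibre-cong {f} {g} {a} f⇒g g⇒f = Subset.⊆-antisym (λ i∈ → ∈-fibre g (f⇒g _ (fibre-∈ f i∈)))
                                                     (λ i∈ → ∈-fibre f (g⇒f _ (fibre-∈ g i∈)))

  ∣fibre∣≡load : ∀ f a → ∣ fibre f a ∣ ≡ load f a
  ∣fibre∣≡load f a = ∣tabulate∣ (λ i → f i Fin.≟ a)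
    where
    ∣tabulate∣ : ∀ {N} {P : Fin N → Set} (P? : Unary.Decidable P) → ∣ Vec.tabulate (does ∘ P?) ∣ ≡ sum (𝟙 ∘ P?)
    ∣tabulate∣ {zero}  P? = refl
    ∣tabulate∣ {suc N} P? with P? zero
    ... | yes _ = cong suc (∣tabulate∣ (P? ∘ suc))
    ... | no  _ = ∣tabulate∣ (P? ∘ suc)

  exchange-fibre : ∀ f {i j a} → f i ≢ a → f j ≢ a → fibre (exchange i j f) a ≡ fibre f a
  exchange-fibre f {i} {j} {a} fi≢a fj≢a = fibre-cong (λ l → forth l (l Fin.≟ i) (l Fin.≟ j)) back
    where
    forth : ∀ l → Dec (l ≡ i) → Dec (l ≡ j) → exchange i j f l ≡ a → f l ≡ a
    forth l (yes refl) _          eq = contradiction (trans (sym (exchange-first i j f)) eq) fj≢a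
    forth l (no _)     (yes refl) eq = contradiction (trans (sym (exchange-second i j f)) eq) fi≢a
    forth l (no l≢i)   (no l≢j)   eq = trans (sym (exchange-other f l≢i l≢j)) eq
    back : ∀ l → f l ≡ a → exchange i j f l ≡ a
    back l eq = trans (exchange-other f (λ { refl → fi≢a eq }) (λ { refl → fj≢a eq })) eq

  lookup-fibres : ∀ f a b l → Vec.lookup (fromSubset (fibre f a) ⊎ᵐ fromSubset (fibre f b)) l ≡
                              𝟙 (f l Fin.≟ a) ℕ.+ 𝟙 (f l Fin.≟ b)
  lookup-fibres f a b l = trans (Vec.lookup-zipWith ℕ._+_ l (fromSubset (fibre f a)) (fromSubset (fibre f b)))
    (cong₂ ℕ._+_ (lookup-fibre a) (lookup-fibre b))
    where
    lookup-fibre : ∀ a → Vec.lookup (fromSubset (fibre f a)) l ≡ 𝟙 (f l Fin.≟ a)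
    lookup-fibre a = trans (Vec.lookup-map l (λ b → if b then 1 else 0) (fibre f a))
      (cong (λ b → if b then 1 else 0) (Vec.lookup∘tabulate (λ i → does (f i Fin.≟ a)) l))

  -- The multiplicity of `l` in the union is `both (f l)`, and `both` takes the same value at `f i`
  -- and `f j`, the only images that the exchange alters.
  exchange-union : ∀ f i j → fromSubset (fibre f (f i)) ⊎ᵐ fromSubset (fibre f (f j)) ≡
    fromSubset (fibre (exchange i j f) (f i)) ⊎ᵐ fromSubset (fibre (exchange i j f) (f j))
  exchange-union f i j = lookup-ext _ _ λ l → trans (lookup-fibres f (f i) (f j) l)
    (trans (pointwise l (l Fin.≟ i) (l Fin.≟ j)) (sym (lookup-fibres f′ (f i) (f j) l)))
    where
    f′ = exchange i j f
    lookup-ext : ∀ {n} (t u : Multiset n) → (∀ l → Vec.lookup t l ≡ Vec.lookup u l) → t ≡ u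
    lookup-ext t u eq = trans (sym (Vec.tabulate∘lookup t)) (trans (Vec.tabulate-cong eq) (Vec.tabulate∘lookup u))
    both = λ v → 𝟙 (v Fin.≟ f i) ℕ.+ 𝟙 (v Fin.≟ f j)
    both-swap : both (f i) ≡ both (f j)
    both-swap = trans (ℕ.+-comm (𝟙 (f i Fin.≟ f i)) _)
      (cong₂ ℕ._+_ (𝟙-cong (f i Fin.≟ f j) (f j Fin.≟ f i) sym sym)
      (𝟙-cong (f i Fin.≟ f i) (f j Fin.≟ f j) (λ _ → refl) (λ _ → refl)))
    pointwise : ∀ l → Dec (l ≡ i) → Dec (l ≡ j) → both (f l) ≡ both (f′ l)
    pointwise l (yes refl) _ = trans both-swap (cong both (sym (exchange-first i j f)))
    pointwise l (no _) (yes refl) = trans (sym both-swap) (cong both (sym (exchange-second i j f)))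
    pointwise l (no l≢i) (no l≢j) = cong both (sym (exchange-other f l≢i l≢j))

  exchange-size : ∀ f i j a → ∣ fibre f a ∣ ≡ ∣ fibre (exchange i j f) a ∣
  exchange-size f i j a = trans (∣fibre∣≡load f a)
    (trans (sym (load-exchange i j f a)) (sym (∣fibre∣≡load (exchange i j f) a)))

-- Lists indexed by position

tabulate-↭ : ∀ {A : Set} {n} (f : Fin (suc n) → A) p → tabulate f ↭ f p ∷ tabulate (f ∘ punchIn p)
tabulate-↭ f zero = ↭-refl
tabulate-↭ {n = suc n} f (suc p) = ↭-trans (↭.prep (f zero) (tabulate-↭ (f ∘ suc) p)) (↭.swap _ _ ↭-refl)

-- The remainder `r` is literally the same list on both sides, as a shuffle demands.
tabulate-pair : ∀ {A : Set} {n} (f g : Fin n → A) p q → p ≢ q → (∀ l → l ≢ p → l ≢ q → f l ≡ g l) →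
                ∃[ r ] tabulate f ↭ f p ∷ f q ∷ r × tabulate g ↭ g p ∷ g q ∷ r
tabulate-pair {n = suc zero} f g zero zero p≢q _ = contradiction refl p≢q
tabulate-pair {A} {suc (suc n)} f g p q p≢q off = rest f , split f ,
  subst (λ r → tabulate g ↭ g p ∷ g q ∷ r) (List.tabulate-cong λ l → sym (off _ (Fin.punchInᵢ≢i p _) (avoids l)))
    (split g)
  where
  q′ = punchOut p≢q
  rest : (Fin (suc (suc n)) → A) → List A
  rest h = tabulate (h ∘ punchIn p ∘ punchIn q′)
  split : ∀ h → tabulate h ↭ h p ∷ h q ∷ rest h
  split h = ↭-trans (tabulate-↭ h p) (↭.prep (h p) (subst (λ l → tabulate (h ∘ punchIn p) ↭ h l ∷ rest h)
    (Fin.punchIn-punchOut p≢q) (tabulate-↭ (h ∘ punchIn p) q′)))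
  avoids : ∀ l → punchIn p (punchIn q′ l) ≢ q
  avoids l eq = Fin.punchInᵢ≢i q′ l (Fin.punchIn-injective p _ _ (trans eq (sym (Fin.punchIn-punchOut p≢q))))

tabulate-injective : ∀ {A : Set} {n} {f g : Fin n → A} → tabulate f ≡ tabulate g → f ≗ g
tabulate-injective eq zero    = List.∷-injectiveˡ eq
tabulate-injective eq (suc i) = tabulate-injective (List.∷-injectiveʳ eq) i

length-filter-tabulate : ∀ {A : Set} {P : A → Set} (P? : Unary.Decidable P) {n} (f : Fin n → A) →
                         length (filter P? (tabulate f)) ≡ sum (λ p → 𝟙 (P? (f p)))
length-filter-tabulate P? {zero}  f = refl
length-filter-tabulate P? {suc n} f with P? (f zero)
... | yes _ = cong suc (length-filter-tabulate P? (f ∘ suc))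
... | no  _ = length-filter-tabulate P? (f ∘ suc)

unique-position : ∀ {A : Set} {P : A → Set} (P? : Unary.Decidable P) xs → length (filter P? xs) ≡ 1 →
                  ∃[ p ] P (lookup xs p) × (∀ q → P (lookup xs q) → q ≡ p)
unique-position {P = P} P? (x ∷ xs) one with P? x
... | yes px = zero , px , λ where
  zero    _  → refl
  (suc q) Pq → contradiction (ℕ.suc-injective one)
    (ℕ.>⇒≢ (List.filter-some P? (lose (∈-lookup {xs = xs} q) Pq)))
... | no ¬px with unique-position P? xs one
...   | p , Pp , uniq = suc p , Pp , λ where
  zero    Px → contradiction Px ¬px
  (suc q) Pq → cong suc (uniq q Pq)

simple⇒nondegenerate : ∀ {n k} (deg : Vec ℕ n) {f : Fin (Vec.sum deg) → Fin k} → Simple (owner deg) f →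
                       ∀ a v → ¬ (2 ℕ.≤ Vec.lookup (vertices deg (fibre f a)) v)
simple⇒nondegenerate deg {f} simple a v 2≤ with 1<∣p∣⇒two (fibre f a ∩ stubs deg v)
  (subst (2 ℕ.≤_) (Vec.lookup∘tabulate (λ v → ∣ fibre f a ∩ stubs deg v ∣) v) 2≤)
... | i , j , i≢j , i∈ , j∈ = i≢j (simple
  (trans (fibre-∈ f (proj₁ (split i∈))) (sym (fibre-∈ f (proj₁ (split j∈)))))
  (trans (∈-stubs⇒owner deg (proj₂ (split i∈))) (sym (∈-stubs⇒owner deg (proj₂ (split j∈))))))
  where
  split : ∀ {i} → i ∈ fibre f a ∩ stubs deg v → i ∈ fibre f a × i ∈ stubs deg v
  split = Subset.x∈p∩q⁻ (fibre f a) (stubs deg v)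

nondegenerate⇒simple : ∀ {n k} (deg : Vec ℕ n) {f : Fin (Vec.sum deg) → Fin k} →
                       (∀ a v → ¬ (2 ℕ.≤ Vec.lookup (vertices deg (fibre f a)) v)) → Simple (owner deg) f
nondegenerate⇒simple deg {f} nondeg {i} {j} fi≡fj ow with i Fin.≟ j
... | yes i≡j = i≡j
... | no  i≢j = contradiction
  (subst (2 ℕ.≤_) (sym (Vec.lookup∘tabulate (λ v → ∣ fibre f (f i) ∩ stubs deg v ∣) v))
    (two⇒1<∣p∣ i≢j
      (Subset.x∈p∩q⁺ (∈-fibre f refl , ∈-stubs-owner deg i))
      (Subset.x∈p∩q⁺ (∈-fibre f (sym fi≡fj) , subst (λ v → j ∈ stubs deg v) (sym ow) (∈-stubs-owner deg j)))))
  (nondeg (f i) v)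
  where v = owner deg i

⟶-cong : ∀ {u v l l′} → (∀ k → u k ≡ v k) → l ≡ l′ → u ⟶ l → v ⟶ l′
⟶-cong u≡v refl conv ε 0<ε = proj₁ (conv ε 0<ε) , λ k K≤k →
  subst (λ q → ℚ.∣ q ℚ.- _ ∣ ℚ.< ε) (u≡v k) (proj₂ (conv ε 0<ε) k K≤k)

-- Hypergraphs as pairs of assignments

module Connectivity (𝐝 : DegreeSequence) where

  open DegreeSequence 𝐝
  open Stub 𝐝
  open Shuffling 𝐝

  arc : ∀ {k} → (Fin OutStubs → Fin k) → (Fin InStubs → Fin k) → Fin k → Hyperarc
  arc f g a = fibre f a , fibre g a

  build : ∀ {k} → (Fin OutStubs → Fin k) → (Fin InStubs → Fin k) → Hypergraph
  build f g = tabulate (arc f g)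

  Avoids : List Feature → Hypergraph → Set
  Avoids x H = ∀ φ → φ ∉ x → ¬ Has φ (map underlying H)

  -- Each stub lies in exactly one hyperarc, so membership is the graph of a map from stubs to
  -- positions.
  position : ∀ {N} {side : Hyperarc → Subset N} (H : Hypergraph) →
             (∀ i → length (filter (λ a → i ∈? side a) H) ≡ 1) →
             ∃[ f ] (∀ p → fibre f p ≡ side (lookup H p))
  position {side = side} H one = f , λ p → Subset.⊆-antisym
    (λ {i} i∈ → subst (λ p → i ∈ side (lookup H p)) (fibre-∈ f i∈) (proj₁ (proj₂ (unique i))))
    (λ {i} i∈ → ∈-fibre f (sym (proj₂ (proj₂ (unique i)) p i∈)))
    where
    unique = λ i → unique-position (λ a → i ∈? side a) H (one i)
    f = λ i → proj₁ (unique i)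

  decode : ∀ {k} H → length H ≡ k → HasDegrees H → ∃[ f ] ∃[ g ] build {k} f g ≡ H
  decode H refl deg = f , g , trans
    (List.tabulate-cong λ p → cong₂ _,_ (proj₂ (position {side = tail} H (HasDegrees.tails deg)) p)
                                        (proj₂ (position {side = head} H (HasDegrees.heads deg)) p))
    (List.tabulate-lookup H)
    where
    f = proj₁ (position {side = tail} H (HasDegrees.tails deg))
    g = proj₁ (position {side = head} H (HasDegrees.heads deg))

  build-loads : ∀ {k} (f f′ : Fin OutStubs → Fin k) g g′ → map size (build f g) ≡ map size (build f′ g′) →
                (∀ a → load f a ≡ load f′ a) × (∀ a → load g a ≡ load g′ a)
  build-loads f f′ g g′ eq =
    (λ a → trans (sym (∣fibre∣≡load f a)) (trans (cong proj₁ (sizes≡ a)) (∣fibre∣≡load f′ a))) ,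
    (λ a → trans (sym (∣fibre∣≡load g a)) (trans (cong proj₂ (sizes≡ a)) (∣fibre∣≡load g′ a)))
    where
    sizes≡ : ∀ a → size (arc f g a) ≡ size (arc f′ g′ a)
    sizes≡ = tabulate-injective (trans (sym (List.map-tabulate (arc f g) size))
      (trans eq (List.map-tabulate (arc f′ g′) size)))

  -- Any pair of assignments uses each stub exactly once; only the sizes depend on the assignments,
  -- and they are the loads.
  build-degrees : ∀ {k} (f f′ : Fin OutStubs → Fin k) g g′ → (∀ a → load f a ≡ load f′ a) →
                  (∀ a → load g a ≡ load g′ a) → HasDegrees (build f g) → HasDegrees (build f′ g′)
  build-degrees {k} f f′ g g′ loads-f loads-g deg = mkHasDegrees
    (λ i → trans (length-filter-tabulate (λ a → i ∈? tail a) (arc f′ g′)) (used-once f′ i))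
    (λ i → trans (length-filter-tabulate (λ a → i ∈? head a) (arc f′ g′)) (used-once g′ i))
    (subst (_↭ δ) same-sizes (HasDegrees.sizes deg))
    where
    used-once : ∀ {N} (f : Fin N → Fin k) i → sum (λ p → 𝟙 (i ∈? fibre f p)) ≡ 1
    used-once f i = ℕ.≤-antisym
      (sum-𝟙≤1 (λ p → i ∈? fibre f p) (λ i∈ i∈′ → trans (sym (fibre-∈ f i∈)) (fibre-∈ f i∈′)))
      (ℕ.≤-trans (ℕ.≤-reflexive (sym (𝟙-yes (i ∈? fibre f (f i)) (∈-fibre f refl))))
        (≤-sum (λ p → 𝟙 (i ∈? fibre f p)) (f i)))
    same-size : ∀ {N} (f f′ : Fin N → Fin k) → (∀ a → load f a ≡ load f′ a) →
                ∀ a → ∣ fibre f a ∣ ≡ ∣ fibre f′ a ∣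
    same-size f f′ loads a = trans (∣fibre∣≡load f a) (trans (loads a) (sym (∣fibre∣≡load f′ a)))
    same-sizes : map size (build f g) ≡ map size (build f′ g′)
    same-sizes = trans (List.map-tabulate (arc f g) size) (trans
      (List.tabulate-cong λ a → cong₂ _,_ (same-size f f′ loads-f a) (same-size g g′ loads-g a))
      (sym (List.map-tabulate (arc f′ g′) size)))

  -- Owners of the stubs for which the allowed features say exactly that no
  -- hyperarc contains two stubs of the same owner in its tail or in its head.
  record Ownership (x : List Feature) : Set where
    field
      {nᵒ nⁱ}       : ℕ
      ownerᵒ        : Fin OutStubs → Fin nᵒ
      ownerⁱ        : Fin InStubs → Fin nⁱ
      ownerᵒ-mono   : ∀ {i j} → i Fin.≤ j → ownerᵒ i Fin.≤ ownerᵒ j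
      ownerⁱ-mono   : ∀ {i j} → i Fin.≤ j → ownerⁱ i Fin.≤ ownerⁱ j
      avoids⇒simple : ∀ {k} {f : Fin OutStubs → Fin k} {g} → Avoids x (build f g) →
                      Simple ownerᵒ f × Simple ownerⁱ g
      simple⇒avoids : ∀ {k} {f : Fin OutStubs → Fin k} {g} → Simple ownerᵒ f → Simple ownerⁱ g →
                      Avoids x (build f g)

  -- With every stub its own owner, simplicity holds for every assignment.
  unrestricted : Ownership (s ∷ d ∷ m ∷ [])
  unrestricted = record
    { ownerᵒ = λ i → i ; ownerⁱ = λ i → i ; ownerᵒ-mono = λ i≤j → i≤j ; ownerⁱ-mono = λ i≤j → i≤j
    ; avoids⇒simple = λ _ → (λ _ eq → eq) , (λ _ eq → eq)
    ; simple⇒avoids = λ _ _ → λ where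
        s s∉ _ → s∉ (here refl)
        d d∉ _ → d∉ (there (here refl))
        m m∉ _ → m∉ (there (there (here refl)))
    }

  nondegenerate : Ownership (s ∷ m ∷ [])
  nondegenerate = record
    { ownerᵒ = owner dᵒᵘᵗ ; ownerⁱ = owner dⁱⁿ ; ownerᵒ-mono = owner-mono dᵒᵘᵗ ; ownerⁱ-mono = owner-mono dⁱⁿ
    ; avoids⇒simple = λ {_} {f} {g} avoids →
        let avoids-d = avoids d λ { (there (here ())) ; (there (there ())) } in
        nondegenerate⇒simple dᵒᵘᵗ (λ a v 2≤ → avoids-d (Any.map⁺ (Any.tabulate⁺ a (v , inj₁ 2≤)))) ,
        nondegenerate⇒simple dⁱⁿ (λ a v 2≤ → avoids-d (Any.map⁺ (Any.tabulate⁺ a (v , inj₂ 2≤))))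
    ; simple⇒avoids = λ {_} {f} {g} simple-f simple-g → λ where
        s s∉ _   → s∉ (here refl)
        m m∉ _   → m∉ (there (here refl))
        d _  has → case Any.tabulate⁻ (Any.map⁻ has) of λ where
          (a , v , inj₁ 2≤) → simple⇒nondegenerate dᵒᵘᵗ simple-f a v 2≤
          (a , v , inj₂ 2≤) → simple⇒nondegenerate dⁱⁿ simple-g a v 2≤
    }

  -- Self-loops and multi-hyperarcs are allowed in both spaces, so at most degeneracy has to be
  -- carried along the permutation.
  avoids-↭ : ∀ {x H K} → (x ≡ s ∷ d ∷ m ∷ []) ⊎ (x ≡ s ∷ m ∷ []) → H ↭ K → Avoids x H → Avoids x K
  avoids-↭ (inj₁ refl) p avoids s s∉ _   = s∉ (here refl)
  avoids-↭ (inj₁ refl) p avoids d d∉ _   = d∉ (there (here refl))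
  avoids-↭ (inj₁ refl) p avoids m m∉ _   = m∉ (there (there (here refl)))
  avoids-↭ (inj₂ refl) p avoids s s∉ _   = s∉ (here refl)
  avoids-↭ (inj₂ refl) p avoids m m∉ _   = m∉ (there (here refl))
  avoids-↭ (inj₂ refl) p avoids d d∉ has = avoids d d∉ (Any-resp-↭ (↭-sym (map⁺ underlying p)) has)

-- Irreducibility and convergence

module Convergence (𝐝 : DegreeSequence) (2≤ : 2 ℕ.≤ length (DegreeSequence.δ 𝐝)) (x : List Feature)
  (ownership : Connectivity.Ownership 𝐝 x)
  (𝓗-↭ : ∀ {H K} → H ↭ K → Stub.𝓗 𝐝 x H → Stub.𝓗 𝐝 x K) where

  open DegreeSequence 𝐝
  open Stub 𝐝
  open Shuffling 𝐝
  open Connectivity 𝐝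
  open Ownership ownership
  open ShuffleChain 𝐝 2≤ x 𝓗-↭
  open UniformChain chain using (Minorises; minorises-trans; converges)

  Reaches : Hypergraph → Hypergraph → Set
  Reaches H K = ∃[ j ] Minorises j H K

  reaches-↭ : ∀ {H K} → H ↭ K → Reaches H K
  reaches-↭ p = 0 , 1ℚ , 0<1 , λ {f} inv _ → ℚ.≤-reflexive (trans (ℚ.*-identityˡ _) (inv (↭-sym p)))

  reaches-trans : ∀ {H K L} → Reaches H K → Reaches K L → Reaches H L
  reaches-trans (j , H≥K) (k , K≥L) = j ℕ.+ k , minorises-trans {j} {k} H≥K K≥L

  k : ℕ
  k = length δ

  module Tails = Assignments ownerᵒ ownerᵒ-mono k
  module Heads = Assignments ownerⁱ ownerⁱ-mono k

  shuffle-reaches : ∀ (A B : Fin k → Hyperarc) p q → p ≢ q → (∀ l → l ≢ p → l ≢ q → A l ≡ B l) →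
                    (A p , A q) ⇝ (B p , B q) →
                    𝓗 x (tabulate A) → 𝓗 x (tabulate B) → Reaches (tabulate A) (tabulate B)
  shuffle-reaches A B p q p≢q off ⇝B 𝓗A 𝓗B = reaches-trans
    (1 , shuffle-minorises {a = A p} {A q} {r} {B p} {B q} A↭ ⇝B 𝓗A (𝓗-↭ B↭ 𝓗B)) (reaches-↭ (↭-sym B↭))
    where
    pair = tabulate-pair A B p q p≢q off
    r  = proj₁ pair
    A↭ = proj₁ (proj₂ pair)
    B↭ = proj₂ (proj₂ pair)

  record Valid (f : Fin OutStubs → Fin k) (g : Fin InStubs → Fin k) : Set where
    constructor valid
    field
      degrees  : HasDegrees (build f g)
      simple-f : Simple ownerᵒ f
      simple-g : Simple ownerⁱ g

  valid⇒𝓗 : ∀ f g → Valid f g → 𝓗 x (build f g)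
  valid⇒𝓗 f g (valid degrees simple-f simple-g) = degrees , simple⇒avoids {f = f} {g} simple-f simple-g

  𝓗⇒valid : ∀ f g → 𝓗 x (build f g) → Valid f g
  𝓗⇒valid f g (degrees , avoids) = valid degrees (proj₁ simple) (proj₂ simple)
    where simple = avoids⇒simple {f = f} {g} avoids

  exchange-tails-valid : ∀ f g i j → Simple ownerᵒ (exchange i j f) → Valid f g → Valid (exchange i j f) g
  exchange-tails-valid f g i j simple (valid degrees _ simple-g) =
    valid (build-degrees f (exchange i j f) g g (λ a → sym (load-exchange i j f a)) (λ _ → refl) degrees)
          simple simple-g

  exchange-heads-valid : ∀ f g i j → Simple ownerⁱ (exchange i j g) → Valid f g → Valid f (exchange i j g)
  exchange-heads-valid f g i j simple (valid degrees simple-f _) =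
    valid (build-degrees f f g (exchange i j g) (λ _ → refl) (λ a → sym (load-exchange i j g a)) degrees)
          simple-f simple

  -- Both directions are recorded because a `right` exchange is traversed backwards.
  exchange-tails : ∀ f g i j → f i ≢ f j → Valid f g → Valid (exchange i j f) g →
    Reaches (build f g) (build (exchange i j f) g) × Reaches (build (exchange i j f) g) (build f g)
  exchange-tails f g i j fi≢fj v v′ =
    shuffle-reaches A B (f i) (f j) fi≢fj (λ l ≢i ≢j → sym (off l ≢i ≢j)) ⇝B
      (valid⇒𝓗 f g v) (valid⇒𝓗 (exchange i j f) g v′) ,
    shuffle-reaches B A (f i) (f j) fi≢fj off (⇝-sym {A (f i) , A (f j)} {B (f i) , B (f j)} ⇝B)
      (valid⇒𝓗 (exchange i j f) g v′) (valid⇒𝓗 f g v)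
    where
    A = arc f g
    B = arc (exchange i j f) g
    off : ∀ l → l ≢ f i → l ≢ f j → B l ≡ A l
    off l ≢i ≢j = cong (_, fibre g l) (exchange-fibre f (≢i ∘ sym) (≢j ∘ sym))
    ⇝B : (A (f i) , A (f j)) ⇝ (B (f i) , B (f j))
    ⇝B = exchange-union f i j , refl ,
      cong (_, _) (exchange-size f i j (f i)) , cong (_, _) (exchange-size f i j (f j))

  exchange-heads : ∀ f g i j → g i ≢ g j → Valid f g → Valid f (exchange i j g) →
    Reaches (build f g) (build f (exchange i j g)) × Reaches (build f (exchange i j g)) (build f g)
  exchange-heads f g i j gi≢gj v v′ =
    shuffle-reaches A B (g i) (g j) gi≢gj (λ l ≢i ≢j → sym (off l ≢i ≢j)) ⇝B
      (valid⇒𝓗 f g v) (valid⇒𝓗 f (exchange i j g) v′) ,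
    shuffle-reaches B A (g i) (g j) gi≢gj off (⇝-sym {A (g i) , A (g j)} {B (g i) , B (g j)} ⇝B)
      (valid⇒𝓗 f (exchange i j g) v′) (valid⇒𝓗 f g v)
    where
    A = arc f g
    B = arc f (exchange i j g)
    off : ∀ l → l ≢ g i → l ≢ g j → B l ≡ A l
    off l ≢i ≢j = cong (fibre f l ,_) (exchange-fibre g (≢i ∘ sym) (≢j ∘ sym))
    ⇝B : (A (g i) , A (g j)) ⇝ (B (g i) , B (g j))
    ⇝B = refl , exchange-union g i j ,
      cong (_ ,_) (exchange-size g i j (g i)) , cong (_ ,_) (exchange-size g i j (g j))

  fibre-≗ : ∀ {N} {f g : Fin N → Fin k} → f ≗ g → ∀ a → fibre f a ≡ fibre g a
  fibre-≗ eq a = fibre-cong (λ i fi≡a → trans (sym (eq i)) fi≡a) (λ i gi≡a → trans (eq i) gi≡a)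

  reaches-tails : ∀ f f′ g → f Tails.↭ᵃ f′ → Valid f g → Valid f′ g → Reaches (build f g) (build f′ g)
  reaches-tails f f′ g (Tails.done f≗f′) _ _ =
    reaches-↭ (↭-reflexive (List.tabulate-cong λ a → cong (_, fibre g a) (fibre-≗ {f = f} {f′} f≗f′ a)))
  reaches-tails f f′ g (Tails.left {i = i} {j} fi≢fj simple p) v v′ =
    let w = exchange-tails-valid f g i j simple v
    in reaches-trans (proj₁ (exchange-tails f g i j fi≢fj v w)) (reaches-tails (exchange i j f) f′ g p w v′)
  reaches-tails f f′ g (Tails.right {i = i} {j} fi≢fj simple p) v v′ =
    let w = exchange-tails-valid f′ g i j simple v′
    in reaches-trans (reaches-tails f (exchange i j f′) g p v w) (proj₂ (exchange-tails f′ g i j fi≢fj v′ w))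

  reaches-heads : ∀ f g g′ → g Heads.↭ᵃ g′ → Valid f g → Valid f g′ → Reaches (build f g) (build f g′)
  reaches-heads f g g′ (Heads.done g≗g′) _ _ =
    reaches-↭ (↭-reflexive (List.tabulate-cong λ a → cong (fibre f a ,_) (fibre-≗ {f = g} {g′} g≗g′ a)))
  reaches-heads f g g′ (Heads.left {i = i} {j} gi≢gj simple p) v v′ =
    let w = exchange-heads-valid f g i j simple v
    in reaches-trans (proj₁ (exchange-heads f g i j gi≢gj v w)) (reaches-heads f (exchange i j g) g′ p w v′)
  reaches-heads f g g′ (Heads.right {i = i} {j} gi≢gj simple p) v v′ =
    let w = exchange-heads-valid f g′ i j simple v′
    in reaches-trans (reaches-heads f g (exchange i j g′) p v w) (proj₂ (exchange-heads f g′ i j gi≢gj v′ w))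

  -- The path passes through the hypergraph with the tails of the target and the heads of the
  -- source. It lies in the space because simplicity constrains tails and heads separately; a ban on
  -- self-loops or multi-hyperarcs would couple them.
  reaches-build : ∀ f f′ g g′ → Valid f g → Valid f′ g′ → map size (build f g) ≡ map size (build f′ g′) →
                  Reaches (build f g) (build f′ g′)
  reaches-build f f′ g g′ v@(valid deg simple-f simple-g) v′@(valid _ simple-f′ simple-g′) sizes =
    reaches-trans (reaches-tails f f′ g (Tails.connected simple-f simple-f′ (proj₁ loads)) v middle)
                  (reaches-heads f′ g g′ (Heads.connected simple-g simple-g′ (proj₂ loads)) middle v′)
    where
    loads = build-loads f f′ g g′ sizes
    middle : Valid f′ g
    middle = valid (build-degrees f f′ g g (proj₁ loads) (λ _ → refl) deg) simple-f′ simple-g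

  irreducible : ∀ {H K} → 𝓗 x H → 𝓗 x K → Reaches H K
  irreducible {H} {K} 𝓗H 𝓗K
    -- The sizes of `H` and `K` agree only up to order. Rearranging `K` into `K′` aligns them
    -- position by position, which gives the assignments equal loads.
    with ↭-map-inv size (↭-trans (HasDegrees.sizes (proj₁ 𝓗K)) (↭-sym (HasDegrees.sizes (proj₁ 𝓗H))))
  ... | K′ , sizes , K↭K′ = reaches-trans reaches (reaches-↭ (↭-sym K↭K′))
    where
    𝓗K′ : 𝓗 x K′
    𝓗K′ = 𝓗-↭ K↭K′ 𝓗K
    reaches : Reaches H K′
    reaches = go (decode H (𝓗-length 𝓗H) (proj₁ 𝓗H)) (decode K′ (𝓗-length 𝓗K′) (proj₁ 𝓗K′)) 𝓗H 𝓗K′ sizes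
      where
      go : ∀ {H K} → ∃[ f ] ∃[ g ] build {k} f g ≡ H → ∃[ f ] ∃[ g ] build {k} f g ≡ K → 𝓗 x H → 𝓗 x K →
           map size H ≡ map size K → Reaches H K
      go (f , g , refl) (f′ , g′ , refl) 𝓗H 𝓗K = reaches-build f f′ g g′ (𝓗⇒valid f g 𝓗H) (𝓗⇒valid f′ g′ 𝓗K)

  -- The state `H₀` makes `els` nonempty, so `weight els` is the reciprocal of its length; the limit
  -- of the expectation of `hit` is then its mean over `els`, the uniform probability of `T`.
  outcome-uniform : ∀ H₀ → 𝓗 x H₀ → (λ j → outcome x j H₀) ⟶ᵈ uniform (elements x)
  outcome-uniform H₀ 𝓗H₀ T = ⟶-cong
    (λ j → sym (trans (Pr≡𝔼 (_↭? T) (outcome x j H₀)) (outcome-𝔼 j H₀ hit)))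
    (sym (trans (Pr≡𝔼 (_↭? T) (uniform els)) (𝔼-uniform els hit)))
    (converges irreducible hit-inv (length-*-weight (proj₁ (proj₂ (𝓗⊆els 𝓗H₀)))) 𝓗H₀)
    where
    hit : Hypergraph → ℚ
    hit H = ⟦ H ↭? T ⟧
    hit-inv : Inv hit
    hit-inv {H} {K} p = ⟦⟧-cong (H ↭? T) (K ↭? T) (↭-trans (↭-sym p)) (↭-trans p)

open import Data.Nat using (_≤_)

theorem1 : (𝐝 : DegreeSequence) → 2 ≤ length (DegreeSequence.δ 𝐝) →
    (x : List Feature) → (x ≡ s ∷ d ∷ m ∷ []) ⊎ (x ≡ s ∷ m ∷ []) →
    let open Stub 𝐝 in
    (H₀ : Hypergraph) → 𝓗 x H₀ →
    (λ k → outcome x k H₀) ⟶ᵈ uniform (elements x)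
theorem1 𝐝 2≤ x x≡ = Convergence.outcome-uniform 𝐝 2≤ x (ownership x≡) λ p (deg , avoids) →
  HasDegrees-↭ p deg , avoids-↭ x≡ p avoids
  where
  open Shuffling 𝐝
  open Connectivity 𝐝
  ownership : (x ≡ s ∷ d ∷ m ∷ []) ⊎ (x ≡ s ∷ m ∷ []) → Ownership x
  ownership (inj₁ refl) = unrestricted
  ownership (inj₂ refl) = nondegenerate
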